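{- For every fixed integer $s\ge 1$, as $n\to\infty$, $$\beta_s(n)=2^{s}n^{s}\log^{s}n+2^{s}s(\gamma-2)\,n^{s}\log^{s-1}n+O\!\left(n^{s}\log^{s-2}n\right),$$ where $\beta_s(n)=\sum_{k\ge 0}(k)_s\,\frac{a_{n,k}}{n!}$ is the $s$th factorial moment of the number of comparisons used by the quick sort algorithm on a uniformly random permutation of $\{1,\dots,n\}$.
   Context: $S_n$ is the set of all $n!$ permutations of $\{1,\dots,n\}$; inputs of size $n$ to quick sort are permutations in $S_n$, each occurring with probability $1/n!$. $a_{n,k}$ is the number of permutations in $S_n$ for which the basic quick sort algorithm makes exactly $k$ comparisons in total. Basic quick sort on a list of $n\ge 1$ distinct elements takes the first element as pivot, compares it with each of the other $n-1$ elements (using $n-1$ comparisons), splits these into the list of elements smaller than the pivot and the list of elements larger than the pivot (each kept in its original relative order), and recursively sorts both lists; the empty list needs $0$ comparisons. Equivalently, the probability generating functions $G_n(z)=\sum_{k\ge 0}\frac{a_{n,k}}{n!}z^k$ are determined by $G_0(z)=1$ and $G_n(z)=\frac{z^{n-1}}{n}\sum_{1\le j\le n}G_{n-j}(z)\,G_{j-1}(z)$ for $n\ge 1$. $(k)_s=k(k-1)\cdots(k-s+1)$ is the falling factorial, with $(k)_0=1$. $\gamma=0.577\cdots$ is Euler's constant, $\log$ is the natural logarithm, and $\log^{j}n=(\log n)^j$ (with $j$ possibly negative). The implied constant in $O(\cdot)$ may depend on $s$. -}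

module Defs where

open import Data.Nat.Base as ℕ
  using (ℕ; zero; suc; NonZero; NonTrivial; nonTrivial⇒nonZero; _!)
import Data.Nat.Properties as ℕ
open import Data.Nat.Combinatorics using (_P_)
open import Data.Integer.Base as ℤ using (ℤ; +_; -[1+_])
import Data.Integer.Properties as ℤ
open import Data.Rational.Base as ℚ using (ℚ; 0ℚ; 1ℚ; ½; mkℚ)
import Data.Rational.Properties as ℚ
open import Data.Rational.Unnormalised.Base as ℚᵘ using (mkℚᵘ)
import Data.Rational.Unnormalised.Properties as ℚᵘ
import Data.Rational.Solver as ℚ
open import Data.Fin.Base using (Fin; toℕ)
open import Data.List.Base
  using (List; []; _∷_; _++_; map; concatMap; filter; length; upTo)
open import Data.List.Properties using (length-filter; filter-none; filter-accept; filter-reject;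
         length-map; length-upTo)
open import Data.List.Membership.Propositional using (_∈_; _∉_; find; lose)
open import Data.List.Membership.Propositional.Properties
  using (∈-map⁻; ∈-map⁺; ∈-concatMap⁺; ∈-concatMap⁻; ∈-∃++)
open import Data.List.Relation.Unary.Any using (here; there)
open import Data.List.Relation.Unary.All as All using (All; []; _∷_)
import Data.List.Relation.Unary.All.Properties as All
open import Data.List.Relation.Unary.AllPairs using ([]; _∷_)
open import Data.List.Relation.Unary.Unique.Propositional using (Unique)
import Data.List.Relation.Unary.Unique.Propositional.Properties as Unique
open import Data.List.Relation.Binary.Permutation.Propositional
  using (_↭_; ↭-refl; ↭-sym; ↭-trans; ↭-prep)
open import Data.List.Relation.Binary.Permutation.Propositional.Properties
  using (shift; drop-mid; ∈-resp-↭; ↭-length; ↭-empty-inv)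
open import Data.Product using (Σ; ∃; ∃-syntax; _×_; _,_; proj₁; proj₂)
open import Data.Sum using (inj₁; inj₂)
open import Relation.Binary.Definitions using (tri<; tri≈; tri>)
open import Relation.Nullary using (¬_; yes; no; contradiction)
open import Relation.Binary.PropositionalEquality
  using (_≡_; refl; sym; trans; cong; cong₂; subst; subst₂)
open import Algebra.Properties.Monoid.Sum ℚ.+-0-monoid using (sum-syntax)

module Rational where
  open import Data.Rational.Base using (_+_; _*_; _-_; -_; ∣_∣; _≤_; _<_; _/_; 1/_;
    positive; nonNegative)
  open ℚ.+-*-Solver using (solve; _:=_; _:+_; _:*_; _:-_; :-_)
  open ℚ.≤-Reasoning

  dist-sym : ∀ a b → ∣ a - b ∣ ≡ ∣ b - a ∣
  dist-sym a b = trans (cong ∣_∣ (solve 2 (λ a b → a :- b := :- (b :- a)) refl a b))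
                       (ℚ.∣-p∣≡∣p∣ (b - a))

  dist-triangle : ∀ a b c → ∣ a - c ∣ ≤ ∣ a - b ∣ + ∣ b - c ∣
  dist-triangle a b c = subst (λ t → ∣ t ∣ ≤ ∣ a - b ∣ + ∣ b - c ∣)
    (solve 3 (λ a b c → (a :- b) :+ (b :- c) := a :- c) refl a b c)
    (ℚ.∣p+q∣≤∣p∣+∣q∣ (a - b) (b - c))

  dist-refl : ∀ a → ∣ a - a ∣ ≡ 0ℚ
  dist-refl a = cong ∣_∣ (ℚ.+-inverseʳ a)

  ∣∣-≤ : ∀ {a b} → a ≤ b → - a ≤ b → ∣ a ∣ ≤ b
  ∣∣-≤ {a} {b} p q with ℚ.∣p∣≡p∨∣p∣≡-p a
  ... | inj₁ e = subst (_≤ b) (sym e) p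
  ... | inj₂ e = subst (_≤ b) (sym e) q

  0≤∣∣ : ∀ a → 0ℚ ≤ ∣ a ∣
  0≤∣∣ a = ℚ.nonNegative⁻¹ ∣ a ∣ {{ℚ.∣-∣-nonNeg a}}

  a≤∣a∣ : ∀ a → a ≤ ∣ a ∣
  a≤∣a∣ a with ℚ.≤-total 0ℚ a
  ... | inj₁ p = ℚ.≤-reflexive (sym (ℚ.0≤p⇒∣p∣≡p p))
  ... | inj₂ p = ℚ.≤-trans p (0≤∣∣ a)

  p-q≤r⇒p≤q+r : ∀ {p q r} → p - q ≤ r → p ≤ q + r
  p-q≤r⇒p≤q+r {p} {q} {r} h = subst (_≤ q + r)
    (solve 2 (λ p q → q :+ (p :- q) := p) refl p q) (ℚ.+-monoʳ-≤ q h)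

  p≤q+r⇒p-q≤r : ∀ {p q r} → p ≤ q + r → p - q ≤ r
  p≤q+r⇒p-q≤r {p} {q} {r} h = subst (p - q ≤_)
    (solve 2 (λ q r → (q :+ r) :- q := r) refl q r) (ℚ.+-monoˡ-≤ (- q) h)

  0≤q-p : ∀ {p q} → p ≤ q → 0ℚ ≤ q - p
  0≤q-p {p} {q} h = subst (_≤ q - p) (ℚ.+-inverseʳ p) (ℚ.+-monoˡ-≤ (- p) h)

  ∣∣a∣-∣b∣∣≤∣a-b∣ : ∀ a b → ∣ ∣ a ∣ - ∣ b ∣ ∣ ≤ ∣ a - b ∣
  ∣∣a∣-∣b∣∣≤∣a-b∣ a b = ∣∣-≤ (one a b)
    (subst₂ _≤_ (solve 2 (λ x y → y :- x := :- (x :- y)) refl ∣ a ∣ ∣ b ∣)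
                (dist-sym b a) (one b a))
    where
    one : ∀ a b → ∣ a ∣ - ∣ b ∣ ≤ ∣ a - b ∣
    one a b = p≤q+r⇒p-q≤r (subst (λ t → ∣ t ∣ ≤ ∣ b ∣ + ∣ a - b ∣)
      (solve 2 (λ a b → b :+ (a :- b) := a) refl a b)
      (ℚ.∣p+q∣≤∣p∣+∣q∣ b (a - b)))

  *-mono-≤ : ∀ {a b c d} → 0ℚ ≤ b → 0ℚ ≤ c → a ≤ b → c ≤ d → a * c ≤ b * d
  *-mono-≤ {a} {b} {c} {d} 0≤b 0≤c a≤b c≤d = ℚ.≤-trans
    (ℚ.*-monoʳ-≤-nonNeg c {{nonNegative 0≤c}} a≤b)
    (ℚ.*-monoˡ-≤-nonNeg b {{nonNegative 0≤b}} c≤d)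

  *-pos : ∀ {a b} → 0ℚ < a → 0ℚ < b → 0ℚ < a * b
  *-pos {a} {b} p q = ℚ.positive⁻¹ (a * b)
    {{ℚ.pos*pos⇒pos a {{positive p}} b {{positive q}}}}

  ½-pos : ∀ {ε} → 0ℚ < ε → 0ℚ < ½ * ε
  ½-pos = *-pos (ℚ.positive⁻¹ ½)

  ½+½ : ∀ ε → ½ * ε + ½ * ε ≡ ε
  ½+½ ε = trans (sym (ℚ.*-distribʳ-+ ε ½ ½)) (ℚ.*-identityˡ ε)

  ¼ : ℚ
  ¼ = ½ * ½

  ¼-pos : ∀ {ε} → 0ℚ < ε → 0ℚ < ¼ * ε
  ¼-pos = *-pos (ℚ.positive⁻¹ ¼)

  ¼×4 : ∀ ε → ¼ * ε + (¼ * ε + ¼ * ε) + ¼ * ε ≡ ε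
  ¼×4 ε = trans
    (solve 2 (λ q e → q :* e :+ (q :* e :+ q :* e) :+ q :* e := (q :+ q :+ q :+ q) :* e)
       refl ¼ ε)
    (ℚ.*-identityˡ ε)

  recip : ℚ → ℚ
  recip q with q ℚ.≟ 0ℚ
  ... | yes _   = 0ℚ
  ... | no  q≢0 = (1/ q) {{ℚ.≢-nonZero q≢0}}

  recip-inverse : ∀ {q} → 0ℚ < q → recip q * q ≡ 1ℚ
  recip-inverse {q} 0<q with q ℚ.≟ 0ℚ
  ... | yes q≡0 = contradiction (sym q≡0) (ℚ.<⇒≢ 0<q)
  ... | no  q≢0 = ℚ.*-inverseˡ q {{ℚ.≢-nonZero q≢0}}

  recip-pos : ∀ {q} → 0ℚ < q → 0ℚ < recip q
  recip-pos {q} 0<q with q ℚ.≟ 0ℚ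
  ... | yes q≡0 = contradiction (sym q≡0) (ℚ.<⇒≢ 0<q)
  ... | no  q≢0 = ℚ.positive⁻¹ _ {{ℚ.1/pos⇒pos q {{positive 0<q}}}}

  recip-antimono : ∀ {a b} → 0ℚ < a → a ≤ b → recip b ≤ recip a
  recip-antimono {a} {b} 0<a a≤b = begin
    recip b                  ≡⟨ sym (trans (cong (_* recip b) (recip-inverse 0<a))
                                           (ℚ.*-identityˡ _)) ⟩
    recip a * a * recip b    ≤⟨ ℚ.*-monoʳ-≤-nonNeg (recip b)
                                  {{nonNegative (ℚ.<⇒≤ (recip-pos 0<b))}}
                                  (ℚ.*-monoˡ-≤-nonNeg (recip a)
                                    {{nonNegative (ℚ.<⇒≤ (recip-pos 0<a))}} a≤b) ⟩
    recip a * b * recip b    ≡⟨ solve 3 (λ x b y → x :* b :* y := x :* (y :* b)) refl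
                                  (recip a) b (recip b) ⟩
    recip a * (recip b * b)  ≡⟨ cong (recip a *_) (recip-inverse 0<b) ⟩
    recip a * 1ℚ             ≡⟨ ℚ.*-identityʳ _ ⟩
    recip a                  ∎
    where 0<b = ℚ.<-≤-trans 0<a a≤b

  recip-dist : ∀ {δ a b} → 0ℚ < δ → δ ≤ a → δ ≤ b →
               ∣ recip a - recip b ∣ ≤ recip δ * recip δ * ∣ a - b ∣
  recip-dist {δ} {a} {b} 0<δ δ≤a δ≤b = begin
    ∣ recip a - recip b ∣              ≡⟨ cong ∣_∣ step ⟩
    ∣ recip a * recip b * (b - a) ∣    ≡⟨ ℚ.∣p*q∣≡∣p∣*∣q∣ (recip a * recip b) (b - a) ⟩
    ∣ recip a * recip b ∣ * ∣ b - a ∣  ≡⟨ cong₂ _*_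
                                           (ℚ.0≤p⇒∣p∣≡p (ℚ.<⇒≤ (*-pos 0<ra 0<rb)))
                                           (dist-sym b a) ⟩
    recip a * recip b * ∣ a - b ∣      ≤⟨ ℚ.*-monoʳ-≤-nonNeg _ {{ℚ.∣-∣-nonNeg (a - b)}}
                                           (*-mono-≤ (ℚ.<⇒≤ (recip-pos 0<δ)) (ℚ.<⇒≤ 0<rb)
                                             (recip-antimono 0<δ δ≤a)
                                             (recip-antimono 0<δ δ≤b)) ⟩
    recip δ * recip δ * ∣ a - b ∣      ∎
    where
    0<a  = ℚ.<-≤-trans 0<δ δ≤a
    0<b  = ℚ.<-≤-trans 0<δ δ≤b
    0<ra = recip-pos 0<a
    0<rb = recip-pos 0<b
    step : recip a - recip b ≡ recip a * recip b * (b - a)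
    step = begin-equality
      recip a - recip b
        ≡⟨ cong₂ _-_ {recip a} {recip a * 1ℚ} {recip b} {recip b * 1ℚ}
             (sym (ℚ.*-identityʳ (recip a))) (sym (ℚ.*-identityʳ (recip b))) ⟩
      recip a * 1ℚ - recip b * 1ℚ
        ≡⟨ cong₂ (λ u v → recip a * u - recip b * v)
             (sym (recip-inverse 0<b)) (sym (recip-inverse 0<a)) ⟩
      recip a * (recip b * b) - recip b * (recip a * a)
        ≡⟨ solve 4 (λ x y a b → x :* (y :* b) :- y :* (x :* a) := x :* y :* (b :- a)) refl
             (recip a) (recip b) a b ⟩
      recip a * recip b * (b - a) ∎

  unit : ℕ → ℚ
  unit n = + 1 / suc n

  unit-≃ : ∀ n → ℚ.toℚᵘ (unit n) ℚᵘ.≃ mkℚᵘ (+ 1) n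
  unit-≃ n = ℚ.toℚᵘ-fromℚᵘ (mkℚᵘ (+ 1) n)

  unit-pos : ∀ n → 0ℚ < unit n
  unit-pos n = ℚ.positive⁻¹ (unit n) {{ℚ.normalize-pos 1 (suc n)}}

  unit-antimono : ∀ {m n} → m ℕ.≤ n → unit n ≤ unit m
  unit-antimono {m} {n} m≤n = ℚ.toℚᵘ-cancel-≤
    (ℚᵘ.≤-respˡ-≃ (ℚᵘ.≃-sym (unit-≃ n)) (ℚᵘ.≤-respʳ-≃ (ℚᵘ.≃-sym (unit-≃ m))
      (ℚᵘ.*≤* (ℤ.*-monoˡ-≤-nonNeg (+ 1) (ℤ.+≤+ (ℕ.s≤s m≤n))))))

  archimedean : ∀ ε → 0ℚ < ε → ∃[ N ] (∀ {n} → N ℕ.≤ n → unit n ≤ ε)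
  archimedean ε@(mkℚ (+ suc p) d _) 0<ε = d , λ d≤n → ℚ.≤-trans (unit-antimono d≤n)
    (ℚ.toℚᵘ-cancel-≤ (ℚᵘ.≤-respˡ-≃ (ℚᵘ.≃-sym (unit-≃ d))
      (ℚᵘ.*≤* (ℤ.*-monoʳ-≤-nonNeg (+ suc d) {+ 1} {+ suc p} (ℤ.+≤+ (ℕ.s≤s ℕ.z≤n))))))
  archimedean (mkℚ (+ zero) d _) (ℚ.*<* (ℤ.+<+ ()))
  archimedean (mkℚ -[1+ _ ] d _) (ℚ.*<* ())

open Rational using (recip; unit) public

harmonic : ℕ → ℚ
harmonic zero    = 0ℚ
harmonic (suc n) = harmonic n ℚ.+ unit n

module Harmonic where
  open import Data.Rational.Base using (_+_; _*_; _-_; -_; ∣_∣; _≤_; _/_)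
  open ℚ.+-*-Solver using (solve; _:=_; _:+_; _:*_; _:-_; :-_)
  open ℚ.≤-Reasoning

  nat : ℕ → ℚ
  nat j = + j / 1

  nat-suc : ∀ j → nat (suc j) ≡ nat j + 1ℚ
  nat-suc j = ℚ.toℚᵘ-injective (ℚᵘ.≃-trans (ℚ.toℚᵘ-fromℚᵘ (mkℚᵘ (+ suc j) 0))
    (ℚᵘ.≃-sym (ℚᵘ.≃-trans (ℚ.toℚᵘ-homo-+ (nat j) 1ℚ)
      (ℚᵘ.≃-trans (ℚᵘ.+-congˡ (ℚ.toℚᵘ 1ℚ) (ℚ.toℚᵘ-fromℚᵘ (mkℚᵘ (+ j) 0)))
        (ℚᵘ.*≡* (cong (ℤ._* + 1) (trans (cong (ℤ._+ + 1) (ℤ.*-identityʳ (+ j)))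
                                        (cong +_ (ℕ.+-comm j 1)))))))))

  nat-suc-* : ∀ j q → nat (suc j) * q ≡ nat j * q + q
  nat-suc-* j q = trans (cong (_* q) (nat-suc j))
    (trans (ℚ.*-distribʳ-+ q (nat j) 1ℚ) (cong (λ t → nat j * q + t) (ℚ.*-identityˡ q)))

  nat*unit : ∀ k n → nat (suc k) * unit (k ℕ.+ n ℕ.* suc k) ≡ unit n
  nat*unit k n = ℚ.toℚᵘ-injective
    (ℚᵘ.≃-trans (ℚ.toℚᵘ-homo-* (nat (suc k)) (unit (k ℕ.+ n ℕ.* suc k)))
    (ℚᵘ.≃-trans (ℚᵘ.*-cong (ℚ.toℚᵘ-fromℚᵘ (mkℚᵘ (+ suc k) 0))
                           (Rational.unit-≃ (k ℕ.+ n ℕ.* suc k)))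
    (ℚᵘ.≃-trans (ℚᵘ.*≡* (cong +_ eq)) (ℚᵘ.≃-sym (Rational.unit-≃ n)))))
    where
    eq : suc k ℕ.* 1 ℕ.* suc n ≡ 1 ℕ.* (1 ℕ.* suc (k ℕ.+ n ℕ.* suc k))
    eq = trans (cong (ℕ._* suc n) (ℕ.*-identityʳ (suc k)))
        (trans (ℕ.*-comm (suc k) (suc n))
        (sym (trans (ℕ.*-identityˡ (1 ℕ.* (suc n ℕ.* suc k))) (ℕ.*-identityˡ _))))

  block-upper : ∀ a j → harmonic (j ℕ.+ suc a) ≤ harmonic (suc a) + nat j * unit a
  block-upper a zero    = ℚ.≤-reflexive
    (sym (trans (cong (λ t → harmonic (suc a) + t) (ℚ.*-zeroˡ (unit a))) (ℚ.+-identityʳ (harmonic (suc a)))))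
  block-upper a (suc j) = begin
    harmonic (j ℕ.+ suc a) + unit (j ℕ.+ suc a)
      ≤⟨ ℚ.+-mono-≤ (block-upper a j) (Rational.unit-antimono
           (ℕ.≤-trans (ℕ.n≤1+n a) (ℕ.m≤n+m (suc a) j))) ⟩
    harmonic (suc a) + nat j * unit a + unit a
      ≡⟨ trans (ℚ.+-assoc (harmonic (suc a)) (nat j * unit a) (unit a))
               (cong (λ t → harmonic (suc a) + t) (sym (nat-suc-* j (unit a)))) ⟩
    harmonic (suc a) + nat (suc j) * unit a ∎

  block-lower : ∀ a J j → j ℕ.≤ J →
                harmonic (suc a) + nat j * unit (J ℕ.+ a) ≤ harmonic (j ℕ.+ suc a)
  block-lower a J zero    _   = ℚ.≤-reflexive
    (trans (cong (λ t → harmonic (suc a) + t) (ℚ.*-zeroˡ (unit (J ℕ.+ a)))) (ℚ.+-identityʳ (harmonic (suc a))))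
  block-lower a J (suc j) j<J = begin
    harmonic (suc a) + nat (suc j) * unit (J ℕ.+ a)
      ≡⟨ trans (cong (λ t → harmonic (suc a) + t) (nat-suc-* j (unit (J ℕ.+ a))))
               (sym (ℚ.+-assoc (harmonic (suc a)) (nat j * unit (J ℕ.+ a)) (unit (J ℕ.+ a)))) ⟩
    harmonic (suc a) + nat j * unit (J ℕ.+ a) + unit (J ℕ.+ a)
      ≤⟨ ℚ.+-mono-≤ (block-lower a J j (ℕ.≤-trans (ℕ.n≤1+n j) j<J))
           (Rational.unit-antimono (subst (ℕ._≤ J ℕ.+ a) (sym (ℕ.+-suc j a))
                                          (ℕ.+-monoˡ-≤ a j<J))) ⟩
    harmonic (j ℕ.+ suc a) + unit (j ℕ.+ suc a) ∎

  monotone : ∀ (f : ℕ → ℚ) → (∀ n → f n ≤ f (suc n)) → ∀ {m n} → m ℕ.≤ n → f m ≤ f n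
  monotone f step m≤n = go (ℕ.≤⇒≤′ m≤n)
    where
    go : ∀ {m n} → m ℕ.≤′ n → f m ≤ f n
    go (ℕ.≤′-reflexive refl) = ℚ.≤-refl
    go (ℕ.≤′-step h)         = ℚ.≤-trans (go h) (step _)

  harmonic-mono : ∀ {m n} → m ℕ.≤ n → harmonic m ≤ harmonic n
  harmonic-mono = monotone harmonic λ n →
    subst (_≤ harmonic n + unit n) (ℚ.+-identityʳ (harmonic n))
      (ℚ.+-monoʳ-≤ (harmonic n) (ℚ.<⇒≤ (Rational.unit-pos n)))

  -- The right Riemann sum of 1/t over [1 , n] with mesh 1/(m+1):
  -- with M = m+1 it is  Σ_{M<i≤Mn} (1/M) · 1/(i/M) = Σ_{M<i≤Mn} 1/i.
  riemann : ℕ → ℕ → ℚ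
  riemann n m = harmonic (suc m ℕ.* n) - harmonic (suc m)

  riemann-step-≤ : ∀ k m → riemann (suc k) m ≤ riemann (suc k) (suc m)
  riemann-step-≤ k m = begin
    harmonic (suc m ℕ.* suc k) - harmonic (suc m)
      ≡⟨ solve 3 (λ x h u → x :- h := (x :+ u) :- (h :+ u)) refl
           (harmonic (suc m ℕ.* suc k)) (harmonic (suc m)) (unit (suc m)) ⟩
    harmonic (suc m ℕ.* suc k) + unit (suc m) - harmonic (suc (suc m))
      ≤⟨ ℚ.+-monoˡ-≤ (- harmonic (suc (suc m))) block ⟩
    harmonic (suc (suc m) ℕ.* suc k) - harmonic (suc (suc m)) ∎
    where
    a = k ℕ.+ m ℕ.* suc k
    block : harmonic (suc a) + unit (suc m) ≤ harmonic (suc k ℕ.+ suc a)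
    block = subst (λ t → harmonic (suc a) + t ≤ harmonic (suc k ℕ.+ suc a))
      (trans (cong (λ t → nat (suc k) * unit t) (sym (ℕ.+-suc k a))) (nat*unit k (suc m)))
      (block-lower a (suc k) (suc k) ℕ.≤-refl)

  riemann-step-≥ : ∀ k m →
    riemann (suc k) (suc m) + unit (suc m) ≤ riemann (suc k) m + unit m
  riemann-step-≥ k m = begin
    harmonic (suc (suc m) ℕ.* suc k) - harmonic (suc (suc m)) + unit (suc m)
      ≡⟨ solve 3 (λ x h u → x :- (h :+ u) :+ u := x :- h) refl
           (harmonic (suc (suc m) ℕ.* suc k)) (harmonic (suc m)) (unit (suc m)) ⟩
    harmonic (suc (suc m) ℕ.* suc k) - harmonic (suc m)
      ≤⟨ ℚ.+-monoˡ-≤ (- harmonic (suc m)) block ⟩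
    harmonic (suc m ℕ.* suc k) + unit m - harmonic (suc m)
      ≡⟨ solve 3 (λ x u h → x :+ u :- h := x :- h :+ u) refl
           (harmonic (suc m ℕ.* suc k)) (unit m) (harmonic (suc m)) ⟩
    harmonic (suc m ℕ.* suc k) - harmonic (suc m) + unit m ∎
    where
    a = k ℕ.+ m ℕ.* suc k
    block : harmonic (suc k ℕ.+ suc a) ≤ harmonic (suc a) + unit m
    block = subst (λ t → harmonic (suc k ℕ.+ suc a) ≤ harmonic (suc a) + t)
      (nat*unit k m) (block-upper a (suc k))

  riemann-mono : ∀ k {m n} → m ℕ.≤ n → riemann (suc k) m ≤ riemann (suc k) n
  riemann-mono k = monotone (riemann (suc k)) (riemann-step-≤ k)

  riemann-upper : ∀ k {m n} → m ℕ.≤ n → riemann (suc k) n ≤ riemann (suc k) m + unit m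
  riemann-upper k {m} {n} m≤n = ℚ.≤-trans
    (subst (_≤ riemann (suc k) n + unit n) (ℚ.+-identityʳ (riemann (suc k) n))
      (ℚ.+-monoʳ-≤ (riemann (suc k) n) (ℚ.<⇒≤ (Rational.unit-pos n))))
    (go (ℕ.≤⇒≤′ m≤n))
    where
    go : ∀ {m n} → m ℕ.≤′ n → riemann (suc k) n + unit n ≤ riemann (suc k) m + unit m
    go (ℕ.≤′-reflexive refl) = ℚ.≤-refl
    go (ℕ.≤′-step {n} h)     = ℚ.≤-trans (riemann-step-≥ k n) (go h)

  riemann-dist : ∀ k {N m n} → N ℕ.≤ m → N ℕ.≤ n →
                 ∣ riemann (suc k) m - riemann (suc k) n ∣ ≤ unit N
  riemann-dist k {N} {m} {n} hm hn = Rational.∣∣-≤ (one hm hn)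
    (subst (_≤ unit N)
      (solve 2 (λ x y → y :- x := :- (x :- y)) refl (riemann (suc k) m) (riemann (suc k) n))
      (one hn hm))
    where
    one : ∀ {m n} → N ℕ.≤ m → N ℕ.≤ n → riemann (suc k) m - riemann (suc k) n ≤ unit N
    one {m} {n} hm hn = Rational.p≤q+r⇒p-q≤r (ℚ.≤-trans (riemann-upper k hm)
      (ℚ.+-monoˡ-≤ (unit N) (riemann-mono k hn)))

-- Real numbers are rational Cauchy sequences carrying a modulus.
Cauchy : (ℕ → ℚ) → Set
Cauchy f = ∀ ε → 0ℚ ℚ.< ε →
  ∃[ N ] (∀ {m n} → N ℕ.≤ m → N ℕ.≤ n → ℚ.∣ f m ℚ.- f n ∣ ℚ.≤ ε)

record ℝ : Set where
  constructor mkℝ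
  field
    seq    : ℕ → ℚ
    cauchy : Cauchy seq

open ℝ public

infix 4 _≤_ _<_

_≤_ : ℝ → ℝ → Set
x ≤ y = ∀ ε → 0ℚ ℚ.< ε → ∃[ N ] (∀ {n} → N ℕ.≤ n → seq x n ℚ.≤ seq y n ℚ.+ ε)

_<_ : ℝ → ℝ → Set
x < y = ∃[ ε ] (0ℚ ℚ.< ε × ∃[ N ] (∀ {n} → N ℕ.≤ n → seq x n ℚ.+ ε ℚ.≤ seq y n))

fromℚ : ℚ → ℝ
fromℚ q = mkℝ (λ _ → q) λ ε 0<ε → 0 , λ _ _ →
  subst (ℚ._≤ ε) (sym (Rational.dist-refl q)) (ℚ.<⇒≤ 0<ε)

fromℕ : ℕ → ℝ
fromℕ n = fromℚ (+ n ℚ./ 1)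

infixl 6 _+_ _-_
infixl 7 _*_
infix  8 -_
infixr 9 _^_

private
  ⊔-≤ˡ : ∀ {m n o} → m ℕ.⊔ n ℕ.≤ o → m ℕ.≤ o
  ⊔-≤ˡ {m} {n} = ℕ.m⊔n≤o⇒m≤o m n

  ⊔-≤ʳ : ∀ {m n o} → m ℕ.⊔ n ℕ.≤ o → n ℕ.≤ o
  ⊔-≤ʳ {m} {n} = ℕ.m⊔n≤o⇒n≤o m n

_+_ : ℝ → ℝ → ℝ
mkℝ f cf + mkℝ g cg = mkℝ (λ n → f n ℚ.+ g n) λ ε 0<ε →
  let N , p = cf (½ ℚ.* ε) (Rational.½-pos 0<ε)
      M , q = cg (½ ℚ.* ε) (Rational.½-pos 0<ε)
  in N ℕ.⊔ M , λ {m} {n} hm hn → begin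
    ℚ.∣ (f m ℚ.+ g m) ℚ.- (f n ℚ.+ g n) ∣
      ≡⟨ cong ℚ.∣_∣ (solve 4 (λ a b c d → (a :+ b) :- (c :+ d) := (a :- c) :+ (b :- d)) refl
           (f m) (g m) (f n) (g n)) ⟩
    ℚ.∣ (f m ℚ.- f n) ℚ.+ (g m ℚ.- g n) ∣
      ≤⟨ ℚ.∣p+q∣≤∣p∣+∣q∣ (f m ℚ.- f n) (g m ℚ.- g n) ⟩
    ℚ.∣ f m ℚ.- f n ∣ ℚ.+ ℚ.∣ g m ℚ.- g n ∣
      ≤⟨ ℚ.+-mono-≤ (p (⊔-≤ˡ hm) (⊔-≤ˡ hn)) (q (⊔-≤ʳ {N} hm) (⊔-≤ʳ {N} hn)) ⟩
    ½ ℚ.* ε ℚ.+ ½ ℚ.* ε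
      ≡⟨ Rational.½+½ ε ⟩
    ε ∎
  where
  open ℚ.≤-Reasoning
  open ℚ.+-*-Solver using (solve; _:=_; _:+_; _:-_)

-_ : ℝ → ℝ
- mkℝ f cf = mkℝ (λ n → ℚ.- f n) λ ε 0<ε →
  let N , p = cf ε 0<ε
  in N , λ {m} {n} hm hn → subst (ℚ._≤ ε)
    (cong ℚ.∣_∣ (solve 2 (λ a b → b :- a := (:- a) :- (:- b)) refl (f m) (f n)))
    (p hn hm)
  where open ℚ.+-*-Solver using (solve; _:=_; _:-_; :-_)

_-_ : ℝ → ℝ → ℝ
x - y = x + (- y)

∣_∣ : ℝ → ℝ
∣ mkℝ f cf ∣ = mkℝ (λ n → ℚ.∣ f n ∣) λ ε 0<ε →
  let N , p = cf ε 0<ε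
  in N , λ {m} {n} hm hn → ℚ.≤-trans (Rational.∣∣a∣-∣b∣∣≤∣a-b∣ (f m) (f n)) (p hm hn)

seq-bounded : ∀ x → ∃[ B ] (0ℚ ℚ.< B × ∃[ N ] (∀ {n} → N ℕ.≤ n → ℚ.∣ seq x n ∣ ℚ.≤ B))
seq-bounded (mkℝ f cf) =
  let N , p = cf 1ℚ (ℚ.positive⁻¹ 1ℚ)
  in ℚ.∣ f N ∣ ℚ.+ 1ℚ
   , ℚ.+-mono-≤-< (Rational.0≤∣∣ (f N)) (ℚ.positive⁻¹ 1ℚ)
   , N
   , λ {n} hn → Rational.p-q≤r⇒p≤q+r (ℚ.≤-trans (Rational.a≤∣a∣ _)
       (ℚ.≤-trans (Rational.∣∣a∣-∣b∣∣≤∣a-b∣ (f n) (f N)) (p hn ℕ.≤-refl)))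

_*_ : ℝ → ℝ → ℝ
x@(mkℝ f cf) * y@(mkℝ g cg) = mkℝ (λ n → f n ℚ.* g n) λ ε 0<ε →
  let A , 0<A , N₁ , boundA = seq-bounded x
      B , 0<B , N₂ , boundB = seq-bounded y
      0<A+B = ℚ.+-mono-< 0<A 0<B
      η     = recip (A ℚ.+ B) ℚ.* ε
      0<η   = Rational.*-pos (Rational.recip-pos 0<A+B) 0<ε
      N₃ , p = cf η 0<η
      N₄ , q = cg η 0<η
      N = (N₁ ℕ.⊔ N₂) ℕ.⊔ (N₃ ℕ.⊔ N₄)
      ≥₁ = λ {m} (h : N ℕ.≤ m) → ⊔-≤ˡ {N₁} {N₂} (⊔-≤ˡ h)
      ≥₂ = λ {m} (h : N ℕ.≤ m) → ⊔-≤ʳ {N₁} {N₂} (⊔-≤ˡ h)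
      ≥₃ = λ {m} (h : N ℕ.≤ m) → ⊔-≤ˡ {N₃} {N₄} (⊔-≤ʳ {N₁ ℕ.⊔ N₂} h)
      ≥₄ = λ {m} (h : N ℕ.≤ m) → ⊔-≤ʳ {N₃} {N₄} (⊔-≤ʳ {N₁ ℕ.⊔ N₂} h)
  in N , λ {m} {n} hm hn → begin
    ℚ.∣ f m ℚ.* g m ℚ.- f n ℚ.* g n ∣
      ≡⟨ cong ℚ.∣_∣ (solve 4 (λ a b c d → a :* b :- c :* d := a :* (b :- d) :+ d :* (a :- c))
           refl (f m) (g m) (f n) (g n)) ⟩
    ℚ.∣ f m ℚ.* (g m ℚ.- g n) ℚ.+ g n ℚ.* (f m ℚ.- f n) ∣
      ≤⟨ ℚ.∣p+q∣≤∣p∣+∣q∣ (f m ℚ.* (g m ℚ.- g n)) (g n ℚ.* (f m ℚ.- f n)) ⟩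
    ℚ.∣ f m ℚ.* (g m ℚ.- g n) ∣ ℚ.+ ℚ.∣ g n ℚ.* (f m ℚ.- f n) ∣
      ≡⟨ cong₂ ℚ._+_ (ℚ.∣p*q∣≡∣p∣*∣q∣ (f m) (g m ℚ.- g n))
                     (ℚ.∣p*q∣≡∣p∣*∣q∣ (g n) (f m ℚ.- f n)) ⟩
    ℚ.∣ f m ∣ ℚ.* ℚ.∣ g m ℚ.- g n ∣ ℚ.+ ℚ.∣ g n ∣ ℚ.* ℚ.∣ f m ℚ.- f n ∣
      ≤⟨ ℚ.+-mono-≤
           (Rational.*-mono-≤ (ℚ.<⇒≤ 0<A) (Rational.0≤∣∣ _)
             (boundA (≥₁ hm)) (q (≥₄ hm) (≥₄ hn)))
           (Rational.*-mono-≤ (ℚ.<⇒≤ 0<B) (Rational.0≤∣∣ _)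
             (boundB (≥₂ hn)) (p (≥₃ hm) (≥₃ hn))) ⟩
    A ℚ.* η ℚ.+ B ℚ.* η
      ≡⟨ solve 4 (λ a b r e → a :* (r :* e) :+ b :* (r :* e) := r :* (a :+ b) :* e) refl
           A B (recip (A ℚ.+ B)) ε ⟩
    recip (A ℚ.+ B) ℚ.* (A ℚ.+ B) ℚ.* ε
      ≡⟨ trans (cong (ℚ._* ε) (Rational.recip-inverse 0<A+B)) (ℚ.*-identityˡ ε) ⟩
    ε ∎
  where
  open ℚ.≤-Reasoning
  open ℚ.+-*-Solver using (solve; _:=_; _:+_; _:*_; _:-_)

_^_ : ℝ → ℕ → ℝ
x ^ zero  = fromℕ 1
x ^ suc k = x * x ^ k

-- The terms of x are eventually bounded away from 0, so only finitely many
-- of them are affected by the convention recip 0ℚ = 0ℚ.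
inverse : (x : ℝ) → fromℕ 0 < x → ℝ
inverse (mkℝ f cf) (δ , 0<δ , M , pos) = mkℝ (λ n → recip (f n)) λ ε 0<ε →
  let η      = δ ℚ.* δ ℚ.* ε
      N , p  = cf η (Rational.*-pos (Rational.*-pos 0<δ 0<δ) 0<ε)
  in N ℕ.⊔ M , λ {m} {n} hm hn → begin
    ℚ.∣ recip (f m) ℚ.- recip (f n) ∣
      ≤⟨ Rational.recip-dist 0<δ (pos′ (⊔-≤ʳ {N} hm)) (pos′ (⊔-≤ʳ {N} hn)) ⟩
    recip δ ℚ.* recip δ ℚ.* ℚ.∣ f m ℚ.- f n ∣
      ≤⟨ ℚ.*-monoˡ-≤-nonNeg (recip δ ℚ.* recip δ)
           {{ℚ.nonNegative (ℚ.<⇒≤ (Rational.*-pos (Rational.recip-pos 0<δ)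
                                                  (Rational.recip-pos 0<δ)))}}
           (p (⊔-≤ˡ hm) (⊔-≤ˡ hn)) ⟩
    recip δ ℚ.* recip δ ℚ.* (δ ℚ.* δ ℚ.* ε)
      ≡⟨ solve 3 (λ r d e → r :* r :* (d :* d :* e) := (r :* d) :* (r :* d) :* e) refl
           (recip δ) δ ε ⟩
    (recip δ ℚ.* δ) ℚ.* (recip δ ℚ.* δ) ℚ.* ε
      ≡⟨ cong₂ (λ u v → u ℚ.* v ℚ.* ε) (Rational.recip-inverse 0<δ)
                                       (Rational.recip-inverse 0<δ) ⟩
    1ℚ ℚ.* 1ℚ ℚ.* ε
      ≡⟨ ℚ.*-identityˡ ε ⟩
    ε ∎
  where
  open ℚ.≤-Reasoning
  open ℚ.+-*-Solver using (solve; _:=_; _:+_; _:*_; _:-_)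
  pos′ : ∀ {n} → M ℕ.≤ n → δ ℚ.≤ f n
  pos′ {n} h = subst (ℚ._≤ f n) (ℚ.+-identityˡ δ) (pos h)

integerPower : (x : ℝ) → fromℕ 0 < x → ℤ → ℝ
integerPower x 0<x (+ k)    = x ^ k
integerPower x 0<x -[1+ k ] = inverse x 0<x ^ suc k

CauchyInℝ : (ℕ → ℝ) → Set
CauchyInℝ X = ∀ ε → 0ℚ ℚ.< ε →
  ∃[ N ] (∀ {m n} → N ℕ.≤ m → N ℕ.≤ n → ∣ X m - X n ∣ ≤ fromℚ ε)

_ConvergesTo_ : (ℕ → ℝ) → ℝ → Set
X ConvergesTo l = ∀ ε → 0ℚ ℚ.< ε → ∃[ N ] (∀ {n} → N ℕ.≤ n → ∣ X n - l ∣ ≤ fromℚ ε)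

module _ (X : ℕ → ℝ) (X-cauchy : CauchyInℝ X) where

  private
    index : ℕ → ℕ
    index k = proj₁ (cauchy (X k) (unit k) (Rational.unit-pos k))

    index-spec : ∀ k {m n} → index k ℕ.≤ m → index k ℕ.≤ n →
                 ℚ.∣ seq (X k) m ℚ.- seq (X k) n ∣ ℚ.≤ unit k
    index-spec k = proj₂ (cauchy (X k) (unit k) (Rational.unit-pos k))

    -- Compare X k at position i with X l at position j through a far position M.
    compare : ∀ {η k l} i j I J → 0ℚ ℚ.< η → ∣ X k - X l ∣ ≤ fromℚ η →
              (∀ {m} → I ℕ.≤ m → ℚ.∣ seq (X k) i ℚ.- seq (X k) m ∣ ℚ.≤ η) →
              (∀ {m} → J ℕ.≤ m → ℚ.∣ seq (X l) m ℚ.- seq (X l) j ∣ ℚ.≤ η) →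
              ℚ.∣ seq (X k) i ℚ.- seq (X l) j ∣ ℚ.≤ η ℚ.+ (η ℚ.+ η) ℚ.+ η
    compare {η} {k} {l} i j I J 0<η near p q =
      let K , r = near η 0<η
          M = I ℕ.⊔ (J ℕ.⊔ K)
          I≤M = ℕ.m≤m⊔n I (J ℕ.⊔ K)
          J≤M = ℕ.≤-trans (ℕ.m≤m⊔n J K) (ℕ.m≤n⊔m I (J ℕ.⊔ K))
          K≤M = ℕ.≤-trans (ℕ.m≤n⊔m J K) (ℕ.m≤n⊔m I (J ℕ.⊔ K))
      in ℚ.≤-trans (Rational.dist-triangle (seq (X k) i) (seq (X l) M) (seq (X l) j))
           (ℚ.+-mono-≤
             (ℚ.≤-trans (Rational.dist-triangle (seq (X k) i) (seq (X k) M) (seq (X l) M))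
               (ℚ.+-mono-≤ (p I≤M) (r K≤M)))
             (q J≤M))

  lim : ℝ
  lim = mkℝ (λ k → seq (X k) (index k)) λ ε 0<ε →
    let η      = Rational.¼ ℚ.* ε
        0<η    = Rational.¼-pos 0<ε
        N₁ , u = Rational.archimedean η 0<η
        N₂ , c = X-cauchy η 0<η
    in N₁ ℕ.⊔ N₂ , λ {k} {l} hk hl → subst (_ ℚ.≤_) (Rational.¼×4 ε)
         (compare (index k) (index l) (index k) (index l) 0<η
           (c (⊔-≤ʳ {N₁} hk) (⊔-≤ʳ {N₁} hl))
           (λ h → ℚ.≤-trans (index-spec k ℕ.≤-refl h) (u (⊔-≤ˡ hk)))
           (λ h → ℚ.≤-trans (index-spec l h ℕ.≤-refl) (u (⊔-≤ˡ hl))))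

  lim-converges : X ConvergesTo lim
  lim-converges ε 0<ε =
    let η      = Rational.¼ ℚ.* ε
        0<η    = Rational.¼-pos 0<ε
        N₁ , u = Rational.archimedean η 0<η
        N₂ , c = X-cauchy η 0<η
    in N₂ , λ {n} hn ε′ 0<ε′ →
      let K , d = cauchy (X n) η 0<η
      in K ℕ.⊔ (N₁ ℕ.⊔ N₂) , λ {k} hk →
        let K≤k  = ⊔-≤ˡ {K} hk
            N₁≤k = ⊔-≤ˡ {N₁} (⊔-≤ʳ {K} hk)
            N₂≤k = ⊔-≤ʳ {N₁} (⊔-≤ʳ {K} hk)
        in ℚ.≤-trans
          (subst (_ ℚ.≤_) (Rational.¼×4 ε)
            (compare k (index k) K (index k) 0<η
              (c hn N₂≤k)
              (λ h → d K≤k h)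
              (λ h → ℚ.≤-trans (index-spec k h ℕ.≤-refl) (u N₁≤k))))
          (subst (ℚ._≤ ε ℚ.+ ε′) (ℚ.+-identityʳ ε) (ℚ.+-monoʳ-≤ ε (ℚ.<⇒≤ 0<ε′)))

riemann-cauchy : ∀ n .{{_ : NonZero n}} → Cauchy (Harmonic.riemann n)
riemann-cauchy (suc k) ε 0<ε =
  let N , u = Rational.archimedean ε 0<ε
  in N , λ hm hn → ℚ.≤-trans (Harmonic.riemann-dist k hm hn) (u ℕ.≤-refl)

-- log n = ∫₁ⁿ dt/t
log : (n : ℕ) → .{{NonZero n}} → ℝ
log n = mkℝ (Harmonic.riemann n) (riemann-cauchy n)

log-positive : ∀ n .{{_ : NonTrivial n}} → fromℕ 0 < log n {{nonTrivial⇒nonZero n}}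
log-positive (suc (suc k)) = ½ , ℚ.positive⁻¹ ½ , 0 , λ {n} _ → begin
  0ℚ ℚ.+ ½
    ≡⟨⟩
  harmonic 2 ℚ.- harmonic 1
    ≤⟨ ℚ.+-monoˡ-≤ (ℚ.- harmonic 1)
         (Harmonic.harmonic-mono {2} {1 ℕ.* suc (suc k)} (ℕ.s≤s (ℕ.s≤s ℕ.z≤n))) ⟩
  Harmonic.riemann (suc (suc k)) 0
    ≤⟨ Harmonic.riemann-mono (suc k) {0} {n} ℕ.z≤n ⟩
  Harmonic.riemann (suc (suc k)) n ∎
  where open ℚ.≤-Reasoning

logPower : (n : ℕ) → .{{NonTrivial n}} → ℤ → ℝ
logPower n j = integerPower (log n {{nonTrivial⇒nonZero n}}) (log-positive n) j

harmonic-log : ℕ → ℝ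
harmonic-log n = fromℚ (harmonic (suc n)) - log (suc n)

harmonic-log-cauchy : CauchyInℝ harmonic-log
harmonic-log-cauchy ε 0<ε =
  let N , u = Rational.archimedean ε 0<ε
  in N , λ {m} {n} hm hn ε′ 0<ε′ → 0 , λ {k} _ → begin
    seq (∣ harmonic-log m - harmonic-log n ∣) k
      ≡⟨ cong ℚ.∣_∣ (eq m n k) ⟩
    ℚ.∣ Harmonic.riemann (suc k) n ℚ.- Harmonic.riemann (suc k) m ∣
      ≤⟨ Harmonic.riemann-dist k hn hm ⟩
    unit N
      ≤⟨ u ℕ.≤-refl ⟩
    ε
      ≡⟨ sym (ℚ.+-identityʳ ε) ⟩
    ε ℚ.+ 0ℚ
      ≤⟨ ℚ.+-monoʳ-≤ ε (ℚ.<⇒≤ 0<ε′) ⟩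
    ε ℚ.+ ε′ ∎
  where
  open ℚ.≤-Reasoning
  open ℚ.+-*-Solver using (solve; _:=_; _:+_; _:-_; :-_)
  eq : ∀ m n k → seq (harmonic-log m - harmonic-log n) k
               ≡ Harmonic.riemann (suc k) n ℚ.- Harmonic.riemann (suc k) m
  eq m n k = trans
    (solve 5 (λ hm hn hk x y →
        (hm :+ (:- (x :- hk))) :+ (:- (hn :+ (:- (y :- hk)))) := (y :- hn) :- (x :- hm)) refl
      (harmonic (suc m)) (harmonic (suc n)) (harmonic (suc k))
      (harmonic (suc k ℕ.* suc m)) (harmonic (suc k ℕ.* suc n)))
    (cong₂ (λ p q → (harmonic p ℚ.- harmonic (suc n)) ℚ.- (harmonic q ℚ.- harmonic (suc m)))
      (ℕ.*-comm (suc k) (suc n)) (ℕ.*-comm (suc k) (suc m)))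

γ : ℝ
γ = lim harmonic-log harmonic-log-cauchy

insertions : ℕ → List ℕ → List (List ℕ)
insertions x []       = (x ∷ []) ∷ []
insertions x (y ∷ ys) = (x ∷ y ∷ ys) ∷ map (y ∷_) (insertions x ys)

permutations : List ℕ → List (List ℕ)
permutations []       = [] ∷ []
permutations (x ∷ xs) = concatMap (insertions x) (permutations xs)

∈-insertions⁻ : ∀ x xs {ys} → ys ∈ insertions x xs →
  ∃[ us ] ∃[ vs ] (xs ≡ us ++ vs × ys ≡ us ++ x ∷ vs)
∈-insertions⁻ x []       (here refl) = [] , [] , refl , refl
∈-insertions⁻ x (y ∷ ys) (here refl) = [] , y ∷ ys , refl , refl
∈-insertions⁻ x (y ∷ ys) (there p) with ∈-map⁻ (y ∷_) p
... | zs , zs∈ , refl with ∈-insertions⁻ x ys zs∈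
... | us , vs , refl , refl = y ∷ us , vs , refl , refl

∈-insertions⁺ : ∀ x us vs → us ++ x ∷ vs ∈ insertions x (us ++ vs)
∈-insertions⁺ x []       []       = here refl
∈-insertions⁺ x []       (v ∷ vs) = here refl
∈-insertions⁺ x (u ∷ us) vs       = there (∈-map⁺ (u ∷_) (∈-insertions⁺ x us vs))

∈-permutations⁻ : ∀ xs {ys} → ys ∈ permutations xs → ys ↭ xs
∈-permutations⁻ []       (here refl) = ↭-refl
∈-permutations⁻ (x ∷ xs) p with find (∈-concatMap⁻ (insertions x) {xs = permutations xs} p)
... | zs , zs∈ , ys∈ with ∈-insertions⁻ x zs ys∈
... | us , vs , refl , refl =
  ↭-trans (shift x us vs) (↭-prep x (∈-permutations⁻ xs zs∈))

∈-permutations⁺ : ∀ xs {ys} → ys ↭ xs → ys ∈ permutations xs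
∈-permutations⁺ []       p with ↭-empty-inv p
... | refl = here refl
∈-permutations⁺ (x ∷ xs) p with ∈-∃++ (∈-resp-↭ (↭-sym p) (here refl))
... | us , vs , refl = ∈-concatMap⁺ (insertions x)
  (lose (∈-permutations⁺ xs (drop-mid us [] p)) (∈-insertions⁺ x us vs))

remove-unique : ∀ {x : ℕ} us {vs} us′ {vs′} → x ∉ us ++ vs → x ∉ us′ ++ vs′ →
  us ++ x ∷ vs ≡ us′ ++ x ∷ vs′ → us ++ vs ≡ us′ ++ vs′
remove-unique []       []         _ _ refl = refl
remove-unique []       (u′ ∷ us′) _ q refl = contradiction (here refl) q
remove-unique (u ∷ us) []         p _ refl = contradiction (here refl) p
remove-unique (u ∷ us) (u′ ∷ us′) p q e with cong (λ { (z ∷ _) → z ; [] → 0 }) e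
... | refl = cong (u ∷_) (remove-unique us us′ (λ h → p (there h)) (λ h → q (there h))
                           (cong (λ { (_ ∷ zs) → zs ; [] → [] }) e))

insertions-unique : ∀ x xs → x ∉ xs → Unique (insertions x xs)
insertions-unique x []       _  = [] ∷ []
insertions-unique x (y ∷ ys) x∉ =
  All.tabulate (λ p e → x∉ (here (head≡ (∈-map⁻ (y ∷_) p) e)))
  ∷ Unique.map⁺ (λ { refl → refl }) (insertions-unique x ys (λ h → x∉ (there h)))
  where
  head≡ : ∀ {z} → ∃[ zs ] (zs ∈ insertions x ys × z ≡ y ∷ zs) → x ∷ y ∷ ys ≡ z → x ≡ y
  head≡ (_ , _ , refl) refl = refl

concatMap-insertions-unique : ∀ x (L : List (List ℕ)) → All (x ∉_) L → Unique L →
                              Unique (concatMap (insertions x) L)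
concatMap-insertions-unique x []      _         _       = []
concatMap-insertions-unique x (p ∷ L) (x∉p ∷ x∉L) (p∉L ∷ uL) =
  Unique.++⁺ (insertions-unique x p x∉p) (concatMap-insertions-unique x L x∉L uL) disjoint
  where
  disjoint : ∀ {z} → ¬ (z ∈ insertions x p × z ∈ concatMap (insertions x) L)
  disjoint (z∈p , z∈L) with find (∈-concatMap⁻ (insertions x) {xs = L} z∈L)
  ... | q , q∈L , z∈q with ∈-insertions⁻ x p z∈p | ∈-insertions⁻ x q z∈q
  ... | us , vs , refl , refl | us′ , vs′ , refl , e =
    All.lookup p∉L q∈L (remove-unique us us′ x∉p (All.lookup x∉L q∈L) e)

permutations-unique : ∀ xs → Unique xs → Unique (permutations xs)
permutations-unique []       _          = [] ∷ []
permutations-unique (x ∷ xs) (x∉ ∷ uxs) = concatMap-insertions-unique x (permutations xs)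
  (All.tabulate (λ p∈ x∈p → All.lookup x∉ (∈-resp-↭ (∈-permutations⁻ xs p∈) x∈p) refl))
  (permutations-unique xs uxs)

-- Each permutation of 1 , … , n is listed exactly once
-- (∈-permutations⁻, ∈-permutations⁺, permutations-unique).
S : ℕ → List (List ℕ)
S n = permutations (map suc (upTo n))

-- The first argument bounds the recursion depth; any bound ≥ length xs gives
-- the same count (comparisons-∷ below is the intended recursion).
comparisonsWithin : ℕ → List ℕ → ℕ
comparisonsWithin _       []       = 0
comparisonsWithin zero    (x ∷ xs) = 0
comparisonsWithin (suc d) (x ∷ xs) =
  length xs ℕ.+ (comparisonsWithin d (filter (ℕ._<? x) xs) ℕ.+
                 comparisonsWithin d (filter (x ℕ.<?_) xs))

comparisons : List ℕ → ℕ
comparisons xs = comparisonsWithin (length xs) xs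

comparisonsWithin-stable : ∀ d xs → length xs ℕ.≤ d → comparisonsWithin d xs ≡ comparisons xs
comparisonsWithin-stable d xs h = go d (length xs) xs h ℕ.≤-refl
  where
  go : ∀ d e xs → length xs ℕ.≤ d → length xs ℕ.≤ e →
       comparisonsWithin d xs ≡ comparisonsWithin e xs
  go d       e       []       _         _         = refl
  go (suc d) (suc e) (x ∷ xs) (ℕ.s≤s p) (ℕ.s≤s q) = cong (length xs ℕ.+_) (cong₂ ℕ._+_
    (go d e (filter (ℕ._<? x) xs) (ℕ.≤-trans (length-filter (ℕ._<? x) xs) p)
                                  (ℕ.≤-trans (length-filter (ℕ._<? x) xs) q))
    (go d e (filter (x ℕ.<?_) xs) (ℕ.≤-trans (length-filter (x ℕ.<?_) xs) p)
                                  (ℕ.≤-trans (length-filter (x ℕ.<?_) xs) q)))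

comparisons-∷ : ∀ x xs → comparisons (x ∷ xs) ≡
  length xs ℕ.+ (comparisons (filter (ℕ._<? x) xs) ℕ.+ comparisons (filter (x ℕ.<?_) xs))
comparisons-∷ x xs = cong (length xs ℕ.+_) (cong₂ ℕ._+_
  (comparisonsWithin-stable (length xs) (filter (ℕ._<? x) xs) (length-filter (ℕ._<? x) xs))
  (comparisonsWithin-stable (length xs) (filter (x ℕ.<?_) xs) (length-filter (x ℕ.<?_) xs)))

a : ℕ → ℕ → ℕ
a n k = length (filter (λ π → comparisons π ℕ.≟ k) (S n))

-- The sum over all k ≥ 0 stops at k = n², since a n k ≡ 0 beyond (a-vanishes).
-- k P s is the falling factorial (k)ₛ, which is 0 when s > k.
β : ℕ → ℕ → ℚ
β s n = ∑[ k < suc (n ℕ.* n) ] ((+ (toℕ k P s) ℚ./ 1) ℚ.* (+ a n (toℕ k) ℚ./ n !))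
  where instance _ = n ℕ.!≢0

filters-disjoint : ∀ x xs →
  length (filter (ℕ._<? x) xs) ℕ.+ length (filter (x ℕ.<?_) xs) ℕ.≤ length xs
filters-disjoint x []       = ℕ.z≤n
filters-disjoint x (y ∷ ys) with ℕ.<-cmp y x
... | tri< y<x _ x≮y rewrite filter-accept (ℕ._<? x) {xs = ys} y<x
                           | filter-reject (x ℕ.<?_) {xs = ys} x≮y =
  ℕ.s≤s (filters-disjoint x ys)
... | tri≈ y≮x _ x≮y rewrite filter-reject (ℕ._<? x) {xs = ys} y≮x
                           | filter-reject (x ℕ.<?_) {xs = ys} x≮y =
  ℕ.≤-trans (filters-disjoint x ys) (ℕ.n≤1+n (length ys))
... | tri> y≮x _ x<y rewrite filter-reject (ℕ._<? x) {xs = ys} y≮x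
                           | filter-accept (x ℕ.<?_) {xs = ys} x<y
                           | ℕ.+-suc (length (filter (ℕ._<? x) ys))
                                     (length (filter (x ℕ.<?_) ys)) =
  ℕ.s≤s (filters-disjoint x ys)

comparisonsWithin-≤ : ∀ d xs → comparisonsWithin d xs ℕ.≤ length xs ℕ.* length xs
comparisonsWithin-≤ _       []       = ℕ.z≤n
comparisonsWithin-≤ zero    (x ∷ xs) = ℕ.z≤n
comparisonsWithin-≤ (suc d) (x ∷ xs) = begin
  n ℕ.+ (comparisonsWithin d lo ℕ.+ comparisonsWithin d hi)
    ≤⟨ ℕ.+-monoʳ-≤ n (ℕ.+-mono-≤ (comparisonsWithin-≤ d lo) (comparisonsWithin-≤ d hi)) ⟩
  n ℕ.+ (length lo ℕ.* length lo ℕ.+ length hi ℕ.* length hi)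
    ≤⟨ ℕ.+-monoʳ-≤ n (ℕ.+-mono-≤ (ℕ.*-monoʳ-≤ (length lo) (length-filter (ℕ._<? x) xs))
                                 (ℕ.*-monoʳ-≤ (length hi) (length-filter (x ℕ.<?_) xs))) ⟩
  n ℕ.+ (length lo ℕ.* n ℕ.+ length hi ℕ.* n)
    ≡⟨ cong (n ℕ.+_) (sym (ℕ.*-distribʳ-+ n (length lo) (length hi))) ⟩
  n ℕ.+ (length lo ℕ.+ length hi) ℕ.* n
    ≤⟨ ℕ.+-monoʳ-≤ n (ℕ.*-monoˡ-≤ n (filters-disjoint x xs)) ⟩
  suc n ℕ.* n
    ≤⟨ ℕ.*-monoʳ-≤ (suc n) (ℕ.n≤1+n n) ⟩
  suc n ℕ.* suc n ∎
  where
  open ℕ.≤-Reasoning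
  n  = length xs
  lo = filter (ℕ._<? x) xs
  hi = filter (x ℕ.<?_) xs

a-vanishes : ∀ n k → n ℕ.* n ℕ.< k → a n k ≡ 0
a-vanishes n k n²<k = cong length (filter-none (λ π → comparisons π ℕ.≟ k) {xs = S n}
  (All.tabulate λ {π} π∈ e → ℕ.<⇒≱ n²<k (subst (ℕ._≤ n ℕ.* n) e
    (subst (λ l → comparisons π ℕ.≤ l ℕ.* l) (length-π π∈)
      (comparisonsWithin-≤ (length π) π)))))
  where
  length-π : ∀ {π} → π ∈ S n → length π ≡ n
  length-π π∈ = trans (↭-length (∈-permutations⁻ (map suc (upTo n)) π∈))
    (trans (length-map suc (upTo n)) (length-upTo n))

module Submission where

-- Centre the number X of comparisons at its mean μ(n) = 2(n+1)Hₙ - 4n.  The quick sort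
-- recurrence turns into one for X - μ with a centred toll function that is O(n), and by
-- induction on p its pth moment is O(nᵖ): expanding the pth power, the two pure pth moments
-- enter with total weight 2/(p+1) < 1, and all mixed terms involve moments of lower order.
-- Hence the sth factorial moment is μˢ up to O(nˢ logˢ⁻² n), the contribution of order one
-- vanishing because E(X - μ) = 0, and the theorem follows from Hₙ = log n + γ + O(1/n) and
-- log² n = O(n).

import Algebra.Properties.CommutativeMonoid.Sum
import Algebra.Properties.CommutativeSemiring.Exp
open import Algebra.Bundles using (CommutativeRing)
open import Data.Bool.Properties using (T-≡)
open import Data.Fin.Base using (toℕ)
import Data.Integer.Base as ℤ
import Data.Integer.Properties as ℤ
open import Data.List.Base using (List; []; _∷_; _++_; map; concatMap; filter; length; upTo)
open import Data.List.Properties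
  using (length-++; length-map; length-upTo; ++-assoc; filter-accept; filter-reject)
open import Data.List.Relation.Binary.Permutation.Propositional using (_↭_)
open import Data.List.Relation.Binary.Permutation.Propositional.Properties using (↭-length)
open import Data.List.Relation.Unary.All as All using (All; []; _∷_)
import Data.List.Relation.Unary.All.Properties as All
open import Data.List.Relation.Unary.AllPairs using (AllPairs; []; _∷_)
import Data.List.Relation.Unary.AllPairs.Properties as AllPairs
open import Data.Nat.Base using (ℕ; zero; suc; _!; NonTrivial)
import Data.Nat.Base as ℕ
open import Data.Nat.Combinatorics using (_P_; k>n⇒nPk≡0)
open import Data.Nat.Combinatorics.Base using (_P′_)
import Data.Nat.Properties as ℕ
open import Data.Product using (_×_; _,_; proj₁; proj₂; map₁; ∃-syntax)
open import Data.Rational.Base as ℚ using (ℚ; 0ℚ; 1ℚ)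
import Data.Rational.Properties as ℚ
open import Data.Rational.Solver using (module +-*-Solver)
open import Data.Rational.Unnormalised.Base as ℚᵘ using (mkℚᵘ)
import Data.Rational.Unnormalised.Properties as ℚᵘ
open import Function using (_∘_)
open import Function.Bundles using (Equivalence)
open import Relation.Binary.Definitions using (tri<; tri≈; tri>)
open import Relation.Binary.PropositionalEquality
open import Relation.Nullary using (¬_; yes; no; contradiction)
open import Relation.Nullary.Decidable using (from-yes)
open import Relation.Unary using (Decidable)
open CommutativeRing ℚ.+-*-commutativeRing using (commutativeSemiring)
open +-*-Solver using (solve; _:=_; _:+_; _:*_; _:-_; :-_; con)

-- An inequality between reals is an inequality between the terms of their sequences, from some
-- index on and up to a slack. The estimate is therefore proved in ℚ, index by index: a `Point`
-- holds n with one term each of `log n` and `γ`, and every bound is uniform over all points, so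
-- that a single rational constant serves all n and all indices. At p = 1 the weight 2/(p+1) of the
-- recursive calls is 1 and the induction on moments gains nothing. The first moment has to vanish
-- exactly, which is why `μ` is the exact mean and not only its asymptotic form. Factorial moments
-- are reached by replacing one factor k - s by (μ - s) + (k - μ) at a time; the mixed moments
-- E((k)_s (k - μ)^j) make this a closed recursion. The error is measured as (n ℓ)^s / ℓ², with ℓ
-- for log n, so the negative exponent at s = 1 appears only in the final translation.

module Expectation where

  open import Data.Rational.Base using (_+_; _*_)
  open Algebra.Properties.CommutativeMonoid.Sum ℚ.+-0-commutativeMonoid
    using (sum-cong-≗; sum-syntax; ∑-distrib-+)
  open import Defs using (unit; insertions; permutations; ∈-permutations⁻; S; comparisons;
    comparisonsWithin-≤; comparisons-∷; a; β; module Harmonic)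
  open Harmonic using (nat; nat-suc; nat*unit)
  open ≡-Reasoning

  -- Rational arithmetic of natural numbers and factorials.

  nat-+ : ∀ m n → nat (m ℕ.+ n) ≡ nat m + nat n
  nat-+ zero    n = sym (ℚ.+-identityˡ (nat n))
  nat-+ (suc m) n = begin
    nat (suc (m ℕ.+ n))   ≡⟨ nat-suc (m ℕ.+ n) ⟩
    nat (m ℕ.+ n) + 1ℚ    ≡⟨ cong (_+ 1ℚ) (nat-+ m n) ⟩
    nat m + nat n + 1ℚ    ≡⟨ solve 3 (λ m n o → m :+ n :+ o := m :+ o :+ n) refl (nat m) (nat n) 1ℚ ⟩
    nat m + 1ℚ + nat n    ≡⟨ cong (_+ nat n) (sym (nat-suc m)) ⟩
    nat (suc m) + nat n   ∎

  nat-* : ∀ m n → nat (m ℕ.* n) ≡ nat m * nat n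
  nat-* zero    n = sym (ℚ.*-zeroˡ (nat n))
  nat-* (suc m) n = begin
    nat (n ℕ.+ m ℕ.* n)         ≡⟨ nat-+ n (m ℕ.* n) ⟩
    nat n + nat (m ℕ.* n)       ≡⟨ cong (nat n +_) (nat-* m n) ⟩
    nat n + nat m * nat n       ≡⟨ ℚ.+-comm (nat n) (nat m * nat n) ⟩
    nat m * nat n + nat n       ≡⟨ sym (Harmonic.nat-suc-* m (nat n)) ⟩
    nat (suc m) * nat n         ∎

  nat-suc*unit : ∀ n → nat (suc n) * unit n ≡ 1ℚ
  nat-suc*unit n = trans (cong (λ k → nat (suc n) * unit k) (sym (ℕ.+-identityʳ n))) (nat*unit n 0)

  nat-suc-cancel : ∀ n {p q} → nat (suc n) * p ≡ nat (suc n) * q → p ≡ q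
  nat-suc-cancel n {p} {q} e = begin
    p                            ≡⟨ expand p ⟩
    unit n * (nat (suc n) * p)   ≡⟨ cong (unit n *_) e ⟩
    unit n * (nat (suc n) * q)   ≡⟨ sym (expand q) ⟩
    q                            ∎
    where
    expand : ∀ p → p ≡ unit n * (nat (suc n) * p)
    expand p = begin
      p                            ≡⟨ sym (ℚ.*-identityˡ p) ⟩
      1ℚ * p                       ≡⟨ cong (_* p) (sym (nat-suc*unit n)) ⟩
      nat (suc n) * unit n * p     ≡⟨ solve 3 (λ u v p → u :* v :* p := v :* (u :* p)) refl
                                        (nat (suc n)) (unit n) p ⟩
      unit n * (nat (suc n) * p)   ∎

  -- A product of `unit`s rather than a quotient by `n !`: one factor splits off by computation and
  -- no `NonZero` instance is needed. `/-!` gives the link with the quotients in `β`.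
  1/_! : ℕ → ℚ
  1/ zero !  = 1ℚ
  1/ suc n ! = unit n * 1/ n !

  nat!*1/! : ∀ n → nat (n !) * 1/ n ! ≡ 1ℚ
  nat!*1/! zero    = refl
  nat!*1/! (suc n) = begin
    nat (suc n ℕ.* n !) * (unit n * 1/ n !)
      ≡⟨ cong (_* (unit n * 1/ n !)) (nat-* (suc n) (n !)) ⟩
    nat (suc n) * nat (n !) * (unit n * 1/ n !)
      ≡⟨ solve 4 (λ a b c d → a :* b :* (c :* d) := (a :* c) :* (b :* d)) refl
           (nat (suc n)) (nat (n !)) (unit n) (1/ n !) ⟩
    nat (suc n) * unit n * (nat (n !) * 1/ n !)
      ≡⟨ cong₂ _*_ (nat-suc*unit n) (nat!*1/! n) ⟩
    1ℚ ∎

  /-*-nat : ∀ m d .{{_ : ℕ.NonZero d}} → (ℤ.+ m ℚ./ d) * nat d ≡ nat m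
  /-*-nat m (suc d) = ℚ.toℚᵘ-injective
    (ℚᵘ.≃-trans (ℚ.toℚᵘ-homo-* (ℤ.+ m ℚ./ suc d) (nat (suc d)))
    (ℚᵘ.≃-trans (ℚᵘ.*-cong (ℚ.toℚᵘ-fromℚᵘ (mkℚᵘ (ℤ.+ m) d)) (ℚ.toℚᵘ-fromℚᵘ (mkℚᵘ (ℤ.+ suc d) 0)))
    (ℚᵘ.≃-trans (ℚᵘ.*≡* (trans (ℤ.*-identityʳ (ℤ.+ m ℤ.* ℤ.+ suc d))
                               (cong (λ t → ℤ.+ m ℤ.* ℤ.+ t) (sym (ℕ.*-identityʳ (suc d))))))
                (ℚᵘ.≃-sym (ℚ.toℚᵘ-fromℚᵘ (mkℚᵘ (ℤ.+ m) 0))))))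

  /-! : ∀ m n → ((ℤ.+ m ℚ./ n !) {{n ℕ.!≢0}}) ≡ nat m * 1/ n !
  /-! m n = begin
    m/n!                          ≡⟨ sym (ℚ.*-identityʳ m/n!) ⟩
    m/n! * 1ℚ                     ≡⟨ cong (m/n! *_) (sym (nat!*1/! n)) ⟩
    m/n! * (nat (n !) * 1/ n !)   ≡⟨ sym (ℚ.*-assoc m/n! (nat (n !)) (1/ n !)) ⟩
    m/n! * nat (n !) * 1/ n !     ≡⟨ cong (_* 1/ n !) (/-*-nat m (n !) {{n ℕ.!≢0}}) ⟩
    nat m * 1/ n !                ∎
    where m/n! = (ℤ.+ m ℚ./ n !) {{n ℕ.!≢0}}

  private variable
    A B : Set

  -- Finite sums over lists.

  ∑ : List A → (A → ℚ) → ℚ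
  ∑ []       f = 0ℚ
  ∑ (x ∷ xs) f = f x + ∑ xs f

  ∑-cong-All : ∀ {xs : List A} {f g} → All (λ x → f x ≡ g x) xs → ∑ xs f ≡ ∑ xs g
  ∑-cong-All []       = refl
  ∑-cong-All (e ∷ es) = cong₂ _+_ e (∑-cong-All es)

  ∑-cong : ∀ (xs : List A) {f g} → (∀ x → f x ≡ g x) → ∑ xs f ≡ ∑ xs g
  ∑-cong xs e = ∑-cong-All (All.universal e xs)

  ∑-++ : ∀ (xs ys : List A) f → ∑ (xs ++ ys) f ≡ ∑ xs f + ∑ ys f
  ∑-++ []       ys f = sym (ℚ.+-identityˡ (∑ ys f))
  ∑-++ (x ∷ xs) ys f = trans (cong (f x +_) (∑-++ xs ys f)) (sym (ℚ.+-assoc (f x) (∑ xs f) (∑ ys f)))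

  ∑-map : ∀ (h : A → B) xs f → ∑ (map h xs) f ≡ ∑ xs (f ∘ h)
  ∑-map h []       f = refl
  ∑-map h (x ∷ xs) f = cong (f (h x) +_) (∑-map h xs f)

  ∑-concatMap : ∀ (h : A → List B) xs f → ∑ (concatMap h xs) f ≡ ∑ xs (λ x → ∑ (h x) f)
  ∑-concatMap h []       f = refl
  ∑-concatMap h (x ∷ xs) f =
    trans (∑-++ (h x) (concatMap h xs) f) (cong (∑ (h x) f +_) (∑-concatMap h xs f))

  ∑-+ : ∀ (xs : List A) f g → ∑ xs (λ x → f x + g x) ≡ ∑ xs f + ∑ xs g
  ∑-+ []       f g = refl
  ∑-+ (x ∷ xs) f g = trans (cong (f x + g x +_) (∑-+ xs f g))
    (solve 4 (λ a b c d → a :+ b :+ (c :+ d) := a :+ c :+ (b :+ d)) refl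
       (f x) (g x) (∑ xs f) (∑ xs g))

  ∑-*ˡ : ∀ c (xs : List A) f → ∑ xs (λ x → c * f x) ≡ c * ∑ xs f
  ∑-*ˡ c []       f = sym (ℚ.*-zeroʳ c)
  ∑-*ˡ c (x ∷ xs) f =
    trans (cong (c * f x +_) (∑-*ˡ c xs f)) (sym (ℚ.*-distribˡ-+ c (f x) (∑ xs f)))

  ∑-0 : ∀ (xs : List A) → ∑ xs (λ _ → 0ℚ) ≡ 0ℚ
  ∑-0 []       = refl
  ∑-0 (x ∷ xs) = trans (ℚ.+-identityˡ _) (∑-0 xs)

  ∑-swap : ∀ (xs : List A) (ys : List B) (f : A → B → ℚ) → ∑ xs (λ x → ∑ ys (f x)) ≡ ∑ ys (λ y → ∑ xs (λ x → f x y))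
  ∑-swap []       ys f = sym (∑-0 ys)
  ∑-swap (x ∷ xs) ys f = trans (cong (∑ ys (f x) +_) (∑-swap xs ys f))
    (sym (∑-+ ys (f x) (λ y → ∑ xs (λ z → f z y))))

  ∑-1 : ∀ (xs : List A) → ∑ xs (λ _ → 1ℚ) ≡ nat (length xs)
  ∑-1 []       = refl
  ∑-1 (x ∷ xs) = trans (cong (1ℚ +_) (∑-1 xs))
    (trans (ℚ.+-comm 1ℚ (nat (length xs))) (sym (nat-suc (length xs))))

  -- Choosing the first entry of a permutation.

  splits : List A → List (List A × A × List A)
  splits []       = []
  splits (x ∷ xs) = ([] , x , xs) ∷ map (map₁ (x ∷_)) (splits xs)

  splits-join : ∀ (xs : List A) → All (λ (us , x , vs) → us ++ x ∷ vs ≡ xs) (splits xs)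
  splits-join []       = []
  splits-join (x ∷ xs) = refl ∷ All.map⁺ (All.map (cong (x ∷_)) (splits-join xs))

  length-splits : ∀ (xs : List A) → length (splits xs) ≡ length xs
  length-splits []       = refl
  length-splits (x ∷ xs) = cong suc (trans (length-map (map₁ (x ∷_)) (splits xs)) (length-splits xs))

  ∑-splits-∷ : ∀ (x : A) xs f →
    ∑ (splits (x ∷ xs)) f ≡ f ([] , x , xs) + ∑ (splits xs) (f ∘ map₁ (x ∷_))
  ∑-splits-∷ x xs f = cong (f ([] , x , xs) +_) (∑-map (map₁ (x ∷_)) (splits xs) f)

  ∑-splits-++ : ∀ (xs ys : List A) f → ∑ (splits (xs ++ ys)) f ≡
    ∑ (splits xs) (λ (us , x , vs) → f (us , x , vs ++ ys)) +
    ∑ (splits ys) (λ (us , y , vs) → f (xs ++ us , y , vs))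
  ∑-splits-++ []       ys f = sym (ℚ.+-identityˡ (∑ (splits ys) f))
  ∑-splits-++ (x ∷ xs) ys f = begin
    ∑ (splits (x ∷ xs ++ ys)) f
      ≡⟨ ∑-splits-∷ x (xs ++ ys) f ⟩
    F + ∑ (splits (xs ++ ys)) (f ∘ map₁ (x ∷_))
      ≡⟨ cong (F +_) (∑-splits-++ xs ys (f ∘ map₁ (x ∷_))) ⟩
    F + (∑ (splits xs) (λ (us , x′ , vs) → f (x ∷ us , x′ , vs ++ ys)) + G)
      ≡⟨ sym (ℚ.+-assoc F _ G) ⟩
    F + ∑ (splits xs) (λ (us , x′ , vs) → f (x ∷ us , x′ , vs ++ ys)) + G
      ≡⟨ cong (_+ G) (sym (∑-splits-∷ x xs (λ (us , x , vs) → f (us , x , vs ++ ys)))) ⟩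
    ∑ (splits (x ∷ xs)) (λ (us , x , vs) → f (us , x , vs ++ ys)) + G ∎
    where
    F = f ([] , x , xs ++ ys)
    G = ∑ (splits ys) (λ (us , y , vs) → f (x ∷ xs ++ us , y , vs))

  ∑-permutations-∷ : ∀ x xs g →
    ∑ (permutations (x ∷ xs)) g ≡ ∑ (permutations xs) (λ ρ → ∑ (insertions x ρ) g)
  ∑-permutations-∷ x xs = ∑-concatMap (insertions x) (permutations xs)

  -- The lists of permutations are built by inserting the first element everywhere;
  -- quick sort needs them sorted by their head.
  ∑-permutations-head : ∀ x xs g → ∑ (permutations (x ∷ xs)) g ≡
    ∑ (splits (x ∷ xs)) (λ (us , y , vs) → ∑ (permutations (us ++ vs)) (λ ρ → g (y ∷ ρ)))
  ∑-permutations-head x []       g = sym (ℚ.+-identityʳ _)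
  ∑-permutations-head x (y ∷ ys) g = begin
    ∑ (permutations (x ∷ y ∷ ys)) g
      ≡⟨ ∑-permutations-∷ x (y ∷ ys) g ⟩
    ∑ (permutations (y ∷ ys)) (λ ρ → ∑ (insertions x ρ) g)
      ≡⟨ ∑-permutations-head y ys (λ ρ → ∑ (insertions x ρ) g) ⟩
    ∑ (splits (y ∷ ys)) (λ (us , z , vs) →
      ∑ (permutations (us ++ vs)) (λ ρ → g (x ∷ z ∷ ρ) + ∑ (map (z ∷_) (insertions x ρ)) g))
      ≡⟨ ∑-cong (splits (y ∷ ys)) (λ (us , z , vs) →
           trans (∑-+ (permutations (us ++ vs)) (λ ρ → g (x ∷ z ∷ ρ)) (λ ρ → ∑ (map (z ∷_) (insertions x ρ)) g))
             (cong (∑ (permutations (us ++ vs)) (λ ρ → g (x ∷ z ∷ ρ)) +_)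
               (trans (∑-cong (permutations (us ++ vs)) (λ ρ → ∑-map (z ∷_) (insertions x ρ) g))
                      (sym (∑-permutations-∷ x (us ++ vs) (g ∘ (z ∷_))))))) ⟩
    ∑ (splits (y ∷ ys)) (λ t → x-first t + x-later t)
      ≡⟨ ∑-+ (splits (y ∷ ys)) x-first x-later ⟩
    ∑ (splits (y ∷ ys)) x-first + ∑ (splits (y ∷ ys)) x-later
      ≡⟨ cong (_+ ∑ (splits (y ∷ ys)) x-later) (sym (∑-permutations-head y ys (g ∘ (x ∷_)))) ⟩
    ∑ (permutations (y ∷ ys)) (λ ρ → g (x ∷ ρ)) + ∑ (splits (y ∷ ys)) x-later
      ≡⟨ sym (∑-splits-∷ x (y ∷ ys)
           (λ (us , z , vs) → ∑ (permutations (us ++ vs)) (λ ρ → g (z ∷ ρ)))) ⟩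
    ∑ (splits (x ∷ y ∷ ys)) (λ (us , z , vs) → ∑ (permutations (us ++ vs)) (λ ρ → g (z ∷ ρ))) ∎
    where
    x-first x-later : List ℕ × ℕ × List ℕ → ℚ
    x-first (us , z , vs) = ∑ (permutations (us ++ vs)) (λ ρ → g (x ∷ z ∷ ρ))
    x-later (us , z , vs) = ∑ (permutations (x ∷ us ++ vs)) (λ ρ → g (z ∷ ρ))

  -- Uniform averages over permutations.

  average : List ℕ → (List ℕ → ℚ) → ℚ
  average xs g = 1/ length xs ! * ∑ (permutations xs) g

  average-cong : ∀ xs {f g} → (∀ {ρ} → ρ ↭ xs → f ρ ≡ g ρ) → average xs f ≡ average xs g
  average-cong xs e = cong (1/ length xs ! *_)
    (∑-cong-All (All.tabulate (λ ρ∈ → e (∈-permutations⁻ xs ρ∈))))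

  average-+ : ∀ xs f g → average xs (λ ρ → f ρ + g ρ) ≡ average xs f + average xs g
  average-+ xs f g = trans (cong (1/ length xs ! *_) (∑-+ (permutations xs) f g))
    (ℚ.*-distribˡ-+ (1/ length xs !) _ _)

  average-*ˡ : ∀ c xs f → average xs (λ ρ → c * f ρ) ≡ c * average xs f
  average-*ˡ c xs f = trans (cong (1/ length xs ! *_) (∑-*ˡ c (permutations xs) f))
    (solve 3 (λ w c s → w :* (c :* s) := c :* (w :* s)) refl
       (1/ length xs !) c (∑ (permutations xs) f))

  average-∑ : ∀ xs (ys : List B) (f : List ℕ → B → ℚ) →
    average xs (λ ρ → ∑ ys (f ρ)) ≡ ∑ ys (λ y → average xs (λ ρ → f ρ y))
  average-∑ xs ys f = trans (cong (1/ length xs ! *_) (∑-swap (permutations xs) ys f))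
    (sym (∑-*ˡ (1/ length xs !) ys (λ y → ∑ (permutations xs) (λ ρ → f ρ y))))

  average-[] : ∀ g → average [] g ≡ g []
  average-[] g = trans (ℚ.*-identityˡ _) (ℚ.+-identityʳ _)

  length-removed : ∀ (us : List A) {x vs xs} → us ++ x ∷ vs ≡ xs → suc (length (us ++ vs)) ≡ length xs
  length-removed us {x} {vs} refl = begin
    suc (length (us ++ vs))          ≡⟨ cong suc (length-++ us) ⟩
    suc (length us ℕ.+ length vs)    ≡⟨ sym (ℕ.+-suc (length us) (length vs)) ⟩
    length us ℕ.+ suc (length vs)    ≡⟨ sym (length-++ us) ⟩
    length (us ++ x ∷ vs)            ∎

  -- Conditioning on the first entry: the length cancels the leading `unit` of the reciprocal
  -- factorial, and what is left normalises the average over each list with one entry removed.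
  -- Multiplied out in this way, the identity also holds for the empty list.
  average-head : ∀ xs g → nat (length xs) * average xs g ≡
    ∑ (splits xs) (λ (us , x , vs) → average (us ++ vs) (λ ρ → g (x ∷ ρ)))
  average-head []         g = ℚ.*-zeroˡ (average [] g)
  average-head (x₀ ∷ xs₀) g = begin
    nat (suc n) * (unit n * 1/ n ! * ∑ (permutations xs) g)
      ≡⟨ solve 4 (λ a b c d → a :* (b :* c :* d) := a :* b :* (c :* d)) refl
           (nat (suc n)) (unit n) (1/ n !) (∑ (permutations xs) g) ⟩
    nat (suc n) * unit n * (1/ n ! * ∑ (permutations xs) g)
      ≡⟨ trans (cong (_* (1/ n ! * ∑ (permutations xs) g)) (nat-suc*unit n))
               (ℚ.*-identityˡ (1/ n ! * ∑ (permutations xs) g)) ⟩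
    1/ n ! * ∑ (permutations xs) g
      ≡⟨ cong (1/ n ! *_) (∑-permutations-head x₀ xs₀ g) ⟩
    1/ n ! * ∑ (splits xs) (λ (us , x , vs) → ∑ (permutations (us ++ vs)) (λ ρ → g (x ∷ ρ)))
      ≡⟨ sym (∑-*ˡ (1/ n !) (splits xs) _) ⟩
    ∑ (splits xs) (λ (us , x , vs) → 1/ n ! * ∑ (permutations (us ++ vs)) (λ ρ → g (x ∷ ρ)))
      ≡⟨ ∑-cong-All (All.map (λ { {us , x , vs} e → cong (λ m → 1/ m ! *
             ∑ (permutations (us ++ vs)) (λ ρ → g (x ∷ ρ)))
             (sym (ℕ.suc-injective (length-removed us e))) }) (splits-join xs)) ⟩
    ∑ (splits xs) (λ (us , x , vs) → average (us ++ vs) (λ ρ → g (x ∷ ρ))) ∎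
    where
    xs = x₀ ∷ xs₀
    n  = length xs₀

  -- Follows from `average-head` by induction on the length, so permutations need not be counted.
  average-1 : ∀ n xs → length xs ≡ n → average xs (λ _ → 1ℚ) ≡ 1ℚ
  average-1 zero    []       _    = average-[] (λ _ → 1ℚ)
  average-1 (suc n) (x ∷ xs) e₀   = nat-suc-cancel n (begin
    nat (suc n) * average (x ∷ xs) (λ _ → 1ℚ)
      ≡⟨ cong (λ k → nat k * average (x ∷ xs) (λ _ → 1ℚ)) (sym e₀) ⟩
    nat (length (x ∷ xs)) * average (x ∷ xs) (λ _ → 1ℚ)
      ≡⟨ average-head (x ∷ xs) (λ _ → 1ℚ) ⟩
    ∑ (splits (x ∷ xs)) (λ (us , y , vs) → average (us ++ vs) (λ _ → 1ℚ))
      ≡⟨ ∑-cong-All (All.map (λ { {us , _ , vs} e →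
           average-1 n (us ++ vs) (ℕ.suc-injective (trans (length-removed us e) e₀)) }) (splits-join (x ∷ xs))) ⟩
    ∑ (splits (x ∷ xs)) (λ _ → 1ℚ)
      ≡⟨ trans (∑-1 (splits (x ∷ xs))) (cong nat (trans (length-splits (x ∷ xs)) e₀)) ⟩
    nat (suc n)
      ≡⟨ sym (ℚ.*-identityʳ (nat (suc n))) ⟩
    nat (suc n) * 1ℚ ∎)

  -- A uniform permutation of xs ++ ys restricts to independent uniform permutations of xs
  -- and of ys: condition on which of the two lists the head comes from.
  module _ {L R : ℕ → Set} (L? : Decidable L) (R? : Decidable R) (L⇒¬R : ∀ {x} → L x → ¬ R x) where

    average-filter : ∀ n xs ys → length (xs ++ ys) ≡ n → All L xs → All R ys →
      ∀ (g : List ℕ → List ℕ → ℚ) →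
      average (xs ++ ys) (λ ρ → g (filter L? ρ) (filter R? ρ)) ≡
      average xs (λ σ → average ys (λ τ → g σ τ))
    average-filter zero    []         []       _ _ _ g =
      trans (average-[] (λ ρ → g (filter L? ρ) (filter R? ρ)))
        (sym (trans (average-[] (λ σ → average [] (g σ))) (average-[] (g []))))
    average-filter zero    []         (y ∷ ys) ()
    average-filter (suc n) xs         ys       e pxs qys g = nat-suc-cancel n (begin
      nat (suc n) * average (xs ++ ys) G
        ≡⟨ cong (λ k → nat k * average (xs ++ ys) G) (sym e) ⟩
      nat (length (xs ++ ys)) * average (xs ++ ys) G
        ≡⟨ average-head (xs ++ ys) G ⟩
      ∑ (splits (xs ++ ys)) (λ (us , x , vs) → average (us ++ vs) (λ ρ → G (x ∷ ρ)))
        ≡⟨ ∑-splits-++ xs ys _ ⟩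
      ∑ (splits xs) (λ (us , x , vs) → average (us ++ vs ++ ys) (λ ρ → G (x ∷ ρ))) +
      ∑ (splits ys) (λ (us , y , vs) → average ((xs ++ us) ++ vs) (λ ρ → G (y ∷ ρ)))
        ≡⟨ cong₂ _+_
             (∑-cong-All (All.map (λ { {us , x , vs} → left us x vs }) (splits-join xs)))
             (∑-cong-All (All.map (λ { {us , y , vs} → right us y vs }) (splits-join ys))) ⟩
      ∑ (splits xs) (λ (us , x , vs) → average (us ++ vs) (λ σ → average ys (g (x ∷ σ)))) +
      ∑ (splits ys) (λ (us , y , vs) → average xs (λ σ → average (us ++ vs) (λ τ → g σ (y ∷ τ))))
        -- `average-head` read backwards: on `xs` in the first sum and, under the average over `xs`,
        -- on `ys` in the second. Both sums become multiples of the same mean, with factors adding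
        -- up to the total length.
        ≡⟨ cong₂ _+_ (sym (average-head xs (λ σ → average ys (g σ))))
             (trans (sym (average-∑ xs (splits ys)
                      (λ { σ (us , y , vs) → average (us ++ vs) (λ τ → g σ (y ∷ τ)) })))
               (trans (average-cong xs (λ {σ} _ → sym (average-head ys (g σ))))
                      (average-*ˡ (nat (length ys)) xs (λ σ → average ys (g σ))))) ⟩
      nat (length xs) * mean + nat (length ys) * mean
        ≡⟨ sym (ℚ.*-distribʳ-+ mean (nat (length xs)) (nat (length ys))) ⟩
      (nat (length xs) + nat (length ys)) * mean
        ≡⟨ cong (_* mean) (trans (sym (nat-+ (length xs) (length ys)))
             (cong nat (trans (sym (length-++ xs)) e))) ⟩
      nat (suc n) * mean ∎)
      where
      G = λ ρ → g (filter L? ρ) (filter R? ρ)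
      mean = average xs (λ σ → average ys (g σ))
      left : ∀ us x vs → us ++ x ∷ vs ≡ xs →
        average (us ++ vs ++ ys) (λ ρ → G (x ∷ ρ)) ≡
        average (us ++ vs) (λ σ → average ys (g (x ∷ σ)))
      left us x vs refl = begin
        average (us ++ vs ++ ys) (λ ρ → G (x ∷ ρ))
          ≡⟨ cong₂ average (sym (++-assoc us vs ys)) refl ⟩
        average ((us ++ vs) ++ ys) (λ ρ → G (x ∷ ρ))
          ≡⟨ average-cong ((us ++ vs) ++ ys) (λ {ρ} _ → cong₂ g (filter-accept L? {xs = ρ} px)
               (filter-reject R? {xs = ρ} (L⇒¬R px))) ⟩
        average ((us ++ vs) ++ ys) (λ ρ → g (x ∷ filter L? ρ) (filter R? ρ))
          ≡⟨ average-filter n (us ++ vs) ys len (All.++⁺ (All.++⁻ˡ us pxs) (All.tail (All.++⁻ʳ us pxs)))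
               qys (λ σ → g (x ∷ σ)) ⟩
        average (us ++ vs) (λ σ → average ys (g (x ∷ σ))) ∎
        where
        px = All.head (All.++⁻ʳ us pxs)
        len : length ((us ++ vs) ++ ys) ≡ n
        len = ℕ.suc-injective (trans (cong (suc ∘ length) (++-assoc us vs ys))
          (trans (length-removed us {x} {vs ++ ys} (sym (++-assoc us (x ∷ vs) ys))) e))
      right : ∀ us y vs → us ++ y ∷ vs ≡ ys →
        average ((xs ++ us) ++ vs) (λ ρ → G (y ∷ ρ)) ≡
        average xs (λ σ → average (us ++ vs) (λ τ → g σ (y ∷ τ)))
      right us y vs refl = begin
        average ((xs ++ us) ++ vs) (λ ρ → G (y ∷ ρ))
          ≡⟨ cong₂ average (++-assoc xs us vs) refl ⟩
        average (xs ++ us ++ vs) (λ ρ → G (y ∷ ρ))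
          ≡⟨ average-cong (xs ++ us ++ vs) (λ {ρ} _ → cong₂ g
               (filter-reject L? {xs = ρ} (λ py → L⇒¬R py qy)) (filter-accept R? {xs = ρ} qy)) ⟩
        average (xs ++ us ++ vs) (λ ρ → g (filter L? ρ) (y ∷ filter R? ρ))
          ≡⟨ average-filter n xs (us ++ vs) len pxs
               (All.++⁺ (All.++⁻ˡ us qys) (All.tail (All.++⁻ʳ us qys))) (λ σ τ → g σ (y ∷ τ)) ⟩
        average xs (λ σ → average (us ++ vs) (λ τ → g σ (y ∷ τ))) ∎
        where
        qy = All.head (All.++⁻ʳ us qys)
        len : length (xs ++ us ++ vs) ≡ n
        len = ℕ.suc-injective (trans (cong (suc ∘ length) (sym (++-assoc xs us vs)))
          (trans (length-removed (xs ++ us) {y} {vs} (++-assoc xs us (y ∷ vs))) e))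

  -- The quick sort recurrence for expectations.

  Sorted : List ℕ → Set
  Sorted = AllPairs ℕ._<_

  sorted-split : ∀ us {x vs} → Sorted (us ++ x ∷ vs) →
    Sorted us × Sorted vs × All (ℕ._< x) us × All (x ℕ.<_) vs
  sorted-split []       (x< ∷ s) = [] , s , [] , x<
  sorted-split (u ∷ us) (u< ∷ s) =
    let sus , svs , us< , <vs = sorted-split us s
    in All.++⁻ˡ us u< ∷ sus , svs , All.head (All.++⁻ʳ us u<) ∷ us< , <vs

  -- Sizes of the sublists of smaller and larger elements, one pair for each rank of the pivot; so i
  -- + j + 1 = n throughout.
  pairs : ℕ → List (ℕ × ℕ)
  pairs zero    = []
  pairs (suc n) = (0 , n) ∷ map (map₁ suc) (pairs n)

  ∑-splits-length : ∀ (xs : List A) (h : ℕ × ℕ → ℚ) →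
    ∑ (splits xs) (λ (us , _ , vs) → h (length us , length vs)) ≡ ∑ (pairs (length xs)) h
  ∑-splits-length []       h = refl
  ∑-splits-length (x ∷ xs) h = begin
    ∑ (splits (x ∷ xs)) (λ (us , _ , vs) → h (length us , length vs))
      ≡⟨ ∑-splits-∷ x xs (λ (us , _ , vs) → h (length us , length vs)) ⟩
    h (0 , length xs) + ∑ (splits xs) (λ (us , _ , vs) → h (suc (length us) , length vs))
      ≡⟨ cong (h (0 , length xs) +_) (∑-splits-length xs (h ∘ map₁ suc)) ⟩
    h (0 , length xs) + ∑ (pairs (length xs)) (h ∘ map₁ suc)
      ≡⟨ cong (h (0 , length xs) +_) (sym (∑-map (map₁ suc) (pairs (length xs)) h)) ⟩
    ∑ (pairs (suc (length xs))) h ∎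

  -- Expectation of a function of the number of comparisons; the permutations averaged over are
  -- those in `S n`.
  E : ℕ → (ℕ → ℚ) → ℚ
  E n f = average (map suc (upTo n)) (f ∘ comparisons)

  sorted-range : ∀ n → Sorted (map suc (upTo n))
  sorted-range n = AllPairs.map⁺ (AllPairs.applyUpTo⁺₁ (λ i → i) n (λ i<j _ → ℕ.s≤s i<j))

  length-range : ∀ n → length (map suc (upTo n)) ≡ n
  length-range n = trans (length-map suc (upTo n)) (length-upTo n)

  -- Conditional expectation given the two sublist sizes: i + j comparisons with the pivot, plus two
  -- independent recursive counts.
  E-split : (ℕ → ℚ) → ℕ × ℕ → ℚ
  E-split f (i , j) = E i (λ a → E j (λ b → f (i ℕ.+ j ℕ.+ (a ℕ.+ b))))

  module _ (N : ℕ)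
    (average≡E : ∀ xs f → Sorted xs → length xs ℕ.≤ N → average xs (f ∘ comparisons) ≡ E (length xs) f)
    where

    -- The sublists of a sorted list need not be of the form 1 , ... , k, so the averages over them
    -- become values of `E` only through the hypothesis of this module. They are shorter than `xs`,
    -- hence the bound `N` there and `suc N` here.
    average-comparisons-rec : ∀ xs f → Sorted xs → length xs ℕ.≤ suc N →
      nat (length xs) * average xs (f ∘ comparisons) ≡ ∑ (pairs (length xs)) (E-split f)
    average-comparisons-rec xs f sorted bound = begin
      nat (length xs) * average xs (f ∘ comparisons)
        ≡⟨ average-head xs (f ∘ comparisons) ⟩
      ∑ (splits xs) (λ (us , x , vs) → average (us ++ vs) (λ ρ → f (comparisons (x ∷ ρ))))
        ≡⟨ ∑-cong-All (All.map (λ { {us , x , vs} → step us x vs }) (splits-join xs)) ⟩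
      ∑ (splits xs) (λ (us , _ , vs) → E-split f (length us , length vs))
        ≡⟨ ∑-splits-length xs (E-split f) ⟩
      ∑ (pairs (length xs)) (E-split f) ∎
      where
      step : ∀ us x vs → us ++ x ∷ vs ≡ xs →
        average (us ++ vs) (λ ρ → f (comparisons (x ∷ ρ))) ≡ E-split f (length us , length vs)
      step us x vs refl = begin
        average (us ++ vs) (λ ρ → f (comparisons (x ∷ ρ)))
          ≡⟨ average-cong (us ++ vs) (λ {ρ} ρ↭ → cong f (trans (comparisons-∷ x ρ)
               (cong (ℕ._+ (comparisons (filter (ℕ._<? x) ρ) ℕ.+ comparisons (filter (x ℕ.<?_) ρ)))
                 (trans (↭-length ρ↭) (length-++ us))))) ⟩
        average (us ++ vs) (λ ρ → f (i ℕ.+ j ℕ.+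
          (comparisons (filter (ℕ._<? x) ρ) ℕ.+ comparisons (filter (x ℕ.<?_) ρ))))
          -- Since `xs` is sorted, `us` lies below the pivot and `vs` above it, which makes the two
          -- filtered lists independent and uniform.
          ≡⟨ average-filter (ℕ._<? x) (x ℕ.<?_) (λ y<x x<y → ℕ.<-asym y<x x<y)
               _ us vs refl us< <vs (λ σ τ → f (i ℕ.+ j ℕ.+ (comparisons σ ℕ.+ comparisons τ))) ⟩
        average us (λ σ → average vs (λ τ → f (i ℕ.+ j ℕ.+ (comparisons σ ℕ.+ comparisons τ))))
          ≡⟨ average-cong us (λ {σ} _ →
               average≡E vs (λ b → f (i ℕ.+ j ℕ.+ (comparisons σ ℕ.+ b))) svs
                 (ℕ.≤-trans (ℕ.m≤n+m j i) i+j≤N)) ⟩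
        average us (λ σ → E j (λ b → f (i ℕ.+ j ℕ.+ (comparisons σ ℕ.+ b))))
          ≡⟨ average≡E us (λ a → E j (λ b → f (i ℕ.+ j ℕ.+ (a ℕ.+ b)))) sus
               (ℕ.≤-trans (ℕ.m≤m+n i j) i+j≤N) ⟩
        E-split f (i , j) ∎
        where
        i = length us
        j = length vs
        sus = proj₁ (sorted-split us sorted)
        svs = proj₁ (proj₂ (sorted-split us sorted))
        us< = proj₁ (proj₂ (proj₂ (sorted-split us sorted)))
        <vs = proj₂ (proj₂ (proj₂ (sorted-split us sorted)))
        i+j≤N : i ℕ.+ j ℕ.≤ N
        i+j≤N = ℕ.s≤s⁻¹ (ℕ.≤-trans (ℕ.≤-reflexive
          (trans (cong suc (sym (length-++ us))) (length-removed us {x} {vs} refl))) bound)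

  -- Only the relative order of the entries matters: `xs` and the range 1 , ... , n satisfy the same
  -- recurrence, whose right-hand side depends on the length alone. The bound `N` is the induction
  -- variable that feeds the preceding module.
  average≡E : ∀ N xs f → Sorted xs → length xs ℕ.≤ N → average xs (f ∘ comparisons) ≡ E (length xs) f
  average≡E N       []       f _ _ = refl
  average≡E (suc N) (x ∷ xs) f s h = nat-suc-cancel (length xs) (begin
    nat n * average (x ∷ xs) (f ∘ comparisons)
      ≡⟨ average-comparisons-rec N (average≡E N) (x ∷ xs) f s h ⟩
    ∑ (pairs n) (E-split f)
      ≡⟨ cong (λ k → ∑ (pairs k) (E-split f)) (sym (length-range n)) ⟩
    ∑ (pairs (length (map suc (upTo n)))) (E-split f)
      ≡⟨ sym (average-comparisons-rec N (average≡E N) (map suc (upTo n)) f (sorted-range n)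
           (subst (ℕ._≤ suc N) (sym (length-range n)) h)) ⟩
    nat (length (map suc (upTo n))) * E n f
      ≡⟨ cong (λ k → nat k * E n f) (length-range n) ⟩
    nat n * E n f ∎)
    where n = suc (length xs)

  E-rec : ∀ n f → nat n * E n f ≡ ∑ (pairs n) (E-split f)
  E-rec n f = begin
    nat n * E n f
      ≡⟨ cong (λ k → nat k * E n f) (sym (length-range n)) ⟩
    nat (length (map suc (upTo n))) * E n f
      ≡⟨ average-comparisons-rec (length (map suc (upTo n))) (average≡E _) (map suc (upTo n)) f
           (sorted-range n) (ℕ.n≤1+n _) ⟩
    ∑ (pairs (length (map suc (upTo n)))) (E-split f)
      ≡⟨ cong (λ k → ∑ (pairs k) (E-split f)) (length-range n) ⟩
    ∑ (pairs n) (E-split f) ∎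

  E-cong : ∀ n {f g} → (∀ k → f k ≡ g k) → E n f ≡ E n g
  E-cong n e = average-cong (map suc (upTo n)) (λ {ρ} _ → e (comparisons ρ))

  E-+ : ∀ n f g → E n (λ k → f k + g k) ≡ E n f + E n g
  E-+ n f g = average-+ (map suc (upTo n)) (f ∘ comparisons) (g ∘ comparisons)

  E-*ˡ : ∀ n c f → E n (λ k → c * f k) ≡ c * E n f
  E-*ˡ n c f = average-*ˡ c (map suc (upTo n)) (f ∘ comparisons)

  E-1 : ∀ n → E n (λ _ → 1ℚ) ≡ 1ℚ
  E-1 n = average-1 _ (map suc (upTo n)) refl

  E-0 : ∀ f → E 0 f ≡ f 0
  E-0 f = average-[] (f ∘ comparisons)

  -- From the counts `a n k` to expectations.

  δ : ℕ → ℕ → ℚ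
  δ zero    zero    = 1ℚ
  δ zero    (suc k) = 0ℚ
  δ (suc c) zero    = 0ℚ
  δ (suc c) (suc k) = δ c k

  δ-refl : ∀ c → δ c c ≡ 1ℚ
  δ-refl zero    = refl
  δ-refl (suc c) = δ-refl c

  δ-≢ : ∀ {c k} → c ≢ k → δ c k ≡ 0ℚ
  δ-≢ {zero}  {zero}  c≢k = contradiction refl c≢k
  δ-≢ {zero}  {suc k} c≢k = refl
  δ-≢ {suc c} {zero}  c≢k = refl
  δ-≢ {suc c} {suc k} c≢k = δ-≢ (c≢k ∘ cong suc)

  sum-*0 : ∀ K (F : ℕ → ℚ) → ∑[ k < K ] (F (toℕ k) * 0ℚ) ≡ 0ℚ
  sum-*0 zero    F = refl
  sum-*0 (suc K) F = begin
    F 0 * 0ℚ + ∑[ k < K ] (F (suc (toℕ k)) * 0ℚ)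
      ≡⟨ cong₂ _+_ (ℚ.*-zeroʳ (F 0)) (sum-*0 K (F ∘ suc)) ⟩
    0ℚ ∎

  sum-δ : ∀ K (F : ℕ → ℚ) {c} → c ℕ.< K → ∑[ k < K ] (F (toℕ k) * δ c (toℕ k)) ≡ F c
  sum-δ (suc K) F {zero}  _ = begin
    F 0 * 1ℚ + ∑[ k < K ] (F (suc (toℕ k)) * 0ℚ)
      ≡⟨ cong₂ _+_ (ℚ.*-identityʳ (F 0)) (sum-*0 K (F ∘ suc)) ⟩
    F 0 + 0ℚ
      ≡⟨ ℚ.+-identityʳ (F 0) ⟩
    F 0 ∎
  sum-δ (suc K) F {suc c} (ℕ.s≤s h) = begin
    F 0 * 0ℚ + ∑[ k < K ] (F (suc (toℕ k)) * δ c (toℕ k))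
      ≡⟨ cong₂ _+_ (ℚ.*-zeroʳ (F 0)) (sum-δ K (F ∘ suc) h) ⟩
    0ℚ + F (suc c)
      ≡⟨ ℚ.+-identityˡ (F (suc c)) ⟩
    F (suc c) ∎

  module _ (c : A → ℕ) where

    count : List A → ℕ → ℕ
    count xs k = length (filter (λ x → c x ℕ.≟ k) xs)

    count-∷ : ∀ x xs k → nat (count (x ∷ xs) k) ≡ δ (c x) k + nat (count xs k)
    count-∷ x xs k with c x ℕ.≟ k
    ... | yes refl = begin
      nat (count (x ∷ xs) (c x))       ≡⟨ cong (nat ∘ length) (filter-accept (λ x′ → c x′ ℕ.≟ c x) {xs = xs} refl) ⟩
      nat (suc (count xs (c x)))       ≡⟨ nat-suc (count xs (c x)) ⟩
      nat (count xs (c x)) + 1ℚ        ≡⟨ ℚ.+-comm (nat (count xs (c x))) 1ℚ ⟩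
      1ℚ + nat (count xs (c x))        ≡⟨ cong (_+ nat (count xs (c x))) (sym (δ-refl (c x))) ⟩
      δ (c x) (c x) + nat (count xs (c x)) ∎
    ... | no  c≢k = begin
      nat (count (x ∷ xs) k)           ≡⟨ cong (nat ∘ length) (filter-reject (λ x′ → c x′ ℕ.≟ k) {xs = xs} c≢k) ⟩
      nat (count xs k)                 ≡⟨ sym (ℚ.+-identityˡ (nat (count xs k))) ⟩
      0ℚ + nat (count xs k)            ≡⟨ cong (_+ nat (count xs k)) (sym (δ-≢ c≢k)) ⟩
      δ (c x) k + nat (count xs k)     ∎

    -- Double counting: each entry adds one `δ` to the counts, and the hypothesis keeps its value
    -- inside the range of summation.
    sum-count : ∀ K (F : ℕ → ℚ) {xs} → All (λ x → c x ℕ.< K) xs →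
      ∑[ k < K ] (F (toℕ k) * nat (count xs (toℕ k))) ≡ ∑ xs (F ∘ c)
    sum-count K F []                  = sum-*0 K F
    sum-count K F {x ∷ xs} (cx<K ∷ h) = begin
      ∑[ k < K ] (F (toℕ k) * nat (count (x ∷ xs) (toℕ k)))
        ≡⟨ sum-cong-≗ {K} (λ k → trans (cong (F (toℕ k) *_) (count-∷ x xs (toℕ k)))
             (ℚ.*-distribˡ-+ (F (toℕ k)) (δ (c x) (toℕ k)) (nat (count xs (toℕ k))))) ⟩
      ∑[ k < K ] (F (toℕ k) * δ (c x) (toℕ k) + F (toℕ k) * nat (count xs (toℕ k)))
        ≡⟨ ∑-distrib-+ {K} (λ k → F (toℕ k) * δ (c x) (toℕ k)) (λ k → F (toℕ k) * nat (count xs (toℕ k))) ⟩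
      ∑[ k < K ] (F (toℕ k) * δ (c x) (toℕ k)) + ∑[ k < K ] (F (toℕ k) * nat (count xs (toℕ k)))
        ≡⟨ cong₂ _+_ (sum-δ K F cx<K) (sum-count K F h) ⟩
      F (c x) + ∑ xs (F ∘ c) ∎

  -- The numbers `a n k` divided by `n !` are the distribution of the number of comparisons.
  -- Truncating at k = n² loses nothing by `comparisonsWithin-≤`.
  β≡E : ∀ s n → β s n ≡ E n (λ k → nat (k P s))
  β≡E s n = begin
    β s n
      ≡⟨ sum-cong-≗ {suc (n ℕ.* n)} (λ k → trans (cong (nat (toℕ k P s) *_) (/-! (a n (toℕ k)) n))
           (solve 3 (λ x y w → x :* (y :* w) := w :* x :* y) refl
              (nat (toℕ k P s)) (nat (a n (toℕ k))) (1/ n !))) ⟩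
    ∑[ k < suc (n ℕ.* n) ] (1/ n ! * nat (toℕ k P s) * nat (a n (toℕ k)))
      ≡⟨ sum-count comparisons (suc (n ℕ.* n)) (λ k → 1/ n ! * nat (k P s)) bound ⟩
    ∑ (S n) (λ π → 1/ n ! * nat (comparisons π P s))
      ≡⟨ ∑-*ˡ (1/ n !) (S n) (λ π → nat (comparisons π P s)) ⟩
    1/ n ! * ∑ (S n) (λ π → nat (comparisons π P s))
      ≡⟨ cong (λ m → 1/ m ! * ∑ (S n) (λ π → nat (comparisons π P s))) (sym (length-range n)) ⟩
    E n (λ k → nat (k P s)) ∎
    where
    bound : All (λ π → comparisons π ℕ.< suc (n ℕ.* n)) (S n)
    bound = All.tabulate λ {π} π∈ → ℕ.s≤s (subst (λ l → comparisons π ℕ.≤ l ℕ.* l)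
      (trans (↭-length (∈-permutations⁻ (map suc (upTo n)) π∈)) (length-range n))
      (comparisonsWithin-≤ (length π) π))

module Moments where

  open import Data.Rational.Base using (_+_; _*_; _-_; -_; ∣_∣; _≤_; _<_; nonNegative; positive)
  open Algebra.Properties.CommutativeSemiring.Exp commutativeSemiring using (_^_; ^-homo-*)
  open import Defs using (unit; harmonic; comparisons; module Harmonic; module Rational)
  open Harmonic using (nat; nat-suc; nat-suc-*; harmonic-mono)
  open Rational using (*-mono-≤; 0≤∣∣; a≤∣a∣; ∣∣-≤; unit-antimono)
  open Expectation

  private variable
    A : Set

  -- Order lemmas and a calculus of uniform bounds.

  nat-nonneg : ∀ n → 0ℚ ≤ nat n
  nat-nonneg n = ℚ.nonNegative⁻¹ (nat n) {{ℚ.normalize-nonNeg n 1}}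

  nat-mono : ∀ {m n} → m ℕ.≤ n → nat m ≤ nat n
  nat-mono = Harmonic.monotone nat λ n → subst₂ _≤_ (ℚ.+-identityʳ (nat n)) (sym (nat-suc n))
    (ℚ.+-monoʳ-≤ (nat n) (ℚ.nonNegative⁻¹ 1ℚ))

  *-nonneg : ∀ {p q} → 0ℚ ≤ p → 0ℚ ≤ q → 0ℚ ≤ p * q
  *-nonneg {p} {q} 0≤p 0≤q = subst (_≤ p * q) (ℚ.*-zeroˡ 0ℚ) (*-mono-≤ 0≤p ℚ.≤-refl 0≤p 0≤q)

  +-nonneg : ∀ {p q} → 0ℚ ≤ p → 0ℚ ≤ q → 0ℚ ≤ p + q
  +-nonneg = ℚ.+-mono-≤

  ^-nonneg : ∀ {p} → 0ℚ ≤ p → ∀ k → 0ℚ ≤ p ^ k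
  ^-nonneg 0≤p zero    = ℚ.nonNegative⁻¹ 1ℚ
  ^-nonneg 0≤p (suc k) = *-nonneg 0≤p (^-nonneg 0≤p k)

  *-monoˡ : ∀ {p q r} → 0ℚ ≤ r → p ≤ q → r * p ≤ r * q
  *-monoˡ {r = r} 0≤r = ℚ.*-monoˡ-≤-nonNeg r {{nonNegative 0≤r}}

  *-cancelˡ : ∀ {p q} r → 0ℚ < r → r * p ≤ r * q → p ≤ q
  *-cancelˡ r 0<r = ℚ.*-cancelˡ-≤-pos r {{positive 0<r}}

  module BigO (I : Set) where

    infix 4 _≲_

    -- One constant for the whole index type, not just eventually. The index types will be ℕ, ℕ × ℕ
    -- and `Point`; on the last one, uniformity is what allows the passage to real numbers. Absolute
    -- values on both sides keep the calculus free of sign conditions.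
    record _≲_ (f h : I → ℚ) : Set where
      constructor big-O
      field
        constant        : ℚ
        constant-nonneg : 0ℚ ≤ constant
        bound           : ∀ i → ∣ f i ∣ ≤ constant * ∣ h i ∣

    private variable
      f g h k : I → ℚ

    ≤⇒≲ : (∀ i → ∣ f i ∣ ≤ ∣ h i ∣) → f ≲ h
    ≤⇒≲ {h = h} f≤h = big-O 1ℚ (ℚ.nonNegative⁻¹ 1ℚ)
      λ i → subst (_ ≤_) (sym (ℚ.*-identityˡ ∣ h i ∣)) (f≤h i)

    ≲-reflexive : (∀ i → f i ≡ h i) → f ≲ h
    ≲-reflexive f≡h = ≤⇒≲ λ i → ℚ.≤-reflexive (cong ∣_∣ (f≡h i))

    ≲-refl : f ≲ f
    ≲-refl = ≲-reflexive λ _ → refl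

    ≲-trans : f ≲ g → g ≲ h → f ≲ h
    ≲-trans {h = h} (big-O C 0≤C p) (big-O D 0≤D q) = big-O (C * D) (*-nonneg 0≤C 0≤D)
      λ i → ℚ.≤-trans (p i) (ℚ.≤-trans (*-monoˡ 0≤C (q i))
        (ℚ.≤-reflexive (sym (ℚ.*-assoc C D ∣ h i ∣))))

    ≲-respˡ : (∀ i → g i ≡ f i) → f ≲ h → g ≲ h
    ≲-respˡ e = ≲-trans (≲-reflexive e)

    ≲-respʳ : (∀ i → h i ≡ k i) → f ≲ h → f ≲ k
    ≲-respʳ e p = ≲-trans p (≲-reflexive e)

    ≲-0 : (λ _ → 0ℚ) ≲ h
    ≲-0 {h} = ≤⇒≲ λ i → 0≤∣∣ (h i)

    ≲-const : ∀ c → (λ _ → c) ≲ (λ _ → 1ℚ)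
    ≲-const c = big-O ∣ c ∣ (0≤∣∣ c) λ _ → ℚ.≤-reflexive (sym (ℚ.*-identityʳ ∣ c ∣))

    ≲-+ : f ≲ h → g ≲ h → (λ i → f i + g i) ≲ h
    ≲-+ {f} {h} {g} (big-O C 0≤C p) (big-O D 0≤D q) = big-O (C + D) (+-nonneg 0≤C 0≤D)
      λ i → ℚ.≤-trans (ℚ.∣p+q∣≤∣p∣+∣q∣ (f i) (g i)) (ℚ.≤-trans (ℚ.+-mono-≤ (p i) (q i))
        (ℚ.≤-reflexive (sym (ℚ.*-distribʳ-+ ∣ h i ∣ C D))))

    ≲-neg : f ≲ h → (λ i → - f i) ≲ h
    ≲-neg {f} p = ≲-trans (≤⇒≲ λ i → ℚ.≤-reflexive (ℚ.∣-p∣≡∣p∣ (f i))) p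

    ≲-* : f ≲ h → g ≲ k → (λ i → f i * g i) ≲ (λ i → h i * k i)
    ≲-* {f} {h} {g} {k} (big-O C 0≤C p) (big-O D 0≤D q) = big-O (C * D) (*-nonneg 0≤C 0≤D) λ i →
      begin
      ∣ f i * g i ∣                      ≡⟨ ℚ.∣p*q∣≡∣p∣*∣q∣ (f i) (g i) ⟩
      (∣ f i ∣) * (∣ g i ∣)              ≤⟨ *-mono-≤ (*-nonneg 0≤C (0≤∣∣ (h i))) (0≤∣∣ (g i)) (p i) (q i) ⟩
      C * (∣ h i ∣) * (D * (∣ k i ∣))        ≡⟨ solve 4 (λ a b c d → a :* b :* (c :* d) := a :* c :* (b :* d))
                                              refl C (∣ h i ∣) D (∣ k i ∣) ⟩
      C * D * ((∣ h i ∣) * (∣ k i ∣))        ≡⟨ cong (C * D *_) (sym (ℚ.∣p*q∣≡∣p∣*∣q∣ (h i) (k i))) ⟩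
      C * D * ∣ h i * k i ∣              ∎
      where open ℚ.≤-Reasoning

    ≲-*ˡ : ∀ c → f ≲ h → (λ i → c * f i) ≲ h
    ≲-*ˡ {h = h} c p = ≲-respʳ (λ i → ℚ.*-identityˡ (h i)) (≲-* (≲-const c) p)

    ≲-^ : f ≲ h → ∀ m → (λ i → f i ^ m) ≲ (λ i → h i ^ m)
    ≲-^ p zero    = ≲-refl
    ≲-^ p (suc m) = ≲-* p (≲-^ p m)

  module _ {I J : Set} (φ : I → J) {f h : J → ℚ} where

    private
      module I = BigO I
      module J = BigO J

    ≲-reindex : f J.≲ h → (f ∘ φ) I.≲ (h ∘ φ)
    ≲-reindex (J.big-O C 0≤C b) = I.big-O C 0≤C (b ∘ φ)

  -- The mean and the size of the toll.

  -- The mean of the number of comparisons.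
  μ : ℕ → ℚ
  μ n = nat 2 * (nat n + 1ℚ) * harmonic n - nat 4 * nat n

  -- The centred toll function: X - μ satisfies the quick sort recurrence with this toll.
  toll : ℕ × ℕ → ℚ
  toll (i , j) = nat (i ℕ.+ j) + μ i + μ j - μ (suc (i ℕ.+ j))

  size : ℕ × ℕ → ℚ
  size (i , j) = nat (suc (i ℕ.+ j))

  harmonic-growth : ∀ i d → harmonic (d ℕ.+ i) ≤ harmonic i + nat d * unit i
  harmonic-growth i zero    = ℚ.≤-reflexive (sym (trans (cong (harmonic i +_) (ℚ.*-zeroˡ (unit i)))
    (ℚ.+-identityʳ (harmonic i))))
  harmonic-growth i (suc d) = begin
    harmonic (d ℕ.+ i) + unit (d ℕ.+ i)
      ≤⟨ ℚ.+-mono-≤ (harmonic-growth i d) (unit-antimono (ℕ.m≤n+m i d)) ⟩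
    harmonic i + nat d * unit i + unit i
      ≡⟨ trans (ℚ.+-assoc (harmonic i) _ _) (cong (harmonic i +_) (sym (nat-suc-* d (unit i)))) ⟩
    harmonic i + nat (suc d) * unit i ∎
    where open ℚ.≤-Reasoning

  -- The weight i + 1 is the one of the harmonic number in `μ`. It compensates the size of the d
  -- reciprocals involved, each at most 1/(i+1), so a gap lies between 0 and d and carries no
  -- logarithm.
  gap : ℕ → ℕ → ℚ
  gap i d = (nat i + 1ℚ) * (harmonic (d ℕ.+ i) - harmonic i)

  gap-nonneg : ∀ i d → 0ℚ ≤ gap i d
  gap-nonneg i d = *-nonneg (+-nonneg (nat-nonneg i) (ℚ.nonNegative⁻¹ 1ℚ))
    (Rational.0≤q-p (harmonic-mono (ℕ.m≤n+m i d)))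

  gap-≤ : ∀ i d → gap i d ≤ nat d
  gap-≤ i d = begin
    (nat i + 1ℚ) * (harmonic (d ℕ.+ i) - harmonic i)
      ≤⟨ *-monoˡ (+-nonneg (nat-nonneg i) (ℚ.nonNegative⁻¹ 1ℚ))
           (Rational.p≤q+r⇒p-q≤r (harmonic-growth i d)) ⟩
    (nat i + 1ℚ) * (nat d * unit i)
      ≡⟨ solve 3 (λ a b c → a :* (b :* c) := b :* (a :* c)) refl (nat i + 1ℚ) (nat d) (unit i) ⟩
    nat d * ((nat i + 1ℚ) * unit i)
      ≡⟨ cong (nat d *_) (trans (cong (_* unit i) (sym (nat-suc i))) (nat-suc*unit i)) ⟩
    nat d * 1ℚ
      ≡⟨ ℚ.*-identityʳ (nat d) ⟩
    nat d ∎
    where open ℚ.≤-Reasoning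

  -- With n = i + j + 1 the weight n + 1 is (i + 1) + (j + 1), so the harmonic number of n is shared
  -- out between the two sublists and only differences remain. This cancellation makes the toll
  -- linear instead of n log n.
  toll-gaps : ∀ i j → toll (i , j) ≡
    nat i + nat j + nat 4 - nat 2 * (gap i (suc j) + gap j (suc i))
  toll-gaps i j = begin
    nat (i ℕ.+ j) + μ i + μ j - μ (suc (i ℕ.+ j))
      ≡⟨ cong₂ (λ u v → u + μ i + μ j - (nat 2 * (v + 1ℚ) * hn - nat 4 * v)) (nat-+ i j)
           (trans (nat-suc (i ℕ.+ j)) (cong (_+ 1ℚ) (nat-+ i j))) ⟩
    x + y + μ i + μ j - (nat 2 * (x + y + 1ℚ + 1ℚ) * hn - nat 4 * (x + y + 1ℚ))
      ≡⟨ solve 5 (λ x y a b c →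
           x :+ y :+ (con (nat 2) :* (x :+ con 1ℚ) :* a :- con (nat 4) :* x)
             :+ (con (nat 2) :* (y :+ con 1ℚ) :* b :- con (nat 4) :* y)
             :- (con (nat 2) :* (x :+ y :+ con 1ℚ :+ con 1ℚ) :* c :- con (nat 4) :* (x :+ y :+ con 1ℚ)) :=
           x :+ y :+ con (nat 4) :- con (nat 2) :* ((x :+ con 1ℚ) :* (c :- a) :+ (y :+ con 1ℚ) :* (c :- b)))
           refl x y (harmonic i) (harmonic j) hn ⟩
    x + y + nat 4 - nat 2 * ((x + 1ℚ) * (hn - harmonic i) + (y + 1ℚ) * (hn - harmonic j))
      ≡⟨ cong (λ k → x + y + nat 4 - nat 2 *
           ((x + 1ℚ) * (harmonic (suc k) - harmonic i) + gap j (suc i))) (ℕ.+-comm i j) ⟩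
    x + y + nat 4 - nat 2 * (gap i (suc j) + gap j (suc i)) ∎
    where
    open ≡-Reasoning
    x = nat i
    y = nat j
    hn = harmonic (suc (i ℕ.+ j))

  -- The two gaps add up to something between 0 and i + j + 2, so the toll lies between - (i + j)
  -- and i + j + 4. The constant 4 is what the upper end requires at i = j = 0.
  toll-bound : ∀ t → ∣ toll t ∣ ≤ nat 4 * ∣ size t ∣
  toll-bound (i , j) = ℚ.≤-trans (∣∣-≤ upper lower) (*-monoˡ {r = nat 4} (nat-nonneg 4) (a≤∣a∣ (size (i , j))))
    where
    open ℚ.≤-Reasoning
    x = nat i
    y = nat j
    G = gap i (suc j) + gap j (suc i)
    0≤G : 0ℚ ≤ G
    0≤G = +-nonneg (gap-nonneg i (suc j)) (gap-nonneg j (suc i))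
    size≡ : size (i , j) ≡ x + y + 1ℚ
    size≡ = trans (nat-suc (i ℕ.+ j)) (cong (_+ 1ℚ) (nat-+ i j))
    0≤x+y : 0ℚ ≤ x + y
    0≤x+y = +-nonneg (nat-nonneg i) (nat-nonneg j)
    upper : toll (i , j) ≤ nat 4 * size (i , j)
    upper = begin
      toll (i , j)                     ≡⟨ toll-gaps i j ⟩
      x + y + nat 4 - nat 2 * G        ≤⟨ ℚ.+-monoʳ-≤ (x + y + nat 4)
                                            (ℚ.neg-antimono-≤ (*-nonneg {nat 2} (nat-nonneg 2) 0≤G)) ⟩
      x + y + nat 4 - 0ℚ               ≡⟨ solve 1 (λ z → z :+ con (nat 4) :- con 0ℚ :=
                                            con 0ℚ :+ con (nat 4) :+ z) refl (x + y) ⟩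
      0ℚ + nat 4 + (x + y)             ≤⟨ ℚ.+-monoˡ-≤ (x + y) (ℚ.+-monoˡ-≤ (nat 4)
                                            (*-nonneg {nat 3} (nat-nonneg 3) 0≤x+y)) ⟩
      nat 3 * (x + y) + nat 4 + (x + y) ≡⟨ solve 1 (λ z → con (nat 3) :* z :+ con (nat 4) :+ z :=
                                            con (nat 4) :* (z :+ con 1ℚ)) refl (x + y) ⟩
      nat 4 * (x + y + 1ℚ)             ≡⟨ cong (nat 4 *_) (sym size≡) ⟩
      nat 4 * size (i , j)             ∎
    lower : - toll (i , j) ≤ nat 4 * size (i , j)
    lower = begin
      - toll (i , j)                   ≡⟨ cong -_ (toll-gaps i j) ⟩
      - (x + y + nat 4 - nat 2 * G)    ≡⟨ solve 2 (λ z g → :- (z :+ con (nat 4) :- con (nat 2) :* g) :=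
                                            con (nat 2) :* g :+ (:- z :- con (nat 4))) refl (x + y) G ⟩
      nat 2 * G + (- (x + y) - nat 4)  ≤⟨ ℚ.+-monoˡ-≤ (- (x + y) - nat 4) (*-monoˡ {r = nat 2} (nat-nonneg 2)
                                            (ℚ.+-mono-≤ (gap-≤ i (suc j)) (gap-≤ j (suc i)))) ⟩
      nat 2 * (nat (suc j) + nat (suc i)) + (- (x + y) - nat 4)
        ≡⟨ cong₂ (λ u v → nat 2 * (u + v) + (- (x + y) - nat 4)) (nat-suc j) (nat-suc i) ⟩
      nat 2 * ((y + 1ℚ) + (x + 1ℚ)) + (- (x + y) - nat 4)
        ≡⟨ solve 2 (λ x y → con (nat 2) :* ((y :+ con 1ℚ) :+ (x :+ con 1ℚ)) :+ (:- (x :+ y) :- con (nat 4)) :=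
             x :+ y :+ con 0ℚ) refl x y ⟩
      x + y + 0ℚ                       ≤⟨ ℚ.+-monoʳ-≤ (x + y) (+-nonneg (*-nonneg {nat 3} (nat-nonneg 3) 0≤x+y) (nat-nonneg 4)) ⟩
      x + y + (nat 3 * (x + y) + nat 4) ≡⟨ solve 1 (λ z → z :+ (con (nat 3) :* z :+ con (nat 4)) :=
                                            con (nat 4) :* (z :+ con 1ℚ)) refl (x + y) ⟩
      nat 4 * (x + y + 1ℚ)             ≡⟨ cong (nat 4 *_) (sym size≡) ⟩
      nat 4 * size (i , j)             ∎

  -- Sums over sublist sizes; the toll has mean zero.

  ∑< : ℕ → (ℕ → ℚ) → ℚ
  ∑< zero    f = 0ℚ
  ∑< (suc n) f = ∑< n f + f n

  ∑<-shift : ∀ n f → f 0 + ∑< n (f ∘ suc) ≡ ∑< (suc n) f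
  ∑<-shift zero    f = ℚ.+-comm (f 0) 0ℚ
  ∑<-shift (suc n) f = trans (sym (ℚ.+-assoc (f 0) (∑< n (f ∘ suc)) (f (suc n))))
    (cong (_+ f (suc n)) (∑<-shift n f))

  pairs-sum : ∀ n → All (λ (i , j) → suc (i ℕ.+ j) ≡ n) (pairs n)
  pairs-sum zero    = []
  pairs-sum (suc n) = refl ∷ All.map⁺ (All.map (cong suc) (pairs-sum n))

  length-pairs : ∀ n → ∑ (pairs n) (λ _ → 1ℚ) ≡ nat n
  length-pairs zero    = refl
  length-pairs (suc n) = begin
    1ℚ + ∑ (map (map₁ suc) (pairs n)) (λ _ → 1ℚ)
      ≡⟨ cong (1ℚ +_) (trans (∑-map (map₁ suc) (pairs n) (λ _ → 1ℚ)) (length-pairs n)) ⟩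
    1ℚ + nat n
      ≡⟨ trans (ℚ.+-comm 1ℚ (nat n)) (sym (nat-suc n)) ⟩
    nat (suc n) ∎
    where open ≡-Reasoning

  ∑-pairs-proj₂ : ∀ n f → ∑ (pairs n) (f ∘ proj₂) ≡ ∑< n f
  ∑-pairs-proj₂ zero    f = refl
  ∑-pairs-proj₂ (suc n) f = trans (cong (f n +_)
    (trans (∑-map (map₁ suc) (pairs n) (f ∘ proj₂)) (∑-pairs-proj₂ n f))) (ℚ.+-comm (f n) (∑< n f))

  ∑-pairs-proj₁ : ∀ n f → ∑ (pairs n) (f ∘ proj₁) ≡ ∑< n f
  ∑-pairs-proj₁ zero    f = refl
  ∑-pairs-proj₁ (suc n) f = trans (cong (f 0 +_)
    (trans (∑-map (map₁ suc) (pairs n) (f ∘ proj₁)) (∑-pairs-proj₁ n (f ∘ suc)))) (∑<-shift n f)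

  -- The recurrence n μ(n) = n (n - 1) + 2 (μ(0) + ... + μ(n - 1)) of the mean, at n = m + 1.
  -- Consecutive instances differ by (n + 1) μ(n + 1) = (n + 2) μ(n) + 2 n, which the closed form
  -- satisfies.
  ∑-μ : ∀ m → (nat m + 1ℚ) * nat m + nat 2 * ∑< (suc m) μ ≡ (nat m + 1ℚ) * μ (suc m)
  ∑-μ zero    = refl
  ∑-μ (suc m) = begin
    (nat (suc m) + 1ℚ) * nat (suc m) + nat 2 * (∑< (suc m) μ + μ (suc m))
      ≡⟨ cong (λ y → (y + 1ℚ) * y + nat 2 * (∑< (suc m) μ + μ (suc m))) (nat-suc m) ⟩
    (x + 1ℚ + 1ℚ) * (x + 1ℚ) + nat 2 * (∑< (suc m) μ + μ (suc m))
      ≡⟨ solve 3 (λ x s u → (x :+ con 1ℚ :+ con 1ℚ) :* (x :+ con 1ℚ) :+ con (nat 2) :* (s :+ u) :=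
           ((x :+ con 1ℚ) :* x :+ con (nat 2) :* s) :+ con (nat 2) :* (x :+ con 1ℚ) :+ con (nat 2) :* u)
           refl x (∑< (suc m) μ) (μ (suc m)) ⟩
    ((x + 1ℚ) * x + nat 2 * ∑< (suc m) μ) + nat 2 * (x + 1ℚ) + nat 2 * μ (suc m)
      ≡⟨ cong (λ t → t + nat 2 * (x + 1ℚ) + nat 2 * μ (suc m)) (∑-μ m) ⟩
    (x + 1ℚ) * μ (suc m) + nat 2 * (x + 1ℚ) + nat 2 * μ (suc m)
      ≡⟨ cong (λ y → (x + 1ℚ) * (nat 2 * (y + 1ℚ) * h - nat 4 * y) + nat 2 * (x + 1ℚ)
           + nat 2 * (nat 2 * (y + 1ℚ) * h - nat 4 * y)) (nat-suc m) ⟩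
    (x + 1ℚ) * (nat 2 * (x + 1ℚ + 1ℚ) * h - nat 4 * (x + 1ℚ)) + nat 2 * (x + 1ℚ)
      + nat 2 * (nat 2 * (x + 1ℚ + 1ℚ) * h - nat 4 * (x + 1ℚ))
      ≡⟨ solve 2 (λ x h → (x :+ con 1ℚ) :* (con (nat 2) :* (x :+ con 1ℚ :+ con 1ℚ) :* h :- con (nat 4) :* (x :+ con 1ℚ))
             :+ con (nat 2) :* (x :+ con 1ℚ)
             :+ con (nat 2) :* (con (nat 2) :* (x :+ con 1ℚ :+ con 1ℚ) :* h :- con (nat 4) :* (x :+ con 1ℚ)) :=
           (x :+ con 1ℚ :+ con 1ℚ) :* (con (nat 2) :* (x :+ con 1ℚ :+ con 1ℚ :+ con 1ℚ) :* h
             :- con (nat 4) :* (x :+ con 1ℚ :+ con 1ℚ))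
             :+ con (nat 2) :* (x :+ con 1ℚ :+ con 1ℚ :+ con 1ℚ) :* con 1ℚ)
           refl x h ⟩
    (x + 1ℚ + 1ℚ) * (nat 2 * (x + 1ℚ + 1ℚ + 1ℚ) * h - nat 4 * (x + 1ℚ + 1ℚ))
      + nat 2 * (x + 1ℚ + 1ℚ + 1ℚ) * 1ℚ
      -- The 1 turns into (m + 2) `u`, where `u` is the reciprocal of m + 2: the increment that
      -- completes the next harmonic number.
      ≡⟨ cong (λ o → (x + 1ℚ + 1ℚ) * (nat 2 * (x + 1ℚ + 1ℚ + 1ℚ) * h - nat 4 * (x + 1ℚ + 1ℚ))
           + nat 2 * (x + 1ℚ + 1ℚ + 1ℚ) * o)
           (sym (trans (cong (_* u) (sym (trans (nat-suc (suc m)) (cong (_+ 1ℚ) (nat-suc m))))) (nat-suc*unit (suc m)))) ⟩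
    (x + 1ℚ + 1ℚ) * (nat 2 * (x + 1ℚ + 1ℚ + 1ℚ) * h - nat 4 * (x + 1ℚ + 1ℚ))
      + nat 2 * (x + 1ℚ + 1ℚ + 1ℚ) * ((x + 1ℚ + 1ℚ) * u)
      ≡⟨ solve 3 (λ y h u → y :* (con (nat 2) :* (y :+ con 1ℚ) :* h :- con (nat 4) :* y)
             :+ con (nat 2) :* (y :+ con 1ℚ) :* (y :* u) :=
           y :* (con (nat 2) :* (y :+ con 1ℚ) :* (h :+ u) :- con (nat 4) :* y)) refl (x + 1ℚ + 1ℚ) h u ⟩
    (x + 1ℚ + 1ℚ) * (nat 2 * (x + 1ℚ + 1ℚ + 1ℚ) * (h + u) - nat 4 * (x + 1ℚ + 1ℚ))
      ≡⟨ cong (λ y → y * (nat 2 * (y + 1ℚ) * (h + u) - nat 4 * y))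
           (sym (trans (nat-suc (suc m)) (cong (_+ 1ℚ) (nat-suc m)))) ⟩
    nat (suc (suc m)) * μ (suc (suc m))
      ≡⟨ cong (_* μ (suc (suc m))) (nat-suc (suc m)) ⟩
    (nat (suc m) + 1ℚ) * μ (suc (suc m)) ∎
    where
    open ≡-Reasoning
    x = nat m
    h = harmonic (suc m)
    u = unit (suc m)

  -- A rearrangement of `∑-μ`, since i + j is the same for all pairs. This is the source of the
  -- exact vanishing of the first central moment.
  ∑-toll : ∀ n → ∑ (pairs n) toll ≡ 0ℚ
  ∑-toll zero    = refl
  ∑-toll (suc m) = begin
    ∑ (pairs (suc m)) toll
      ≡⟨ ∑-cong-All (All.map (λ { {i , j} e → trans
           (cong₂ (λ u v → nat u + μ i + μ j - μ v) (ℕ.suc-injective e) e)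
           (solve 4 (λ n a b c → n :+ a :+ b :- c := (n :- c) :* con 1ℚ :+ (a :+ b)) refl
              (nat m) (μ i) (μ j) (μ (suc m))) }) (pairs-sum (suc m))) ⟩
    ∑ (pairs (suc m)) (λ (i , j) → c * 1ℚ + (μ i + μ j))
      ≡⟨ trans (∑-+ (pairs (suc m)) (λ _ → c * 1ℚ) (λ (i , j) → μ i + μ j))
           (cong₂ _+_ (∑-*ˡ c (pairs (suc m)) (λ _ → 1ℚ)) (∑-+ (pairs (suc m)) (μ ∘ proj₁) (μ ∘ proj₂))) ⟩
    c * ∑ (pairs (suc m)) (λ _ → 1ℚ) + (∑ (pairs (suc m)) (μ ∘ proj₁) + ∑ (pairs (suc m)) (μ ∘ proj₂))
      ≡⟨ cong₂ _+_ (cong (c *_) (trans (length-pairs (suc m)) (nat-suc m)))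
           (cong₂ _+_ (∑-pairs-proj₁ (suc m) μ) (∑-pairs-proj₂ (suc m) μ)) ⟩
    c * (nat m + 1ℚ) + (s + s)
      ≡⟨ solve 3 (λ n d s → (n :- d) :* (n :+ con 1ℚ) :+ (s :+ s) :=
           ((n :+ con 1ℚ) :* n :+ con (nat 2) :* s) :- (n :+ con 1ℚ) :* d) refl (nat m) (μ (suc m)) s ⟩
    ((nat m + 1ℚ) * nat m + nat 2 * s) - (nat m + 1ℚ) * μ (suc m)
      ≡⟨ cong (_- (nat m + 1ℚ) * μ (suc m)) (∑-μ m) ⟩
    (nat m + 1ℚ) * μ (suc m) - (nat m + 1ℚ) * μ (suc m)
      ≡⟨ ℚ.+-inverseʳ ((nat m + 1ℚ) * μ (suc m)) ⟩
    0ℚ ∎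
    where
    open ≡-Reasoning
    c = nat m - μ (suc m)
    s = ∑< (suc m) μ

  -- Linearity and independence of expectations.

  E-const : ∀ n c → E n (λ _ → c) ≡ c
  E-const n c = begin
    E n (λ _ → c)         ≡⟨ E-cong n (λ _ → sym (ℚ.*-identityʳ c)) ⟩
    E n (λ _ → c * 1ℚ)    ≡⟨ trans (E-*ˡ n c (λ _ → 1ℚ)) (cong (c *_) (E-1 n)) ⟩
    c * 1ℚ                ≡⟨ ℚ.*-identityʳ c ⟩
    c                     ∎
    where open ≡-Reasoning

  E-∑ : ∀ n (L : List A) (f : ℕ → A → ℚ) → E n (λ k → ∑ L (f k)) ≡ ∑ L (λ t → E n (λ k → f k t))
  E-∑ n L f = average-∑ (map suc (upTo n)) L (λ ρ → f (comparisons ρ))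

  -- Linearity of the inner and then of the outer expectation, which factorises each product. The
  -- shape is that of `cross-terms-expand`: two pure powers and a list of mixed products.
  E-independent : ∀ i j (f g : ℕ → ℚ) (L : List A) (c : A → ℚ) (F G : A → ℕ → ℚ) →
    E i (λ a → E j (λ b → f a + g b + ∑ L (λ t → c t * (F t a * G t b)))) ≡
    E i f + E j g + ∑ L (λ t → c t * (E i (F t) * E j (G t)))
  E-independent i j f g L c F G = begin
    E i (λ a → E j (λ b → f a + g b + ∑ L (λ t → c t * (F t a * G t b))))
      ≡⟨ E-cong i inner ⟩
    E i (λ a → f a + E j g + ∑ L (λ t → (c t * E j (G t)) * F t a))
      ≡⟨ E-+ i (λ a → f a + E j g) (λ a → ∑ L (λ t → (c t * E j (G t)) * F t a)) ⟩
    E i (λ a → f a + E j g) + E i (λ a → ∑ L (λ t → (c t * E j (G t)) * F t a))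
      ≡⟨ cong₂ _+_ (trans (E-+ i f (λ _ → E j g)) (cong (E i f +_) (E-const i (E j g))))
           (trans (E-∑ i L (λ a t → (c t * E j (G t)) * F t a)) (∑-cong L (λ t →
             trans (E-*ˡ i (c t * E j (G t)) (F t))
               (solve 3 (λ x y z → (x :* y) :* z := x :* (z :* y)) refl (c t) (E j (G t)) (E i (F t)))))) ⟩
    E i f + E j g + ∑ L (λ t → c t * (E i (F t) * E j (G t))) ∎
    where
    open ≡-Reasoning
    inner : ∀ a → E j (λ b → f a + g b + ∑ L (λ t → c t * (F t a * G t b))) ≡
                  f a + E j g + ∑ L (λ t → (c t * E j (G t)) * F t a)
    inner a = begin
      E j (λ b → f a + g b + ∑ L (λ t → c t * (F t a * G t b)))
        ≡⟨ E-+ j (λ b → f a + g b) (λ b → ∑ L (λ t → c t * (F t a * G t b))) ⟩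
      E j (λ b → f a + g b) + E j (λ b → ∑ L (λ t → c t * (F t a * G t b)))
        ≡⟨ cong₂ _+_ (trans (E-+ j (λ _ → f a) g) (cong (_+ E j g) (E-const j (f a))))
             (trans (E-∑ j L (λ b t → c t * (F t a * G t b))) (∑-cong L (λ t →
               trans (E-cong j (λ b → sym (ℚ.*-assoc (c t) (F t a) (G t b))))
                 (trans (E-*ˡ j (c t * F t a) (G t))
                   (solve 3 (λ x y z → (x :* y) :* z := (x :* z) :* y) refl (c t) (F t a) (E j (G t))))))) ⟩
      f a + E j g + ∑ L (λ t → (c t * E j (G t)) * F t a) ∎

  -- Expanding the power of a sum of three terms.

  Monomial : Set
  Monomial = ℕ × ℕ × ℕ

  monomial : ℚ → ℚ → ℚ → Monomial → ℚ
  monomial c U V (e , u , v) = c ^ e * (U ^ u * V ^ v)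

  times-U times-V times-c : Monomial → Monomial
  times-U (e , u , v) = e , suc u , v
  times-V (e , u , v) = e , u , suc v
  times-c (e , u , v) = suc e , u , v

  -- All monomials of the power of order q + 1 except the pure powers of U and V, repeated instead
  -- of carrying multinomial coefficients. In the step, the four leading entries come from
  -- multiplying a pure power by one of the other two summands.
  cross-terms : ℕ → List Monomial
  cross-terms zero    = (1 , 0 , 0) ∷ []
  cross-terms (suc q) =
    (0 , 1 , suc q) ∷ (0 , suc q , 1) ∷ (1 , suc q , 0) ∷ (1 , 0 , suc q) ∷
    map times-U (cross-terms q) ++ map times-V (cross-terms q) ++ map times-c (cross-terms q)

  cross-terms-expand : ∀ c U V q →
    (U + V + c) ^ suc q ≡ U ^ suc q + V ^ suc q + ∑ (cross-terms q) (monomial c U V)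
  cross-terms-expand c U V zero    =
    solve 3 (λ c U V → (U :+ V :+ c) :* con 1ℚ :=
      U :* con 1ℚ :+ V :* con 1ℚ :+ (c :* con 1ℚ :* (con 1ℚ :* con 1ℚ) :+ con 0ℚ)) refl c U V
  cross-terms-expand c U V (suc q) = begin
    (U + V + c) * (U + V + c) ^ suc q
      ≡⟨ cong ((U + V + c) *_) (cross-terms-expand c U V q) ⟩
    (U + V + c) * (Uᵖ + Vᵖ + R)
      ≡⟨ solve 6 (λ c U V A B R → (U :+ V :+ c) :* (A :+ B :+ R) :=
           U :* A :+ V :* B :+
           (con 1ℚ :* (U :* con 1ℚ :* B) :+ (con 1ℚ :* (A :* (V :* con 1ℚ)) :+
           (c :* con 1ℚ :* (A :* con 1ℚ) :+ (c :* con 1ℚ :* (con 1ℚ :* B) :+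
           (U :* R :+ (V :* R :+ c :* R)))))))
           refl c U V Uᵖ Vᵖ R ⟩
    U * Uᵖ + V * Vᵖ + (m (0 , 1 , suc q) + (m (0 , suc q , 1) + (m (1 , suc q , 0) +
      (m (1 , 0 , suc q) + (U * R + (V * R + c * R))))))
      ≡⟨ cong (λ t → U * Uᵖ + V * Vᵖ + (m (0 , 1 , suc q) + (m (0 , suc q , 1) + (m (1 , suc q , 0) +
           (m (1 , 0 , suc q) + t))))) (sym rest) ⟩
    U ^ suc (suc q) + V ^ suc (suc q) + ∑ (cross-terms (suc q)) m ∎
    where
    open ≡-Reasoning
    m  = monomial c U V
    Uᵖ = U ^ suc q
    Vᵖ = V ^ suc q
    L  = cross-terms q
    R  = ∑ L m
    pull : ∀ x (times-x : Monomial → Monomial) → (∀ t → m (times-x t) ≡ x * m t) →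
      ∑ (map times-x L) m ≡ x * R
    pull x times-x e = trans (∑-map times-x L m) (trans (∑-cong L e) (∑-*ˡ x L m))
    rest : ∑ (map times-U L ++ map times-V L ++ map times-c L) m ≡ U * R + (V * R + c * R)
    rest = begin
      ∑ (map times-U L ++ map times-V L ++ map times-c L) m
        ≡⟨ trans (∑-++ (map times-U L) (map times-V L ++ map times-c L) m)
             (cong (∑ (map times-U L) m +_) (∑-++ (map times-V L) (map times-c L) m)) ⟩
      ∑ (map times-U L) m + (∑ (map times-V L) m + ∑ (map times-c L) m)
        ≡⟨ cong₂ _+_
             (pull U times-U (λ { (e , u , v) →
               solve 4 (λ x C D E → C :* (x :* D :* E) := x :* (C :* (D :* E))) refl
                 U (c ^ e) (U ^ u) (V ^ v) }))
             (cong₂ _+_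
               (pull V times-V (λ { (e , u , v) →
                 solve 4 (λ x C D E → C :* (D :* (x :* E)) := x :* (C :* (D :* E))) refl
                   V (c ^ e) (U ^ u) (V ^ v) }))
               (pull c times-c (λ { (e , u , v) →
                 solve 4 (λ x C D E → x :* C :* (D :* E) := x :* (C :* (D :* E))) refl
                   c (c ^ e) (U ^ u) (V ^ v) }))) ⟩
      U * R + (V * R + c * R) ∎

  -- Total degree p yields the size nᵖ; u , v < p ensures that only moments of lower order occur,
  -- for which bounds are available by induction.
  Proper : ℕ → Monomial → Set
  Proper p (e , u , v) = e ℕ.+ (u ℕ.+ v) ≡ p × u ℕ.< p × v ℕ.< p

  cross-terms-proper : ∀ q → All (Proper (suc q)) (cross-terms q)
  cross-terms-proper zero    = (refl , ℕ.s≤s ℕ.z≤n , ℕ.s≤s ℕ.z≤n) ∷ []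
  cross-terms-proper (suc q) =
    (refl , ℕ.s≤s (ℕ.s≤s ℕ.z≤n) , ℕ.≤-refl) ∷
    (ℕ.+-comm (suc q) 1 , ℕ.≤-refl , ℕ.s≤s (ℕ.s≤s ℕ.z≤n)) ∷
    (cong suc (ℕ.+-identityʳ (suc q)) , ℕ.≤-refl , ℕ.s≤s ℕ.z≤n) ∷
    (refl , ℕ.s≤s ℕ.z≤n , ℕ.≤-refl) ∷
    All.++⁺ (All.map⁺ (All.map (λ { {e , u , v} (d , u< , v<) →
               trans (ℕ.+-suc e (u ℕ.+ v)) (cong suc d) , ℕ.s≤s u< , ℕ.m<n⇒m<1+n v< }) (cross-terms-proper q)))
      (All.++⁺ (All.map⁺ (All.map (λ { {e , u , v} (d , u< , v<) →
                  trans (cong (e ℕ.+_) (ℕ.+-suc u v)) (trans (ℕ.+-suc e (u ℕ.+ v)) (cong suc d)) ,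
                  ℕ.m<n⇒m<1+n u< , ℕ.s≤s v< }) (cross-terms-proper q)))
               (All.map⁺ (All.map (λ { {e , u , v} (d , u< , v<) →
                  cong suc d , ℕ.m<n⇒m<1+n u< , ℕ.m<n⇒m<1+n v< }) (cross-terms-proper q))))

  -- Central moments: recurrence and growth.

  moment : ℕ → ℕ → ℚ
  moment p n = E n (λ k → (nat k - μ n) ^ p)

  remainder : ℕ → ℕ × ℕ → ℚ
  remainder q (i , j) =
    ∑ (cross-terms q) (λ (e , u , v) → toll (i , j) ^ e * (moment u i * moment v j))

  -- Given the sublist sizes, the centred count is the sum of the two centred counts of the sublists
  -- and the toll (`centre`). Expanding its power and using independence separates the pure moments
  -- from the remainder.
  moment-rec : ∀ q n → nat n * moment (suc q) n ≡
    ∑ (pairs n) (λ (i , j) → moment (suc q) i + moment (suc q) j + remainder q (i , j))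
  moment-rec q n = trans (E-rec n (λ k → (nat k - μ n) ^ suc q))
    (∑-cong-All (All.map (λ { {i , j} refl → step i j }) (pairs-sum n)))
    where
    open ≡-Reasoning
    step : ∀ i j → E-split (λ k → (nat k - μ (suc (i ℕ.+ j))) ^ suc q) (i , j) ≡
      moment (suc q) i + moment (suc q) j + remainder q (i , j)
    step i j = begin
      E i (λ a → E j (λ b → (nat (i ℕ.+ j ℕ.+ (a ℕ.+ b)) - μ (suc (i ℕ.+ j))) ^ suc q))
        ≡⟨ E-cong i (λ a → E-cong j (λ b → trans (cong (_^ suc q) (centre a b))
             (cross-terms-expand (toll (i , j)) (nat a - μ i) (nat b - μ j) q))) ⟩
      E i (λ a → E j (λ b → (nat a - μ i) ^ suc q + (nat b - μ j) ^ suc q +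
        ∑ (cross-terms q) (λ (e , u , v) → toll (i , j) ^ e * ((nat a - μ i) ^ u * (nat b - μ j) ^ v))))
        ≡⟨ E-independent i j (λ a → (nat a - μ i) ^ suc q) (λ b → (nat b - μ j) ^ suc q)
             (cross-terms q) (λ (e , u , v) → toll (i , j) ^ e)
             (λ (e , u , v) a → (nat a - μ i) ^ u) (λ (e , u , v) b → (nat b - μ j) ^ v) ⟩
      moment (suc q) i + moment (suc q) j + remainder q (i , j) ∎
      where
      centre : ∀ a b → nat (i ℕ.+ j ℕ.+ (a ℕ.+ b)) - μ (suc (i ℕ.+ j)) ≡
        (nat a - μ i) + (nat b - μ j) + toll (i , j)
      centre a b = trans
        (cong (_- μ (suc (i ℕ.+ j))) (trans (nat-+ (i ℕ.+ j) (a ℕ.+ b)) (cong (nat (i ℕ.+ j) +_) (nat-+ a b))))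
        (solve 6 (λ m a b x y z → m :+ (a :+ b) :- z := (a :- x) :+ (b :- y) :+ (m :+ x :+ y :- z)) refl
           (nat (i ℕ.+ j)) (nat a) (nat b) (μ i) (μ j) (μ (suc (i ℕ.+ j))))

  moment-0 : ∀ n → moment 0 n ≡ 1ℚ
  moment-0 = E-1

  moment-suc-of-0 : ∀ q → moment (suc q) 0 ≡ 0ℚ
  moment-suc-of-0 q = trans (E-0 (λ k → (nat k - μ 0) ^ suc q)) (ℚ.*-zeroˡ (0ℚ ^ q))

  -- By strong induction, with `N` as the bound, both recursive first moments are 0, so only the sum
  -- of the tolls remains, and that is 0 as well.
  moment-1 : ∀ N n → n ℕ.≤ N → moment 1 n ≡ 0ℚ
  moment-1 N       zero    _          = moment-suc-of-0 0
  moment-1 (suc N) (suc m) (ℕ.s≤s m≤N) = nat-suc-cancel m (begin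
    nat (suc m) * moment 1 (suc m)
      ≡⟨ moment-rec 0 (suc m) ⟩
    ∑ (pairs (suc m)) (λ (i , j) → moment 1 i + moment 1 j + remainder 0 (i , j))
      ≡⟨ ∑-cong-All (All.map (λ { {i , j} e → step i j e }) (pairs-sum (suc m))) ⟩
    ∑ (pairs (suc m)) toll
      ≡⟨ ∑-toll (suc m) ⟩
    0ℚ
      ≡⟨ sym (ℚ.*-zeroʳ (nat (suc m))) ⟩
    nat (suc m) * 0ℚ ∎)
    where
    open ≡-Reasoning
    step : ∀ i j → suc (i ℕ.+ j) ≡ suc m → moment 1 i + moment 1 j + remainder 0 (i , j) ≡ toll (i , j)
    step i j refl = begin
      moment 1 i + moment 1 j + (toll (i , j) * 1ℚ * (moment 0 i * moment 0 j) + 0ℚ)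
        ≡⟨ cong₂ (λ x y → x + y + (toll (i , j) * 1ℚ * (moment 0 i * moment 0 j) + 0ℚ))
             (moment-1 N i (ℕ.≤-trans (ℕ.m≤m+n i j) m≤N)) (moment-1 N j (ℕ.≤-trans (ℕ.m≤n+m j i) m≤N)) ⟩
      0ℚ + 0ℚ + (toll (i , j) * 1ℚ * (moment 0 i * moment 0 j) + 0ℚ)
        ≡⟨ cong₂ (λ x y → 0ℚ + 0ℚ + (toll (i , j) * 1ℚ * (x * y) + 0ℚ)) (moment-0 i) (moment-0 j) ⟩
      0ℚ + 0ℚ + (toll (i , j) * 1ℚ * (1ℚ * 1ℚ) + 0ℚ)
        ≡⟨ solve 1 (λ t → con 0ℚ :+ con 0ℚ :+ (t :* con 1ℚ :* (con 1ℚ :* con 1ℚ) :+ con 0ℚ) := t) refl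
             (toll (i , j)) ⟩
      toll (i , j) ∎

  -- The two leading terms of the binomial expansion, with the coefficient 3 + q lowered to 3. With
  -- this fixed coefficient, one multiplication by x + 1 carries the bound to the next exponent.
  power-step : ∀ {x} → 0ℚ ≤ x → ∀ q →
    x ^ (3 ℕ.+ q) + nat 3 * x ^ (2 ℕ.+ q) ≤ (x + 1ℚ) ^ (3 ℕ.+ q)
  power-step {x} 0≤x zero    = begin
    x ^ 3 + nat 3 * x ^ 2
      ≡⟨ sym (ℚ.+-identityʳ _) ⟩
    x ^ 3 + nat 3 * x ^ 2 + 0ℚ
      ≤⟨ ℚ.+-monoʳ-≤ (x ^ 3 + nat 3 * x ^ 2)
           (+-nonneg (*-nonneg {nat 3} (nat-nonneg 3) 0≤x) (ℚ.nonNegative⁻¹ 1ℚ)) ⟩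
    x ^ 3 + nat 3 * x ^ 2 + (nat 3 * x + 1ℚ)
      ≡⟨ solve 1 (λ x →
           x :* (x :* (x :* con 1ℚ)) :+ con (nat 3) :* (x :* (x :* con 1ℚ)) :+ (con (nat 3) :* x :+ con 1ℚ) :=
           (x :+ con 1ℚ) :* ((x :+ con 1ℚ) :* ((x :+ con 1ℚ) :* con 1ℚ))) refl x ⟩
    (x + 1ℚ) ^ 3 ∎
    where open ℚ.≤-Reasoning
  power-step {x} 0≤x (suc q) = begin
    x * y + nat 3 * y
      ≡⟨ sym (ℚ.+-identityʳ _) ⟩
    x * y + nat 3 * y + 0ℚ
      ≤⟨ ℚ.+-monoʳ-≤ (x * y + nat 3 * y) (+-nonneg 0≤y (*-nonneg {nat 3} (nat-nonneg 3) 0≤z)) ⟩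
    x * y + nat 3 * y + (y + nat 3 * z)
      ≡⟨ solve 3 (λ x y z → x :* y :+ con (nat 3) :* (x :* z) :+ (y :+ con (nat 3) :* z) :=
           (x :+ con 1ℚ) :* (y :+ con (nat 3) :* z)) refl x y z ⟩
    (x + 1ℚ) * (y + nat 3 * z)
      ≤⟨ *-monoˡ (+-nonneg 0≤x (ℚ.nonNegative⁻¹ 1ℚ)) (power-step 0≤x q) ⟩
    (x + 1ℚ) * (x + 1ℚ) ^ (3 ℕ.+ q) ∎
    where
    open ℚ.≤-Reasoning
    z = x ^ (2 ℕ.+ q)
    y = x ^ (3 ℕ.+ q)
    0≤y = ^-nonneg 0≤x (3 ℕ.+ q)
    0≤z = ^-nonneg 0≤x (2 ℕ.+ q)

  -- `power-step` telescopes. The 3 is the value of p + 1 at p = 2, the least favourable order.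
  ∑<-power : ∀ q n → nat 3 * ∑< n (λ k → nat k ^ (2 ℕ.+ q)) ≤ nat n * nat n ^ (2 ℕ.+ q)
  ∑<-power q zero    = ℚ.≤-reflexive (sym (ℚ.*-zeroˡ (nat 0 ^ (2 ℕ.+ q))))
  ∑<-power q (suc n) = begin
    nat 3 * (∑< n f + f n)
      ≡⟨ ℚ.*-distribˡ-+ (nat 3) (∑< n f) (f n) ⟩
    nat 3 * ∑< n f + nat 3 * f n
      ≤⟨ ℚ.+-monoˡ-≤ (nat 3 * f n) (∑<-power q n) ⟩
    nat n * f n + nat 3 * f n
      ≤⟨ power-step (nat-nonneg n) q ⟩
    (nat n + 1ℚ) ^ (3 ℕ.+ q)
      ≡⟨ cong (_^ (3 ℕ.+ q)) (sym (nat-suc n)) ⟩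
    nat (suc n) * nat (suc n) ^ (2 ℕ.+ q) ∎
    where
    open ℚ.≤-Reasoning
    f : ℕ → ℚ
    f k = nat k ^ (2 ℕ.+ q)

  ∣∑∣-≤ : ∀ {xs : List A} {f g : A → ℚ} → All (λ x → ∣ f x ∣ ≤ g x) xs → ∣ ∑ xs f ∣ ≤ ∑ xs g
  ∣∑∣-≤ []                           = ℚ.≤-refl
  ∣∑∣-≤ {xs = x ∷ xs} {f} {g} (p ∷ ps) =
    ℚ.≤-trans (ℚ.∣p+q∣≤∣p∣+∣q∣ (f x) (∑ xs f)) (ℚ.+-mono-≤ p (∣∑∣-≤ ps))

  ∣nat∣ : ∀ n → ∣ nat n ∣ ≡ nat n
  ∣nat∣ n = ℚ.0≤p⇒∣p∣≡p (nat-nonneg n)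

  module ℕ² = BigO (ℕ × ℕ)
  open BigO ℕ using (_≲_; big-O; ≲-reflexive; ≲-respˡ; ≲-0)
  open ℕ² using () renaming (_≲_ to _≲²_)

  ∣size∣ : ∀ i j k → k ℕ.≤ suc (i ℕ.+ j) → ∣ nat k ∣ ≤ ∣ size (i , j) ∣
  ∣size∣ i j k h = subst₂ _≤_ (sym (∣nat∣ k)) (sym (∣nat∣ (suc (i ℕ.+ j)))) (nat-mono h)

  module _ (u : ℕ) {f : ℕ → ℚ} where
    ≲²-proj₁ : f ≲ (λ n → nat n ^ u) → (λ (i , j) → f i) ≲² (λ t → size t ^ u)
    ≲²-proj₁ p = ℕ².≲-trans (≲-reindex proj₁ p)
      (ℕ².≲-^ (ℕ².≤⇒≲ (λ (i , j) → ∣size∣ i j i (ℕ.m≤n⇒m≤1+n (ℕ.m≤m+n i j)))) u)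

    ≲²-proj₂ : f ≲ (λ n → nat n ^ u) → (λ (i , j) → f j) ≲² (λ t → size t ^ u)
    ≲²-proj₂ p = ℕ².≲-trans (≲-reindex proj₂ p)
      (ℕ².≲-^ (ℕ².≤⇒≲ (λ (i , j) → ∣size∣ i j j (ℕ.m≤n⇒m≤1+n (ℕ.m≤n+m j i)))) u)

  -- The toll is O(size) and the sublists are no larger than `size`, so each monomial is bounded by
  -- a power of `size` whose exponents add up to p by properness.
  remainder-bound : ∀ p (L : List Monomial) → All (Proper p) L →
    (∀ u → u ℕ.< p → moment u ≲ (λ n → nat n ^ u)) →
    (λ t → ∑ L (λ (e , u , v) → toll t ^ e * (moment u (proj₁ t) * moment v (proj₂ t)))) ≲²
    (λ t → size t ^ p)
  remainder-bound p []                []                    IH = ℕ².≲-0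
  remainder-bound p ((e , u , v) ∷ L) ((refl , u< , v<) ∷ h) IH = ℕ².≲-+
    (ℕ².≲-respʳ (λ t → sym (trans (^-homo-* (size t) e (u ℕ.+ v))
                             (cong (size t ^ e *_) (^-homo-* (size t) u v))))
      (ℕ².≲-* (ℕ².≲-^ toll≲size e) (ℕ².≲-* (≲²-proj₁ u (IH u u<)) (≲²-proj₂ v (IH v v<)))))
    (remainder-bound p L h IH)
    where
    toll≲size : toll ≲² size
    toll≲size = ℕ².big-O (nat 4) (nat-nonneg 4) toll-bound

  module _ (q : ℕ) (D : ℚ) (0≤D : 0ℚ ≤ D)
    (remainder≤ : ∀ t → ∣ remainder (suc q) t ∣ ≤ D * ∣ size t ^ (2 ℕ.+ q) ∣) where

    private
      p = 2 ℕ.+ q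
      K = nat 3 * D
      0≤K : 0ℚ ≤ K
      0≤K = *-nonneg {nat 3} (nat-nonneg 3) 0≤D
      f : ℕ → ℚ
      f k = nat k ^ p

    -- The two recursive calls contribute at most a fraction 2/(p+1) ≤ 2/3 of the
    -- bound K nᵖ, which leaves room for a remainder of K nᵖ / 3.
    moment≤ : ∀ N n → n ℕ.≤ N → ∣ moment p n ∣ ≤ K * f n
    moment≤ N       zero    _ = subst (_≤ K * f 0) (sym (cong ∣_∣ (moment-suc-of-0 (suc q))))
      (*-nonneg 0≤K (^-nonneg ℚ.≤-refl p))
    moment≤ (suc N) (suc m) (ℕ.s≤s m≤N) =
      *-cancelˡ (nat (suc m)) 0<n (*-cancelˡ (nat 3) (ℚ.positive⁻¹ (nat 3)) (begin
      nat 3 * (nat (suc m) * ∣ moment p (suc m) ∣)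
        ≡⟨ cong (nat 3 *_) (trans (cong (_* ∣ moment p (suc m) ∣) (sym (∣nat∣ (suc m))))
             (trans (sym (ℚ.∣p*q∣≡∣p∣*∣q∣ (nat (suc m)) (moment p (suc m))))
               (cong ∣_∣ (moment-rec (suc q) (suc m))))) ⟩
      nat 3 * ∣ ∑ (pairs (suc m)) (λ (i , j) → moment p i + moment p j + remainder (suc q) (i , j)) ∣
        ≤⟨ *-monoˡ {r = nat 3} (nat-nonneg 3) (∣∑∣-≤ (All.map (λ { {i , j} e → step i j e }) (pairs-sum (suc m)))) ⟩
      nat 3 * ∑ (pairs (suc m)) (λ (i , j) → K * f i + K * f j + D * F * 1ℚ)
        ≡⟨ cong (nat 3 *_) total ⟩
      nat 3 * (K * s + K * s + D * F * nat (suc m))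
        ≡⟨ solve 4 (λ K s d n → con (nat 3) :* (K :* s :+ K :* s :+ d :* n) :=
             K :* (con (nat 3) :* s) :+ K :* (con (nat 3) :* s) :+ con (nat 3) :* d :* n) refl K s (D * F) (nat (suc m)) ⟩
      K * (nat 3 * s) + K * (nat 3 * s) + nat 3 * (D * F) * nat (suc m)
        ≤⟨ ℚ.+-monoˡ-≤ (nat 3 * (D * F) * nat (suc m)) (ℚ.+-mono-≤
             (*-monoˡ 0≤K (∑<-power q (suc m))) (*-monoˡ 0≤K (∑<-power q (suc m)))) ⟩
      K * (nat (suc m) * F) + K * (nat (suc m) * F) + nat 3 * (D * F) * nat (suc m)
        ≡⟨ solve 3 (λ D n F → con (nat 3) :* D :* (n :* F) :+ con (nat 3) :* D :* (n :* F) :+ con (nat 3) :* (D :* F) :* n :=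
             con (nat 3) :* (n :* (con (nat 3) :* D :* F))) refl D (nat (suc m)) F ⟩
      nat 3 * (nat (suc m) * (K * F)) ∎))
      where
      open ℚ.≤-Reasoning
      F = f (suc m)
      s = ∑< (suc m) f
      0<n : 0ℚ < nat (suc m)
      0<n = ℚ.positive⁻¹ (nat (suc m)) {{ℚ.normalize-pos (suc m) 1}}
      step : ∀ i j → suc (i ℕ.+ j) ≡ suc m →
        ∣ moment p i + moment p j + remainder (suc q) (i , j) ∣ ≤ K * f i + K * f j + D * F * 1ℚ
      step i j refl = begin
        ∣ moment p i + moment p j + remainder (suc q) (i , j) ∣
          ≤⟨ ℚ.∣p+q∣≤∣p∣+∣q∣ (moment p i + moment p j) (remainder (suc q) (i , j)) ⟩
        ∣ moment p i + moment p j ∣ + ∣ remainder (suc q) (i , j) ∣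
          ≤⟨ ℚ.+-mono-≤ (ℚ.≤-trans (ℚ.∣p+q∣≤∣p∣+∣q∣ (moment p i) (moment p j))
               (ℚ.+-mono-≤ (moment≤ N i (ℕ.≤-trans (ℕ.m≤m+n i j) m≤N))
                           (moment≤ N j (ℕ.≤-trans (ℕ.m≤n+m j i) m≤N))))
               (remainder≤ (i , j)) ⟩
        K * f i + K * f j + D * ∣ size (i , j) ^ p ∣
          ≡⟨ cong (K * f i + K * f j +_) (trans (cong (D *_)
               (ℚ.0≤p⇒∣p∣≡p (^-nonneg (nat-nonneg (suc (i ℕ.+ j))) p))) (sym (ℚ.*-identityʳ (D * F)))) ⟩
        K * f i + K * f j + D * F * 1ℚ ∎
      total : ∑ (pairs (suc m)) (λ (i , j) → K * f i + K * f j + D * F * 1ℚ) ≡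
              K * s + K * s + D * F * nat (suc m)
      total = trans (∑-+ (pairs (suc m)) (λ (i , j) → K * f i + K * f j) (λ _ → D * F * 1ℚ))
        (cong₂ _+_
          (trans (∑-+ (pairs (suc m)) (λ (i , j) → K * f i) (λ (i , j) → K * f j)) (cong₂ _+_
            (trans (∑-*ˡ K (pairs (suc m)) (f ∘ proj₁)) (cong (K *_) (∑-pairs-proj₁ (suc m) f)))
            (trans (∑-*ˡ K (pairs (suc m)) (f ∘ proj₂)) (cong (K *_) (∑-pairs-proj₂ (suc m) f)))))
          (trans (∑-*ˡ (D * F) (pairs (suc m)) (λ _ → 1ℚ)) (cong (D * F *_) (length-pairs (suc m)))))

  -- Strong induction on the order, with `N` as the bound, because the remainder of order p involves
  -- all lower orders. Orders 0 and 1 come from exact values; the contraction sets in at order 2.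
  moment≲′ : ∀ N p → p ℕ.≤ N → moment p ≲ (λ n → nat n ^ p)
  moment≲′ N       zero          _           = ≲-reflexive moment-0
  moment≲′ N       (suc zero)    _           = ≲-respˡ (λ n → moment-1 n n ℕ.≤-refl) ≲-0
  moment≲′ (suc N) (suc (suc q)) (ℕ.s≤s q<N) =
    let ℕ².big-O D 0≤D r = remainder-bound (2 ℕ.+ q) (cross-terms (suc q)) (cross-terms-proper (suc q))
          (λ u u< → moment≲′ N u (ℕ.≤-trans (ℕ.s≤s⁻¹ u<) q<N))
    in big-O (nat 3 * D) (*-nonneg {nat 3} (nat-nonneg 3) 0≤D) λ n →
         subst (λ t → ∣ moment (2 ℕ.+ q) n ∣ ≤ nat 3 * D * t)
           (sym (ℚ.0≤p⇒∣p∣≡p (^-nonneg (nat-nonneg n) (2 ℕ.+ q)))) (moment≤ q D 0≤D r n n ℕ.≤-refl)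

  moment≲ : ∀ p → moment p ≲ (λ n → nat n ^ p)
  moment≲ p = moment≲′ p p ℕ.≤-refl

module Asymptotics where

  open import Data.Rational.Base using (_+_; _*_; _-_; -_; ∣_∣; _≤_; _<_)
  open Algebra.Properties.CommutativeSemiring.Exp commutativeSemiring using (_^_)
  open import Defs using (recip; unit; harmonic; module Harmonic; module Rational)
  open Harmonic using (nat; nat-suc; harmonic-mono)
  open Rational using (*-mono-≤; a≤∣a∣; ∣∣-≤; unit-pos; unit-antimono)
  open Expectation
  open Moments

  -- Falling factorials and mixed moments.

  nat-∸ : ∀ {m n} → n ℕ.≤ m → nat (m ℕ.∸ n) ≡ nat m - nat n
  nat-∸ {m} {n} n≤m = begin
    nat (m ℕ.∸ n)                       ≡⟨ solve 2 (λ x y → x := x :+ y :- y) refl (nat (m ℕ.∸ n)) (nat n) ⟩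
    nat (m ℕ.∸ n) + nat n - nat n       ≡⟨ cong (_- nat n) (sym (nat-+ (m ℕ.∸ n) n)) ⟩
    nat (m ℕ.∸ n ℕ.+ n) - nat n         ≡⟨ cong (λ k → nat k - nat n) (ℕ.m∸n+n≡m n≤m) ⟩
    nat m - nat n                       ∎
    where open ≡-Reasoning

  P≡P′ : ∀ {k s} → s ℕ.≤ k → k P s ≡ k P′ s
  P≡P′ {k} {s} s≤k rewrite Equivalence.to T-≡ (ℕ.≤⇒≤ᵇ s≤k) = refl

  -- True without truncated subtraction: at k = s the factor vanishes, and for k < s both falling
  -- factorials do.
  falling-suc : ∀ k s → nat (k P suc s) ≡ (nat k - nat s) * nat (k P s)
  falling-suc k s with ℕ.<-cmp s k
  ... | tri< s<k _ _ = begin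
    nat (k P suc s)                     ≡⟨ cong nat (P≡P′ s<k) ⟩
    nat ((k ℕ.∸ s) ℕ.* (k P′ s))        ≡⟨ nat-* (k ℕ.∸ s) (k P′ s) ⟩
    nat (k ℕ.∸ s) * nat (k P′ s)        ≡⟨ cong₂ _*_ (nat-∸ (ℕ.<⇒≤ s<k)) (cong nat (sym (P≡P′ (ℕ.<⇒≤ s<k)))) ⟩
    (nat k - nat s) * nat (k P s)       ∎
    where open ≡-Reasoning
  ... | tri≈ _ refl _ = begin
    nat (k P suc k)                     ≡⟨ cong nat (k>n⇒nPk≡0 (ℕ.n<1+n k)) ⟩
    0ℚ                                  ≡⟨ sym (ℚ.*-zeroˡ (nat (k P k))) ⟩
    0ℚ * nat (k P k)                    ≡⟨ cong (_* nat (k P k)) (sym (ℚ.+-inverseʳ (nat k))) ⟩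
    (nat k - nat k) * nat (k P k)       ∎
    where open ≡-Reasoning
  ... | tri> _ _ k<s = begin
    nat (k P suc s)                     ≡⟨ cong nat (k>n⇒nPk≡0 (ℕ.m<n⇒m<1+n k<s)) ⟩
    0ℚ                                  ≡⟨ sym (ℚ.*-zeroʳ (nat k - nat s)) ⟩
    (nat k - nat s) * 0ℚ                ≡⟨ cong (λ t → (nat k - nat s) * nat t) (sym (k>n⇒nPk≡0 k<s)) ⟩
    (nat k - nat s) * nat (k P s)       ∎
    where open ≡-Reasoning

  -- Joins the factorial moments (j = 0) to the central moments (s = 0).
  mixed-moment : ℕ → ℕ → ℕ → ℚ
  mixed-moment s j n = E n (λ k → nat (k P s) * (nat k - μ n) ^ j)

  mixed-moment-0 : ∀ j n → mixed-moment 0 j n ≡ moment j n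
  mixed-moment-0 j n = E-cong n (λ k → ℚ.*-identityˡ ((nat k - μ n) ^ j))

  -- Write the last factor k - s as (μ - s) + (k - μ): either it becomes a constant, or it raises
  -- the central power by one.
  mixed-moment-suc : ∀ s j n → mixed-moment (suc s) j n ≡
    (μ n - nat s) * mixed-moment s j n + mixed-moment s (suc j) n
  mixed-moment-suc s j n = begin
    E n (λ k → nat (k P suc s) * (nat k - μ n) ^ j)
      ≡⟨ E-cong n (λ k → trans (cong (_* (nat k - μ n) ^ j) (falling-suc k s))
           (solve 5 (λ k s m f y → (k :- s) :* f :* y := (m :- s) :* (f :* y) :+ f :* ((k :- m) :* y)) refl
              (nat k) (nat s) (μ n) (nat (k P s)) ((nat k - μ n) ^ j))) ⟩
    E n (λ k → (μ n - nat s) * (nat (k P s) * (nat k - μ n) ^ j) + nat (k P s) * (nat k - μ n) ^ suc j)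
      ≡⟨ trans (E-+ n (λ k → (μ n - nat s) * (nat (k P s) * (nat k - μ n) ^ j))
                      (λ k → nat (k P s) * (nat k - μ n) ^ suc j))
           (cong (_+ mixed-moment s (suc j) n)
             (E-*ˡ n (μ n - nat s) (λ k → nat (k P s) * (nat k - μ n) ^ j))) ⟩
    (μ n - nat s) * mixed-moment s j n + mixed-moment s (suc j) n ∎
    where open ≡-Reasoning

  -- Elementary bounds for harmonic numbers.

  unit≤1 : ∀ n → unit n ≤ 1ℚ
  unit≤1 n = unit-antimono {0} {n} ℕ.z≤n

  harmonic-nonneg : ∀ n → 0ℚ ≤ harmonic n
  harmonic-nonneg n = harmonic-mono {0} {n} ℕ.z≤n

  harmonic≤nat : ∀ n → harmonic n ≤ nat n
  harmonic≤nat zero    = ℚ.≤-refl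
  harmonic≤nat (suc n) = subst (harmonic n + unit n ≤_) (sym (nat-suc n))
    (ℚ.+-mono-≤ (harmonic≤nat n) (unit≤1 n))

  -- The rational form of log² n = O(n). Each step adds 2 h u + u², and h ≤ n gives h u ≤ 1, so it
  -- adds at most 2 + 1.
  harmonic²≤3n : ∀ n → harmonic n * harmonic n ≤ nat 3 * nat n
  harmonic²≤3n zero    = ℚ.≤-refl
  harmonic²≤3n (suc n) = begin
    (h + u) * (h + u)
      ≡⟨ solve 2 (λ h u → (h :+ u) :* (h :+ u) := h :* h :+ (con (nat 2) :* (h :* u) :+ u :* u)) refl h u ⟩
    h * h + (nat 2 * (h * u) + u * u)
      ≤⟨ ℚ.+-mono-≤ (harmonic²≤3n n) (ℚ.+-mono-≤ (*-monoˡ {r = nat 2} (nat-nonneg 2) h*u≤1)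
           (*-mono-≤ (ℚ.nonNegative⁻¹ 1ℚ) (ℚ.<⇒≤ (unit-pos n)) (unit≤1 n) (unit≤1 n))) ⟩
    nat 3 * nat n + (nat 2 * 1ℚ + 1ℚ * 1ℚ)
      ≡⟨ solve 1 (λ x → con (nat 3) :* x :+ (con (nat 2) :* con 1ℚ :+ con 1ℚ :* con 1ℚ) :=
           con (nat 3) :* (x :+ con 1ℚ)) refl (nat n) ⟩
    nat 3 * (nat n + 1ℚ)
      ≡⟨ cong (nat 3 *_) (sym (nat-suc n)) ⟩
    nat 3 * nat (suc n) ∎
    where
    open ℚ.≤-Reasoning
    h = harmonic n
    u = unit n
    h*u≤1 : h * u ≤ 1ℚ
    h*u≤1 = subst (h * u ≤_) (nat-suc*unit n) (*-mono-≤ (nat-nonneg (suc n)) (ℚ.<⇒≤ (unit-pos n))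
      (ℚ.≤-trans (harmonic≤nat n) (nat-mono (ℕ.n≤1+n n))) ℚ.≤-refl)

  -- Main term and error, uniformly over rational approximations.

  -- ℓ and g are rational approximations of log n and γ.
  record Point : Set where
    field
      n           : ℕ
      ℓ g         : ℚ
      1≤ℓ         : 1ℚ ≤ ℓ
      ℓ≤harmonic  : ℓ ≤ harmonic n
      harmonic≤   : harmonic n ≤ ℓ + 1ℚ
      euler       : ∣ nat n * (harmonic n - (ℓ + g)) ∣ ≤ nat 3

  open Point
  open BigO Point

  private
    -- `Z` stands for n log n, `r` for 1 / log n, `d` for γ - 2, and `e` for what the mean differs
    -- from 2 n (log n + γ - 2).
    N H r Z d e : Point → ℚ
    N p = nat (n p)
    H p = harmonic (n p)
    r p = recip (ℓ p)
    Z p = N p * ℓ p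
    d p = g p - nat 2
    e p = μ (n p) - nat 2 * (N p * (ℓ p + d p))

    0<ℓ : ∀ p → 0ℚ < ℓ p
    0<ℓ p = ℚ.<-≤-trans (ℚ.positive⁻¹ 1ℚ) (1≤ℓ p)

    ℓ*r : ∀ p → ℓ p * r p ≡ 1ℚ
    ℓ*r p = trans (ℚ.*-comm (ℓ p) (r p)) (Rational.recip-inverse (0<ℓ p))

    1≤N : ∀ p → 1ℚ ≤ N p
    1≤N p = ℚ.≤-trans (1≤ℓ p) (ℚ.≤-trans (ℓ≤harmonic p) (harmonic≤nat (n p)))

    Z*r : ∀ p → Z p * r p ≡ N p
    Z*r p = trans (ℚ.*-assoc (N p) (ℓ p) (r p)) (trans (cong (N p *_) (ℓ*r p)) (ℚ.*-identityʳ (N p)))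

    ≲1-* : ∀ {f h : Point → ℚ} → f ≲ (λ _ → 1ℚ) → h ≲ (λ _ → 1ℚ) → (λ p → f p * h p) ≲ (λ _ → 1ℚ)
    ≲1-* p q = ≲-respʳ (λ _ → ℚ.*-identityˡ 1ℚ) (≲-* p q)

    1≲ℓ : (λ _ → 1ℚ) ≲ ℓ
    1≲ℓ = ≤⇒≲ λ p → ℚ.≤-trans (1≤ℓ p) (a≤∣a∣ (ℓ p))

    1≲N : (λ _ → 1ℚ) ≲ N
    1≲N = ≤⇒≲ λ p → ℚ.≤-trans (1≤N p) (a≤∣a∣ (N p))

    r≲1 : r ≲ (λ _ → 1ℚ)
    r≲1 = ≤⇒≲ λ p → subst (_≤ 1ℚ) (sym (ℚ.0≤p⇒∣p∣≡p (ℚ.<⇒≤ (Rational.recip-pos (0<ℓ p)))))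
      (Rational.recip-antimono (ℚ.positive⁻¹ 1ℚ) (1≤ℓ p))

    N≲Z : N ≲ Z
    N≲Z = ≲-respˡ (λ p → sym (ℚ.*-identityʳ (N p))) (≲-* (≲-refl {f = N}) 1≲ℓ)

    ℓ≲Z : ℓ ≲ Z
    ℓ≲Z = ≲-respˡ (λ p → sym (ℚ.*-identityˡ (ℓ p))) (≲-* 1≲N ≲-refl)

    H-ℓ≲1 : (λ p → H p - ℓ p) ≲ (λ _ → 1ℚ)
    H-ℓ≲1 = ≤⇒≲ λ p → ∣∣-≤ (Rational.p≤q+r⇒p-q≤r (harmonic≤ p))
      (ℚ.≤-trans (ℚ.neg-antimono-≤ (Rational.0≤q-p (ℓ≤harmonic p))) (ℚ.nonNegative⁻¹ 1ℚ))

    H≲ℓ : H ≲ ℓ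
    H≲ℓ = ≲-respˡ (λ p → solve 2 (λ h l → h := (h :- l) :+ l) refl (H p) (ℓ p))
      (≲-+ (≲-trans H-ℓ≲1 1≲ℓ) ≲-refl)

    N*gap≲1 : (λ p → N p * (H p - (ℓ p + g p))) ≲ (λ _ → 1ℚ)
    N*gap≲1 = big-O (nat 3) (nat-nonneg 3) euler

    -- No field bounds `g` directly: it is the difference of H - ℓ, which lies between 0 and 1, and
    -- of H - (ℓ + g), which `euler` controls.
    d≲1 : d ≲ (λ _ → 1ℚ)
    d≲1 = ≲-respˡ (λ p → solve 3 (λ h l g → g :- con (nat 2) :=
                            (h :- l) :+ (:- (h :- (l :+ g)) :+ :- con (nat 2))) refl (H p) (ℓ p) (g p))
      (≲-+ H-ℓ≲1 (≲-+ (≲-neg (≲-trans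
        (≲-respˡ (λ p → sym (ℚ.*-identityˡ (H p - (ℓ p + g p)))) (≲-* 1≲N ≲-refl)) N*gap≲1))
        (≲-const (- nat 2))))

    -- `e` equals 2 n (H - (ℓ + g)) + 2 H: the first summand is bounded, and the + 1 in 2 (n + 1) H
    -- costs only a logarithm.
    e≲ℓ : e ≲ ℓ
    e≲ℓ = ≲-respˡ (λ p → solve 4 (λ n h l g →
        con (nat 2) :* (n :+ con 1ℚ) :* h :- con (nat 4) :* n :- con (nat 2) :* (n :* (l :+ (g :- con (nat 2)))) :=
        con (nat 2) :* (n :* (h :- (l :+ g))) :+ con (nat 2) :* h) refl (N p) (H p) (ℓ p) (g p))
      (≲-+ (≲-*ˡ (nat 2) (≲-trans N*gap≲1 1≲ℓ)) (≲-*ˡ (nat 2) H≲ℓ))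

    μ≲Z : (λ p → μ (n p)) ≲ Z
    μ≲Z = ≲-respˡ (λ p → solve 4 (λ m n l d →
        m := con (nat 2) :* (n :* l :+ n :* d) :+ (m :- con (nat 2) :* (n :* (l :+ d)))) refl
        (μ (n p)) (N p) (ℓ p) (d p))
      (≲-+ (≲-*ˡ (nat 2) (≲-+ ≲-refl (≲-trans (≲-respʳ (λ p → ℚ.*-identityʳ (N p)) (≲-* (≲-refl {f = N}) d≲1)) N≲Z)))
           (≲-trans e≲ℓ ℓ≲Z))

    ℓ²≲N : (λ p → ℓ p * ℓ p) ≲ N
    ℓ²≲N = big-O (nat 3) (nat-nonneg 3) λ p →
      let 0≤ℓ = ℚ.<⇒≤ (0<ℓ p) in
      subst₂ (λ x y → x ≤ nat 3 * y) (sym (ℚ.0≤p⇒∣p∣≡p (*-nonneg 0≤ℓ 0≤ℓ)))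
        (sym (ℚ.0≤p⇒∣p∣≡p (nat-nonneg (n p))))
        (ℚ.≤-trans (*-mono-≤ (harmonic-nonneg (n p)) 0≤ℓ (ℓ≤harmonic p) (ℓ≤harmonic p)) (harmonic²≤3n (n p)))

    -- Z r² is n / ℓ, so this is ℓ² = O(n), in the form in which `error≲` absorbs `e`.
    ℓ≲Zr² : ℓ ≲ (λ p → Z p * (r p * r p))
    ℓ≲Zr² = ≲-respˡ
      (λ p → trans (sym (ℚ.*-identityʳ (ℓ p))) (trans (cong (ℓ p *_) (sym (ℓ*r p)))
        (sym (ℚ.*-assoc (ℓ p) (ℓ p) (r p)))))
      (≲-respʳ (λ p → trans (cong (_* r p) (sym (Z*r p))) (ℚ.*-assoc (Z p) (r p) (r p)))
        (≲-* ℓ²≲N ≲-refl))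

    μ-s≲Z : ∀ s → (λ p → μ (n p) - nat s) ≲ Z
    μ-s≲Z s = ≲-+ μ≲Z (≲-trans (≲-const (- nat s)) (≲-trans 1≲ℓ ℓ≲Z))

    -- Along `mixed-moment-suc`, a factor μ - s costs Z, while an additional central factor costs N,
    -- which is O(Z).
    mixed-moment≲ : ∀ s j → (λ p → mixed-moment s j (n p)) ≲ (λ p → Z p ^ s * N p ^ j)
    mixed-moment≲ zero    j =
      ≲-respˡ (λ p → mixed-moment-0 j (n p)) (≲-respʳ (λ p → sym (ℚ.*-identityˡ (N p ^ j)))
        (≲-reindex n (moment≲ j)))
    mixed-moment≲ (suc s) j = ≲-respˡ (λ p → mixed-moment-suc s j (n p)) (≲-+
      (≲-respʳ (λ p → sym (ℚ.*-assoc (Z p) (Z p ^ s) (N p ^ j)))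
        (≲-* (μ-s≲Z s) (mixed-moment≲ s j)))
      (≲-respʳ (λ p → sym (ℚ.*-assoc (Z p) (Z p ^ s) (N p ^ j)))
        (≲-trans (mixed-moment≲ s (suc j)) (≲-respˡ
          (λ p → solve 3 (λ z n y → z :* (n :* y) := n :* (z :* y)) refl (Z p ^ s) (N p) (N p ^ j))
          (≲-* N≲Z ≲-refl)))))

    -- Gains a factor 1/ℓ over mixed-moment≲, since X - μ has mean 0.
    mixed-moment-1≲ : ∀ s → (λ p → mixed-moment s 1 (n p)) ≲ (λ p → Z p ^ s * (N p * r p))
    mixed-moment-1≲ zero    =
      ≲-respˡ (λ p → trans (mixed-moment-0 1 (n p)) (moment-1 (n p) (n p) ℕ.≤-refl)) ≲-0
    mixed-moment-1≲ (suc s) = ≲-respˡ (λ p → mixed-moment-suc s 1 (n p)) (≲-+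
      (≲-respʳ (λ p → sym (ℚ.*-assoc (Z p) (Z p ^ s) (N p * r p)))
        (≲-* (μ-s≲Z s) (mixed-moment-1≲ s)))
      -- The second central power costs N², and writing one N as Z r produces the required r.
      (≲-respʳ (λ p → trans (cong (λ t → Z p ^ s * (N p * (t * 1ℚ))) (sym (Z*r p)))
          (solve 4 (λ z y n r → y :* (n :* (z :* r :* con 1ℚ)) := z :* y :* (n :* r)) refl
             (Z p) (Z p ^ s) (N p) (r p)))
        (mixed-moment≲ s 2)))

  -- The first two terms of the binomial expansion of (2 n (ℓ + d))^s, with (2 Z)^s taken out so
  -- that no exponent s - 1 is needed.
  main-term : ℕ → Point → ℚ
  main-term s p = (nat 2 * Z p) ^ s * (1ℚ + nat s * (d p * r p))

  private
    dr≲1 : (λ p → d p * r p) ≲ (λ _ → 1ℚ)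
    dr≲1 = ≲1-* d≲1 r≲1

    [2Z]^≲ : ∀ s → (λ p → (nat 2 * Z p) ^ s) ≲ (λ p → Z p ^ s)
    [2Z]^≲ = ≲-^ (≲-*ˡ (nat 2) ≲-refl)

    main-term≲ : ∀ s → main-term s ≲ (λ p → Z p ^ s)
    main-term≲ s = ≲-respʳ (λ p → ℚ.*-identityʳ (Z p ^ s)) (≲-* ([2Z]^≲ s) (≲-+ ≲-refl (≲-*ˡ (nat s) dr≲1)))

  error : ℕ → Point → ℚ
  error s p = mixed-moment s 0 (n p) - main-term s p

  -- Here μ - e = 2 Z (1 + d r), and (1 + s x)(1 + x) = 1 + (s + 1) x + s x² at x = d r. Multiplying
  -- the main term by μ - s thus yields the next main term, a contribution of e - s, and a quadratic
  -- one.
  error-suc : ∀ s p → error (suc s) p ≡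
    (μ (n p) - nat s) * error s p + (mixed-moment s 1 (n p) +
    ((e p - nat s) * main-term s p + nat s * (nat 2 * Z p * (nat 2 * Z p) ^ s * (d p * d p * (r p * r p)))))
  error-suc s p = begin
    mixed-moment (suc s) 0 (n p) - nat 2 * Z p * A * (1ℚ + nat (suc s) * (d p * r p))
      ≡⟨ cong₂ (λ x y → x - nat 2 * Z p * A * (1ℚ + y * (d p * r p))) (mixed-moment-suc s 0 (n p)) (nat-suc s) ⟩
    (m - nat s) * F + F₁ - nat 2 * Z p * A * (1ℚ + (nat s + 1ℚ) * (d p * r p))
      ≡⟨ solve 8 (λ m s F F₁ Z A d r →
           (m :- s) :* F :+ F₁ :- con (nat 2) :* Z :* A :* (con 1ℚ :+ (s :+ con 1ℚ) :* (d :* r)) :=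
           (m :- s) :* (F :- A :* (con 1ℚ :+ s :* (d :* r))) :+ (F₁ :+
           ((m :- con (nat 2) :* (Z :+ Z :* r :* d) :- s) :* (A :* (con 1ℚ :+ s :* (d :* r))) :+
           s :* (con (nat 2) :* Z :* A :* (d :* d :* (r :* r)))))) refl
           m (nat s) F F₁ (Z p) A (d p) (r p) ⟩
    (m - nat s) * error s p + (F₁ +
      ((m - nat 2 * (Z p + Z p * r p * d p) - nat s) * main-term s p + R))
      ≡⟨ cong (λ t → (m - nat s) * error s p + (F₁ + ((m - nat 2 * t - nat s) * main-term s p + R)))
           (trans (cong (λ t → Z p + t * d p) (Z*r p)) (sym (ℚ.*-distribˡ-+ (N p) (ℓ p) (d p)))) ⟩
    (m - nat s) * error s p + (F₁ + ((e p - nat s) * main-term s p + R)) ∎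
    where
    open ≡-Reasoning
    m  = μ (n p)
    A  = (nat 2 * Z p) ^ s
    F  = mixed-moment s 0 (n p)
    F₁ = mixed-moment s 1 (n p)
    R  = nat s * (nat 2 * Z p * A * (d p * d p * (r p * r p)))

  -- All four terms of `error-suc` are O(Z^(s+1) r²): the old error gains Z; the first mixed moment
  -- has size Z^s N r with N = Z r; `e` and the constant s are O(ℓ), hence O(Z r²); the quadratic
  -- term carries r² itself.
  error≲ : ∀ s → error s ≲ (λ p → Z p ^ s * (r p * r p))
  error≲ zero    = ≲-respˡ (λ p → trans
      (cong (_- main-term 0 p) (trans (mixed-moment-0 0 (n p)) (moment-0 (n p))))
      (solve 1 (λ x → con 1ℚ :- con 1ℚ :* (con 1ℚ :+ con 0ℚ :* x) := con 0ℚ) refl (d p * r p)))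
    ≲-0
  error≲ (suc s) = ≲-respˡ (error-suc s) (≲-+
    (≲-respʳ (λ p → sym (ℚ.*-assoc (Z p) (Z p ^ s) (r p * r p))) (≲-* (μ-s≲Z s) (error≲ s)))
    (≲-+
      (≲-respʳ (λ p → trans (cong (λ t → Z p ^ s * (t * r p)) (sym (Z*r p)))
          (solve 3 (λ z y r → y :* (z :* r :* r) := z :* y :* (r :* r)) refl (Z p) (Z p ^ s) (r p)))
        (mixed-moment-1≲ s))
      (≲-+
        (≲-respʳ (λ p → solve 3 (λ z y r → z :* (r :* r) :* y := z :* y :* (r :* r)) refl (Z p) (Z p ^ s) (r p))
          (≲-* (≲-trans (≲-+ e≲ℓ (≲-trans (≲-const (- nat s)) 1≲ℓ)) ℓ≲Zr²) (main-term≲ s)))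
        (≲-*ˡ (nat s) (≲-* ([2Z]^≲ (suc s))
          (≲-respʳ (λ p → ℚ.*-identityˡ (r p * r p)) (≲-* (≲1-* d≲1 d≲1) ≲-refl)))))))

open import Data.Integer.Base using (+_)
open import Defs
open Algebra.Properties.CommutativeSemiring.Exp commutativeSemiring
  using (^-distrib-*) renaming (_^_ to _^ℚ_)
open Harmonic using (nat; riemann)
open Expectation
open Moments
open Asymptotics
open Point

-- Transfer to real numbers.

seq-^ : ∀ x m k → seq (x ^ m) k ≡ seq x k ^ℚ m
seq-^ x zero    k = refl
seq-^ x (suc m) k = cong (seq x k ℚ.*_) (seq-^ x m k)

harmonic-log-diff : ∀ m n k → seq (harmonic-log m) k ℚ.- seq (harmonic-log n) k ≡
  riemann (suc k) n ℚ.- riemann (suc k) m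
harmonic-log-diff m n k = trans
  (cong₂ (λ i j → (harmonic (suc m) ℚ.- (harmonic i ℚ.- harmonic (suc k))) ℚ.-
                  (harmonic (suc n) ℚ.- (harmonic j ℚ.- harmonic (suc k))))
    (ℕ.*-comm (suc k) (suc m)) (ℕ.*-comm (suc k) (suc n)))
  (solve 5 (λ hm hn hk x y → (hm :- (x :- hk)) :- (hn :- (y :- hk)) := (y :- hn) :- (x :- hm)) refl
    (harmonic (suc m)) (harmonic (suc n)) (harmonic (suc k))
    (harmonic (suc m ℕ.* suc k)) (harmonic (suc n ℕ.* suc k)))

-- Goes through a later term `harmonic-log (M ⊔ m)`. One `unit m` is the distance of the two Riemann
-- sums, one the tolerance in the convergence to `γ`, and one the slack in the order of the reals.
γ-approximation : ∀ m → ∃[ K ] (∀ {k} → K ℕ.≤ k →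
  ℚ.∣ seq (harmonic-log m) k ℚ.- seq γ k ∣ ℚ.≤ unit m ℚ.+ (unit m ℚ.+ unit m))
γ-approximation m =
  let M , near = lim-converges harmonic-log harmonic-log-cauchy (unit m) (Rational.unit-pos m)
      K , b    = near {M ℕ.⊔ m} (ℕ.m≤m⊔n M m) (unit m) (Rational.unit-pos m)
  in K , λ {k} K≤k → ℚ.≤-trans
       (Rational.dist-triangle (seq (harmonic-log m) k) (seq (harmonic-log (M ℕ.⊔ m)) k) (seq γ k))
       (ℚ.+-mono-≤
         (subst (λ t → ℚ.∣ t ∣ ℚ.≤ unit m) (sym (harmonic-log-diff m (M ℕ.⊔ m) k))
           (Harmonic.riemann-dist k (ℕ.m≤n⊔m M m) ℕ.≤-refl))
         (b K≤k))

module _ (m : ℕ) (4≤n : 4 ℕ.≤ suc m) (k : ℕ)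
  (near : ℚ.∣ seq (harmonic-log m) k ℚ.- seq γ k ∣ ℚ.≤ unit m ℚ.+ (unit m ℚ.+ unit m)) where

  -- The sum of mesh 1 anchors all finer ones: by monotonicity they stay above H - 1, and by
  -- `riemann-upper`, with slack `unit 0` = 1, below H, at every index and not only in the limit.
  riemann-0 : riemann (suc m) 0 ≡ harmonic (suc m) ℚ.- 1ℚ
  riemann-0 = cong (λ t → harmonic t ℚ.- 1ℚ) (ℕ.*-identityˡ (suc m))

  harmonic-1≤riemann : harmonic (suc m) ℚ.- 1ℚ ℚ.≤ riemann (suc m) k
  harmonic-1≤riemann = subst (ℚ._≤ riemann (suc m) k) riemann-0 (Harmonic.riemann-mono m {0} {k} ℕ.z≤n)

  point : Point
  point = record
    { n          = suc m
    ; ℓ          = riemann (suc m) k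
    ; g          = seq γ k
    -- The threshold 4: the fourth harmonic number minus 1 is 13/12, whereas the third gives only
    -- 5/6.
    ; 1≤ℓ        = ℚ.≤-trans (ℚ.≤-trans (from-yes (1ℚ ℚ.≤? harmonic 4 ℚ.- 1ℚ))
                     (ℚ.+-monoˡ-≤ (ℚ.- 1ℚ) (Harmonic.harmonic-mono 4≤n))) harmonic-1≤riemann
    ; ℓ≤harmonic = ℚ.≤-trans (Harmonic.riemann-upper m {0} {k} ℕ.z≤n)
                     (ℚ.≤-reflexive (trans (cong (ℚ._+ 1ℚ) riemann-0)
                       (solve 1 (λ h → h :- con 1ℚ :+ con 1ℚ := h) refl (harmonic (suc m)))))
    ; harmonic≤  = subst (ℚ._≤ riemann (suc m) k ℚ.+ 1ℚ)
                     (solve 1 (λ h → h :- con 1ℚ :+ con 1ℚ := h) refl (harmonic (suc m)))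
                     (ℚ.+-monoˡ-≤ 1ℚ harmonic-1≤riemann)
    ; euler      = euler′
    }
    where
    open ℚ.≤-Reasoning
    N = nat (suc m)
    u = unit m
    L = riemann (suc m) k
    euler′ : ℚ.∣ N ℚ.* (harmonic (suc m) ℚ.- (L ℚ.+ seq γ k)) ∣ ℚ.≤ nat 3
    euler′ = begin
      ℚ.∣ N ℚ.* (harmonic (suc m) ℚ.- (L ℚ.+ seq γ k)) ∣
        ≡⟨ trans (ℚ.∣p*q∣≡∣p∣*∣q∣ N _) (cong₂ (λ x y → x ℚ.* ℚ.∣ y ∣) (ℚ.0≤p⇒∣p∣≡p (nat-nonneg (suc m)))
             (solve 3 (λ h l g → h :- (l :+ g) := h :- l :- g) refl (harmonic (suc m)) L (seq γ k))) ⟩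
      N ℚ.* ℚ.∣ harmonic (suc m) ℚ.- L ℚ.- seq γ k ∣
        ≤⟨ *-monoˡ (nat-nonneg (suc m)) near ⟩
      N ℚ.* (u ℚ.+ (u ℚ.+ u))
        ≡⟨ solve 2 (λ n u → n :* (u :+ (u :+ u)) := con (nat 3) :* (n :* u)) refl N u ⟩
      nat 3 ℚ.* (N ℚ.* u)
        ≡⟨ cong (nat 3 ℚ.*_) (nat-suc*unit m) ⟩
      nat 3 ∎

module _ (p : Point) where

  private
    N = nat (n p)
    L = ℓ p
    r = recip L
    d = g p ℚ.- nat 2

    L*r : L ℚ.* r ≡ 1ℚ
    L*r = trans (ℚ.*-comm L r) (Rational.recip-inverse (ℚ.<-≤-trans (ℚ.positive⁻¹ 1ℚ) (1≤ℓ p)))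

  main-term-expand : ∀ t → main-term (suc t) p ≡
    nat 2 ^ℚ suc t ℚ.* N ^ℚ suc t ℚ.* L ^ℚ suc t ℚ.+
    nat 2 ^ℚ suc t ℚ.* nat (suc t) ℚ.* d ℚ.* N ^ℚ suc t ℚ.* L ^ℚ t
  main-term-expand t = begin
    (nat 2 ℚ.* (N ℚ.* L)) ^ℚ suc t ℚ.* (1ℚ ℚ.+ T ℚ.* (d ℚ.* r))
      ≡⟨ cong (ℚ._* (1ℚ ℚ.+ T ℚ.* (d ℚ.* r))) (trans (^-distrib-* (nat 2) (N ℚ.* L) (suc t))
           (cong (A ℚ.*_) (^-distrib-* N L (suc t)))) ⟩
    A ℚ.* (B ℚ.* (L ℚ.* M)) ℚ.* (1ℚ ℚ.+ T ℚ.* (d ℚ.* r))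
      ≡⟨ solve 7 (λ A B L M T d r → A :* (B :* (L :* M)) :* (con 1ℚ :+ T :* (d :* r)) :=
           A :* B :* (L :* M) :+ A :* T :* d :* B :* M :* (L :* r)) refl A B L M T d r ⟩
    A ℚ.* B ℚ.* (L ℚ.* M) ℚ.+ A ℚ.* T ℚ.* d ℚ.* B ℚ.* M ℚ.* (L ℚ.* r)
      ≡⟨ cong (λ x → A ℚ.* B ℚ.* (L ℚ.* M) ℚ.+ x) (trans (cong (A ℚ.* T ℚ.* d ℚ.* B ℚ.* M ℚ.*_) L*r)
           (ℚ.*-identityʳ (A ℚ.* T ℚ.* d ℚ.* B ℚ.* M))) ⟩
    A ℚ.* B ℚ.* (L ℚ.* M) ℚ.+ A ℚ.* T ℚ.* d ℚ.* B ℚ.* M ∎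
    where
    open ≡-Reasoning
    A = nat 2 ^ℚ suc t
    B = N ^ℚ suc t
    M = L ^ℚ t
    T = nat (suc t)

  -- The case s = 1 stands apart because the exponent s - 2 is -1 and `logPower` then takes powers
  -- of the `inverse`, whose terms are `recip`s.
  error-scale-1 : ((N ℚ.* L) ^ℚ 1) ℚ.* (r ℚ.* r) ≡ N ^ℚ 1 ℚ.* r ^ℚ 1
  error-scale-1 = trans
    (solve 3 (λ n l r → n :* l :* con 1ℚ :* (r :* r) := n :* con 1ℚ :* (l :* r :* r)) refl N L r)
    (cong (λ x → N ^ℚ 1 ℚ.* x) (trans (cong (ℚ._* r) L*r) (ℚ.*-comm 1ℚ r)))

  error-scale-2+ : ∀ t → ((N ℚ.* L) ^ℚ (2 ℕ.+ t)) ℚ.* (r ℚ.* r) ≡ N ^ℚ (2 ℕ.+ t) ℚ.* L ^ℚ t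
  error-scale-2+ t = begin
    ((N ℚ.* L) ^ℚ (2 ℕ.+ t)) ℚ.* (r ℚ.* r)
      ≡⟨ cong (ℚ._* (r ℚ.* r)) (^-distrib-* N L (2 ℕ.+ t)) ⟩
    B ℚ.* (L ℚ.* (L ℚ.* M)) ℚ.* (r ℚ.* r)
      ≡⟨ solve 4 (λ B L M r → B :* (L :* (L :* M)) :* (r :* r) := B :* M :* ((L :* r) :* (L :* r)))
           refl B L M r ⟩
    B ℚ.* M ℚ.* ((L ℚ.* r) ℚ.* (L ℚ.* r))
      ≡⟨ trans (cong (λ x → B ℚ.* M ℚ.* (x ℚ.* x)) L*r) (ℚ.*-identityʳ (B ℚ.* M)) ⟩
    B ℚ.* M ∎
    where
    open ≡-Reasoning
    B = N ^ℚ (2 ℕ.+ t)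
    M = L ^ℚ t

  error-scale-nonneg : ∀ s → 0ℚ ℚ.≤ ((N ℚ.* L) ^ℚ s) ℚ.* (r ℚ.* r)
  error-scale-nonneg s = *-nonneg (^-nonneg (*-nonneg (nat-nonneg (n p)) (ℚ.<⇒≤ 0<L)) s) (*-nonneg 0≤r 0≤r)
    where
    0<L = ℚ.<-≤-trans (ℚ.positive⁻¹ 1ℚ) (1≤ℓ p)
    0≤r = ℚ.<⇒≤ (Rational.recip-pos 0<L)

β≡mixed-moment : ∀ s m → β s m ≡ mixed-moment s 0 m
β≡mixed-moment s m = trans (β≡E s m) (E-cong m (λ k → sym (ℚ.*-identityʳ (nat (k P s)))))

module _ (m : ℕ) (4≤n : 4 ℕ.≤ 2 ℕ.+ m) (k : ℕ)
  (near : ℚ.∣ seq (harmonic-log (suc m)) k ℚ.- seq γ k ∣ ℚ.≤ unit (suc m) ℚ.+ (unit (suc m) ℚ.+ unit (suc m)))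
  where

  private
    n′ = 2 ℕ.+ m
    p = point (suc m) 4≤n k near
    lg = log n′

  -- Real operations act termwise and the integer exponent computes to t, so only the powers have to
  -- be moved through `seq`.
  seq-error : ∀ t → seq (fromℚ (β (suc t) n′)
      - (fromℕ 2 ^ suc t * fromℕ n′ ^ suc t * logPower n′ (+ suc t)
         + fromℕ 2 ^ suc t * fromℕ (suc t) * (γ - fromℕ 2) * fromℕ n′ ^ suc t * logPower n′ (+ suc t ℤ.- + 1))) k
    ≡ error (suc t) p
  seq-error t = cong₂ ℚ._-_ (β≡mixed-moment (suc t) n′) (trans
    (cong₂ ℚ._+_
      (cong₂ ℚ._*_ (cong₂ ℚ._*_ (seq-^ (fromℕ 2) (suc t) k) (seq-^ (fromℕ n′) (suc t) k)) (seq-^ lg (suc t) k))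
      (cong₂ ℚ._*_ (cong₂ ℚ._*_ (cong (λ x → x ℚ.* nat (suc t) ℚ.* (seq γ k ℚ.- nat 2))
        (seq-^ (fromℕ 2) (suc t) k)) (seq-^ (fromℕ n′) (suc t) k)) (seq-^ lg t k)))
    (sym (main-term-expand p t)))

  seq-error-scale : ∀ t → seq (fromℕ n′ ^ suc t * logPower n′ (+ suc t ℤ.- + 2)) k ≡
    ((nat n′ ℚ.* ℓ p) ^ℚ suc t) ℚ.* (recip (ℓ p) ℚ.* recip (ℓ p))
  seq-error-scale zero    = trans
    (cong₂ ℚ._*_ (seq-^ (fromℕ n′) 1 k) (seq-^ (inverse lg (log-positive n′)) 1 k))
    (sym (error-scale-1 p))
  seq-error-scale (suc t) = trans
    (cong₂ ℚ._*_ (seq-^ (fromℕ n′) (2 ℕ.+ t) k) (seq-^ lg t k)) (sym (error-scale-2+ p t))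

mainTheorem3 : ∀ (s : ℕ) → 1 ℕ.≤ s →
    ∃[ C ] ∃[ N ] (∀ (n : ℕ) .{{_ : NonTrivial n}} → N ℕ.≤ n →
    ∣ fromℚ (β s n)
    - (fromℕ 2 ^ s * fromℕ n ^ s * logPower n (+ s)
    + fromℕ 2 ^ s * fromℕ s * (γ - fromℕ 2) * fromℕ n ^ s * logPower n (+ s ℤ.- + 1)) ∣
    ≤ C * (fromℕ n ^ s * logPower n (+ s ℤ.- + 2)))
-- `C` is the constant of the uniform bound over points and 4 the threshold of `point`. Only the
-- index `K`, from which the terms of `γ` are close enough, depends on n; from there the inequality
-- holds without the slack ε.
mainTheorem3 (suc t) _ = fromℚ C , 4 , λ { (suc (suc m)) 4≤n ε 0<ε →
    let K , near = γ-approximation (suc m)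
    in K , λ {k} K≤k →
      let p     = point (suc m) 4≤n k (near K≤k)
          scale = fromℕ (2 ℕ.+ m) ^ suc t * logPower (2 ℕ.+ m) (+ suc t ℤ.- + 2)
      in begin
      ℚ.∣ _ ∣
        ≡⟨ cong ℚ.∣_∣ (seq-error m 4≤n k (near K≤k) t) ⟩
      ℚ.∣ error (suc t) p ∣
        ≤⟨ bound p ⟩
      C ℚ.* ℚ.∣ _ ∣
        ≡⟨ cong (C ℚ.*_) (trans (ℚ.0≤p⇒∣p∣≡p (error-scale-nonneg p (suc t)))
             (sym (seq-error-scale m 4≤n k (near K≤k) t))) ⟩
      C ℚ.* seq scale k
        ≡⟨ sym (ℚ.+-identityʳ (C ℚ.* seq scale k)) ⟩
      C ℚ.* seq scale k ℚ.+ 0ℚ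
        ≤⟨ ℚ.+-monoʳ-≤ (C ℚ.* seq scale k) (ℚ.<⇒≤ 0<ε) ⟩
      C ℚ.* seq scale k ℚ.+ ε ∎ }
  where
  open ℚ.≤-Reasoning
  open BigO._≲_ (error≲ (suc t)) renaming (constant to C)
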